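{- Let $q$ be a prime power and let $\mathbb{F}_q$ be the finite field with $q$ elements. For each positive integer $n$, let $A_q(n)$ be the number of pairwise non-isomorphic directed graphs of the form $G(T/\mathbb{F}_q^n)$, where $T$ ranges over all $\mathbb{F}_q$-linear maps $T:\mathbb{F}_q^n\to\mathbb{F}_q^n$. Let $\mathcal P_n$ be the set of all nonzero vectors $\lambda=(\lambda_1,\ldots,\lambda_n)$ of nonnegative integers with $\sum_{i=1}^n \lambda_i\cdot i\le n$. For each $i\ge 1$, let $\sigma_i$ be the number of positive divisors of $q^i-1$, and let $\sigma_i^*$ be the number of positive integers $e$ such that $\mathrm{ord}_e q=i$, where $\mathrm{ord}_e q=\min\{j>0 : q^j\equiv 1 \pmod e\}$. Then $$\sum_{\lambda\in\mathcal P_n}\prod_{i=1}^n\binom{\sigma_i^*+\lambda_i-1}{\lambda_i}\le A_q(n)\le 2^{4\sqrt n}\cdot\sum_{\lambda\in\mathcal P_n}\prod_{i=1}^n\binom{\sigma_i+\lambda_i-1}{\lambda_i}.$$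
   Context: For an $\mathbb{F}_q$-linear map $T:\mathbb{F}_q^n\to\mathbb{F}_q^n$, the functional graph $G(T/\mathbb{F}_q^n)$ is the directed graph with vertex set $\mathbb{F}_q^n$ and edge set $\{v\to T(v) : v\in\mathbb{F}_q^n\}$. -}

module Defs where

open import Data.Nat as ℕ using (ℕ; zero; suc; _+_; _*_; _∸_; _^_; _≤_; _<_)
open import Data.Nat.Primality using (Prime)
open import Data.Nat.Divisibility using (_∣_; _∣?_)
open import Data.Nat.DivMod using (_%_)
open import Data.Nat.Combinatorics using (_C_)
open import Data.Fin as Fin using (Fin; toℕ)
open import Data.Vec as Vec using (Vec; []; _∷_; zipWith; map; lookup)
open import Data.List as List using (List; []; _∷_; filter; upTo; length; concatMap)
open import Data.Nat.ListAction using (sum; product)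
open import Data.Product using (Σ; ∃; _×_; _,_)
open import Relation.Binary.PropositionalEquality using (_≡_; _≢_)
open import Relation.Nullary using (¬_; Dec; yes; no)
open import Relation.Nullary.Decidable using (_×-dec_; ¬?)
open import Function.Bundles using (_↔_; _⇔_; Inverse)
open import Algebra.Structures using (IsCommutativeRing)
open import Level using (0ℓ)
open import Data.List.Relation.Unary.All using (All; all?)
import Data.Vec.Properties as VecP
open import Relation.Nullary.Decidable using (_→-dec_)

IsPrimePower : ℕ → Set
IsPrimePower q = Σ ℕ λ p → Σ ℕ λ k → Prime p × (1 ≤ k) × (q ≡ p ^ k)

record FiniteField (q : ℕ) : Set where
  field
    _+F_ _*F_ : Fin q → Fin q → Fin q
    -F_       : Fin q → Fin q
    0F 1F     : Fin q
    isCommutativeRing : IsCommutativeRing _≡_ _+F_ _*F_ -F_ 0F 1F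
    0≢1       : 0F ≢ 1F
    inverse   : ∀ x → x ≢ 0F → Σ (Fin q) λ y → x *F y ≡ 1F

module _ {q : ℕ} (F : FiniteField q) where
  open FiniteField F

  Vect : ℕ → Set
  Vect n = Vec (Fin q) n

  _+V_ : ∀ {n} → Vect n → Vect n → Vect n
  _+V_ = zipWith _+F_

  _·V_ : ∀ {n} → Fin q → Vect n → Vect n
  c ·V v = map (c *F_) v

  IsLinear : ∀ {n} → (Vect n → Vect n) → Set
  IsLinear T = (∀ u v → T (u +V v) ≡ T u +V T v)
             × (∀ c v → T (c ·V v) ≡ c ·V T v)

  LinearMap : ℕ → Set
  LinearMap n = Σ (Vect n → Vect n) IsLinear

  -- Isomorphism of the functional graphs G(T/F_q^n) and G(S/F_q^n):
  -- a bijection φ of the vertex set F_q^n such that u → v is an edge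
  -- of G(T) (i.e. T u ≡ v) iff φ u → φ v is an edge of G(S).
  FGIso : ∀ {n} → (Vect n → Vect n) → (Vect n → Vect n) → Set
  FGIso {n} T S = Σ (Vect n ↔ Vect n) λ φ →
    let f = Inverse.to φ in ∀ u v → (T u ≡ v) ⇔ (S (f u) ≡ f v)

  NumFGClasses : ℕ → ℕ → Set
  NumFGClasses n k = Σ (Fin k → LinearMap n) λ rep →
      (∀ i j → FGIso (Σ.proj₁ (rep i)) (Σ.proj₁ (rep j)) → i ≡ j)
    × (∀ (T : LinearMap n) → ∃ λ i → FGIso (Σ.proj₁ T) (Σ.proj₁ (rep i)))
    where open import Data.Product as Σ using ()

range1 : ℕ → List ℕ
range1 m = List.map suc (upTo m)

-- σ_i : the number of positive divisors of q^i - 1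
-- (all positive divisors of q^i - 1 ≥ 1 lie in 1, …, q^i - 1).
σ : ℕ → ℕ → ℕ
σ q i = length (filter (λ d → d ∣? (q ^ i ∸ 1)) (range1 (q ^ i ∸ 1)))

OrdIs : ℕ → ℕ → ℕ → Set
OrdIs q e' i = (1 ≤ i) × (q ^ i % suc e' ≡ 1 % suc e')
             × All (λ j → 1 ≤ j → q ^ j % suc e' ≢ 1 % suc e') (upTo i)

OrdIs? : ∀ q i e' → Dec (OrdIs q e' i)
OrdIs? q i e' = (1 ℕ.≤? i) ×-dec ((q ^ i % suc e' ℕ.≟ 1 % suc e')
  ×-dec all? (λ j → (1 ℕ.≤? j) →-dec ¬? (q ^ j % suc e' ℕ.≟ 1 % suc e')) (upTo i))

-- σ*_i : the number of positive integers e with ord_e q = i.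
-- Any such e divides q^i - 1, hence e < q^i (q ≥ 2), so it suffices to
-- count e ∈ {1, …, q^i}, i.e. e' = e - 1 ∈ {0, …, q^i - 1}.
σ* : ℕ → ℕ → ℕ
σ* q i = length (filter (OrdIs? q i) (upTo (q ^ i)))

allVecs : (n b : ℕ) → List (Vec ℕ n)
allVecs zero    b = [] ∷ []
allVecs (suc n) b = concatMap (λ x → List.map (x ∷_) (allVecs n b)) (upTo b)

-- Σ_{i=1}^n λ_i · i  (entry at position k : Fin n is λ_{k+1})
weight : ∀ {n} → Vec ℕ n → ℕ
weight {n} λ' = sum (List.map (λ k → lookup λ' k * suc (toℕ k)) (List.allFin n))

InP : ∀ n → Vec ℕ n → Set
InP n λ' = (¬ (λ' ≡ Vec.replicate n 0)) × (weight λ' ≤ n)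

InP? : ∀ n (λ' : Vec ℕ n) → Dec (InP n λ')
InP? n λ' = ¬? (VecP.≡-dec ℕ._≟_ λ' (Vec.replicate n 0)) ×-dec (weight λ' ℕ.≤? n)

-- P_n as a list (each entry λ_i ≤ n, so entries range over {0, …, n};
-- every element of P_n occurs exactly once)
P : (n : ℕ) → List (Vec ℕ n)
P n = filter (InP? n) (allVecs n (suc n))

sumP : (ℕ → ℕ) → ℕ → ℕ
sumP s n = sum (List.map (λ λ' → product (List.map
  (λ k → (s (suc (toℕ k)) + lookup λ' k ∸ 1) C lookup λ' k) (List.allFin n))) (P n))

{-# OPTIONS --safe #-}

-- Every linear map T is conjugate to a product of indecomposable ones, and an indecomposable map is cyclic over
-- F_q[T]. If it is nilpotent it is a shift. If it is invertible of order e p^t with p ∤ e, then N = T^e - 1 is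
-- nilpotent, ker N is a field with q^d elements, d = ord_e q, and |ker N^s| = q^(d min(s, L)) for dimension d L; so
-- the dimension i and e, a divisor of q^i - 1, determine all numbers |ker (T^k - 1)|, hence the functional graph.
--
-- Upper bound: the graph of T is determined by a multiset of pairs (i, e) together with the partition formed by the
-- sizes of the shifts. The empty multiset, absent from P_n, is absorbed by a factor 2, and 2 p(n) ≤ 16^⌊√n⌋ follows
-- from Erdős's recursion n p(n) = Σ v p(n - v j).
--
-- Lower bound: the cyclic rotation of F_q^e with p ∤ e has q^k fixed points under its k-th power for k ∣ e, and
-- comparing divisor sums with the orders of the elements of ℤ/e shows that a block with L = 1 and order e exists.
-- Sums of such blocks are told apart by |ker (T^k - 1)| = q^(Σ_{e ∣ k} i), again by divisor sums.

module Submission where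

open import Defs
open import Algebra.Bundles using (CommutativeRing; AbelianGroup)
import Algebra.Properties.AbelianGroup
import Algebra.Properties.CommutativeSemiring.Binomial
import Algebra.Properties.CommutativeSemiring.Exp
import Algebra.Properties.Ring
import Algebra.Properties.Semiring.Exp
import Algebra.Properties.Semiring.Mult
import Algebra.Properties.Semiring.Sum
open import Data.Empty using (⊥; ⊥-elim)
open import Data.Fin as Fin using (Fin; zero; suc; toℕ; fromℕ<)
import Data.Fin.Properties as FinP
open import Data.List as List using (List; []; _∷_; _++_)
open import Data.List.Membership.Propositional using (_∈_)
open import Data.List.Membership.Propositional.Properties
import Data.List.Properties as ListP
open import Data.List.Relation.Binary.Permutation.Propositional as Perm using (_↭_)
import Data.List.Relation.Binary.Permutation.Propositional.Properties as PermP
import Data.List.Relation.Unary.All as ListAll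
open ListAll using ([]; _∷_)
import Data.List.Relation.Unary.All.Properties as ListAllP
open import Data.List.Relation.Unary.AllPairs as AllPairs using (AllPairs; []; _∷_)
import Data.List.Relation.Unary.AllPairs.Properties as AllPairsP
open import Data.List.Relation.Unary.Any as Any using (here; there)
open import Data.List.Relation.Unary.Unique.Propositional using (Unique)
import Data.List.Relation.Unary.Unique.Propositional.Properties as UniqueP
open import Data.Nat as ℕ
  using (ℕ; zero; suc; _+_; _*_; _∸_; _^_; _≤_; _<_; z≤n; s≤s; _!; NonZero; >-nonZero; _⊓_)
open import Data.Nat.Combinatorics
  using (nCn≡1; nC1≡n; nCk+nC[k+1]≡[n+1]C[k+1]; k>n⇒nCk≡0) renaming (_C_ to _choose_)
import Data.Nat.Coprimality as Coprimality
open import Data.Nat.DivMod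
open import Data.Nat.Divisibility
open import Data.Nat.GCD using (gcd; gcd[m,n]∣m; gcd[m,n]∣n; gcd-greatest; gcd-GCD; module Bézout)
open import Data.Nat.Induction using (<-wellFounded)
open import Data.Nat.ListAction using (sum; product)
open import Data.Nat.ListAction.Properties using (sum-++)
open import Data.Nat.Primality
  using (Prime; prime⇒nonZero; prime⇒nonTrivial; prime⇒irreducible; euclidsLemma)
open import Data.Nat.Properties as ℕP using (≤-refl; ≤-trans; <-cmp)
open import Data.Nat.Solver using (module +-*-Solver)
open import Data.Product using (Σ; ∃; ∃₂; _×_; _,_; proj₁; proj₂; uncurry)
open import Data.Sum using (_⊎_; inj₁; inj₂; [_,_]′)
open import Data.Unit using (⊤; tt)
open import Data.Vec as Vec using (Vec; []; _∷_)
import Data.Vec.Properties as VecP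
open import Function using (_∘_; id; case_of_)
open import Function.Bundles using (Inverse; Equivalence; mk↔ₛ′; mk⇔)
open import Induction.WellFounded using (Acc; acc)
open import Relation.Binary.Definitions using (tri<; tri≈; tri>)
open import Relation.Binary.PropositionalEquality
  using (_≡_; _≢_; refl; sym; trans; cong; cong₂; subst; isMagma; module ≡-Reasoning)
import Relation.Binary.Reasoning.Setoid
open import Relation.Nullary using (¬_; Dec; yes; no; contradiction)
open import Relation.Nullary.Decidable using (_×-dec_; _→-dec_; ¬?; map′; from-yes)

-- No polynomial is ever factored. Polynomials in T are syntactic operators, and on a finite space
-- g^M with M = (q^n)! is idempotent, so on an indecomposable block every g is invertible or
-- nilpotent. This makes the algebra generated by T local with maximal ideal (N), where N is T
-- itself on nilpotent blocks, and cyclicity follows by splitting off the submodule generated by a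
-- vector v with N^l v nonzero and N^(l+1) = 0. Fixed points suffice because permutations of finite
-- sets are conjugate as soon as all their powers have equally many of them.
--
-- The exponent 4 leaves little room: log p(n) / √n tends to π √(2/3) < 2.57, while 4 log 2 > 2.77.
-- Using Σ 1/k² ≤ 7/4 in place of π²/6, the Erdős induction yields √7 < 2.65, still below. To stay
-- within the integers, the exponential is replaced, on each interval between consecutive squares,
-- by a geometric progression of ratio (3s+5)/(3s+1), about 1 + (4/3)/(s+1), where 4/3 just exceeds
-- √7/2. The gain over one interval tends to e^(8/3) < 16.

module FiniteSets where

  -- Finite sets, iteration, and conjugacy of permutations.

  private variable
    X Y : Set
    M N   : ℕ

  -- Elements are counted, not proofs: `index` may depend on the proof of `P x`, but `elem-index`
  -- and `elem-inj` compare elements only. Hence sums and existentials can serve as `P`.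
  record Card {X : Set} (P : X → Set) (N : ℕ) : Set where
    constructor mkCard
    field
      elem       : Fin N → X
      elem-∈     : ∀ i → P (elem i)
      index      : ∀ x → P x → Fin N
      elem-index : ∀ x p → elem (index x p) ≡ x
      elem-inj   : ∀ {i j} → elem i ≡ elem j → i ≡ j

  All : {X : Set} → X → Set
  All _ = ⊤

  module _ {P : X → Set} {Q : Y → Set} where

    card-≤ : Card P M → Card Q N → (f : X → Y) → (∀ x → P x → Q (f x)) →
             (∀ x y → P x → P y → f x ≡ f y → x ≡ y) → M ≤ N
    card-≤ A B f f-∈ f-inj = FinP.injective⇒≤ {f = λ i → B.index (f (A.elem i)) (f-∈ _ (A.elem-∈ i))}
      λ {i} {j} e → A.elem-inj (f-inj _ _ (A.elem-∈ i) (A.elem-∈ j)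
        (trans (sym (B.elem-index _ _)) (trans (cong B.elem e) (B.elem-index _ _))))
      where module A = Card A
            module B = Card B

    card-bij : Card P N → (f : X → Y) (g : Y → X) → (∀ x → P x → Q (f x)) → (∀ y → Q y → P (g y)) →
               (∀ y → Q y → f (g y) ≡ y) → (∀ x y → P x → P y → f x ≡ f y → x ≡ y) → Card Q N
    card-bij A f g f-∈ g-∈ fg f-inj = record
      { elem = f ∘ A.elem
      ; elem-∈ = λ i → f-∈ _ (A.elem-∈ i)
      ; index = λ y q → A.index (g y) (g-∈ y q)
      ; elem-index = λ y q → trans (cong f (A.elem-index _ _)) (fg y q)
      ; elem-inj = λ {i} {j} e → A.elem-inj (f-inj _ _ (A.elem-∈ i) (A.elem-∈ j) e) }
      where module A = Card A

  module _ {P Q : X → Set} where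

    card-⇔ : Card P N → (∀ x → P x → Q x) → (∀ x → Q x → P x) → Card Q N
    card-⇔ A to from = card-bij A id id to from (λ _ _ → refl) (λ _ _ _ _ e → e)

    card-unique : Card P M → Card Q N → (∀ x → P x → Q x) → (∀ x → Q x → P x) → M ≡ N
    card-unique A B to from = ℕP.≤-antisym (card-≤ A B id to (λ _ _ _ _ e → e))
                                           (card-≤ B A id from (λ _ _ _ _ e → e))

    card-⊎ : Card P M → Card Q N → (∀ x → P x → Q x → ⊥) → Card (λ x → P x ⊎ Q x) (M + N)
    card-⊎ {M} {N} A B disj = record
      { elem = [ A.elem , B.elem ]′ ∘ Fin.splitAt M
      ; elem-∈ = λ i → h (Fin.splitAt M i)
      ; index = λ { x (inj₁ p) → A.index x p Fin.↑ˡ N ; x (inj₂ q) → M Fin.↑ʳ B.index x q }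
      ; elem-index = λ { x (inj₁ p) → trans (cong [ A.elem , B.elem ]′ (FinP.splitAt-↑ˡ M (A.index x p) N)) (A.elem-index x p)
                       ; x (inj₂ q) → trans (cong [ A.elem , B.elem ]′ (FinP.splitAt-↑ʳ M N (B.index x q))) (B.elem-index x q) }
      ; elem-inj = λ {i} {j} e → trans (sym (FinP.join-splitAt M N i))
          (trans (cong (Fin.join M N) (inj (Fin.splitAt M i) (Fin.splitAt M j) e)) (FinP.join-splitAt M N j)) }
      where
      module A = Card A
      module B = Card B
      h : (s : Fin M ⊎ Fin N) → P ([ A.elem , B.elem ]′ s) ⊎ Q ([ A.elem , B.elem ]′ s)
      h (inj₁ i) = inj₁ (A.elem-∈ i)
      h (inj₂ i) = inj₂ (B.elem-∈ i)
      inj : (s t : Fin M ⊎ Fin N) → [ A.elem , B.elem ]′ s ≡ [ A.elem , B.elem ]′ t → s ≡ t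
      inj (inj₁ i) (inj₁ j) e = cong inj₁ (A.elem-inj e)
      inj (inj₁ i) (inj₂ j) e = ⊥-elim (disj _ (A.elem-∈ i) (subst Q (sym e) (B.elem-∈ j)))
      inj (inj₂ i) (inj₁ j) e = ⊥-elim (disj _ (A.elem-∈ j) (subst Q e (B.elem-∈ i)))
      inj (inj₂ i) (inj₂ j) e = cong inj₂ (B.elem-inj e)

  card-Fin : ∀ n → Card {Fin n} All n
  card-Fin n = mkCard id _ (λ i _ → i) (λ _ _ → refl) id

  card-empty : {P : X → Set} → (∀ x → ¬ P x) → Card P 0
  card-empty no-P = mkCard (λ ()) (λ ()) (λ x p → contradiction p (no-P x)) (λ x p → contradiction p (no-P x)) (λ { {()} })

  card-single : {P : X → Set} (x : X) → P x → (∀ y → P y → x ≡ y) → Card P 1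
  card-single x px uniq = mkCard (λ _ → x) (λ _ → px) (λ _ _ → zero) uniq (λ { {zero} {zero} _ → refl })

  card-× : {P : X → Set} {Q : Y → Set} → Card P M → Card Q N →
           Card (λ xy → P (proj₁ xy) × Q (proj₂ xy)) (M * N)
  card-× {M = M} {N = N} A B = record
    { elem = f ∘ Fin.remQuot N
    ; elem-∈ = λ _ → A.elem-∈ _ , B.elem-∈ _
    ; index = λ xy pq → Fin.combine (A.index _ (proj₁ pq)) (B.index _ (proj₂ pq))
    ; elem-index = λ xy pq → trans (cong f (FinP.remQuot-combine (A.index _ (proj₁ pq)) (B.index _ (proj₂ pq))))
                                   (cong₂ _,_ (A.elem-index _ _) (B.elem-index _ _))
    ; elem-inj = λ {i} {j} e → trans (sym (FinP.combine-remQuot {M} N i))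
        (trans (cong (uncurry Fin.combine) (cong₂ _,_ (A.elem-inj (cong proj₁ e)) (B.elem-inj (cong proj₂ e))))
               (FinP.combine-remQuot {M} N j)) }
    where
    module A = Card A
    module B = Card B
    f : Fin M × Fin N → _
    f (i , j) = A.elem i , B.elem j

  card-Vec : Card {X} All M → ∀ n → Card {Vec X n} All (M ^ n)
  card-Vec A zero    = card-single [] tt λ { [] _ → refl }
  card-Vec A (suc n) = card-bij (card-× A (card-Vec A n)) (uncurry _∷_) (λ { (x ∷ v) → x , v })
    _ _ (λ { (x ∷ v) _ → refl }) λ { _ _ _ _ refl → refl }

  card-dec-Fin : ∀ n {P : Fin n → Set} → (∀ i → Dec (P i)) → ∃ (Card P)
  card-dec-Fin zero    P? = 0 , card-empty λ ()
  card-dec-Fin (suc n) {P} P? with card-dec-Fin n (P? ∘ suc) | P? zero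
  ... | M , A | no ¬p = M , record
    { elem = suc ∘ A.elem
    ; elem-∈ = A.elem-∈
    ; index = λ { zero p → contradiction p ¬p ; (suc i) p → A.index i p }
    ; elem-index = λ { zero p → contradiction p ¬p ; (suc i) p → cong suc (A.elem-index i p) }
    ; elem-inj = A.elem-inj ∘ FinP.suc-injective }
    where module A = Card A
  ... | M , A | yes p₀ = suc M , record
    { elem = λ { zero → zero ; (suc i) → suc (A.elem i) }
    ; elem-∈ = λ { zero → p₀ ; (suc i) → A.elem-∈ i }
    ; index = λ { zero p → zero ; (suc i) p → suc (A.index i p) }
    ; elem-index = λ { zero p → refl ; (suc i) p → cong suc (A.elem-index i p) }
    ; elem-inj = λ { {zero} {zero} _ → refl ; {suc i} {suc j} e → cong suc (A.elem-inj (FinP.suc-injective e)) } }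
    where module A = Card A

  module _ {P : X → Set} (A : Card P N) {Q : X → Set} where
    private module A = Card A

    card-dec : (∀ x → Dec (Q x)) → ∃ (Card λ x → P x × Q x)
    card-dec Q? with card-dec-Fin N (Q? ∘ A.elem)
    ... | M , B = M , record
      { elem = A.elem ∘ B.elem
      ; elem-∈ = λ i → A.elem-∈ _ , B.elem-∈ i
      ; index = λ x pq → B.index (A.index x (proj₁ pq)) (subst Q (sym (A.elem-index _ _)) (proj₂ pq))
      ; elem-index = λ x pq → trans (cong A.elem (B.elem-index _ _)) (A.elem-index _ _)
      ; elem-inj = B.elem-inj ∘ A.elem-inj }
      where module B = Card B

    search : (∀ x → Dec (Q x)) → Dec (∃ λ x → P x × Q x)
    search Q? = map′ (λ { (i , q) → A.elem i , A.elem-∈ i , q })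
                     (λ { (x , p , q) → A.index x p , subst Q (sym (A.elem-index _ _)) q })
                     (FinP.any? (Q? ∘ A.elem))

  module _ {P : X → Set} (A : Card P N) {Q : X → Set} where

    card-minus : ∀ {K} → (∀ x → Dec (Q x)) → Card Q K → (∀ x → Q x → P x) →
                 ∃ λ M → Card (λ x → P x × ¬ Q x) M × N ≡ K + M
    card-minus {K} Q? B Q⊆P =
      proj₁ D , proj₂ D , card-unique A (card-⊎ B (proj₂ D) λ x q pq → proj₂ pq q) split (λ x → [ Q⊆P x , proj₁ ]′)
      where
      D = card-dec A (λ x → ¬? (Q? x))
      split : ∀ x → P x → Q x ⊎ (P x × ¬ Q x)
      split x p with Q? x
      ... | yes q = inj₁ q
      ... | no ¬q = inj₂ (p , ¬q)

  least : {P : ℕ → Set} → (∀ n → Dec (P n)) → ∀ m → P m → ∃ λ k → k ≤ m × P k × (∀ j → j < k → ¬ P j)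
  least P? zero    p = 0 , z≤n , p , λ j ()
  least P? (suc m) p with P? 0
  ... | yes p₀ = 0 , z≤n , p₀ , λ j ()
  ... | no ¬p₀ with least (P? ∘ suc) m p
  ... | k , k≤m , pk , min = suc k , s≤s k≤m , pk , λ { zero _ → ¬p₀ ; (suc j) (s≤s j<k) → min j j<k }

  iter : (X → X) → ℕ → X → X
  iter f zero    x = x
  iter f (suc n) x = f (iter f n x)

  module _ (f : X → X) where

    iter-+ : ∀ m n x → iter f (m + n) x ≡ iter f m (iter f n x)
    iter-+ zero    n x = refl
    iter-+ (suc m) n x = cong f (iter-+ m n x)

    iter-* : ∀ m n x → iter f (m * n) x ≡ iter (iter f n) m x
    iter-* zero    n x = refl
    iter-* (suc m) n x = trans (iter-+ n (m * n) x) (cong (iter f n) (iter-* m n x))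

    iter-fix : ∀ m {x} → f x ≡ x → iter f m x ≡ x
    iter-fix zero    e = refl
    iter-fix (suc m) e = trans (cong f (iter-fix m e)) e

    iter-fix-∣ : ∀ {k l x} → k ∣ l → iter f k x ≡ x → iter f l x ≡ x
    iter-fix-∣ {k} {x = x} (divides c refl) e = trans (iter-* c k x) (iter-iter c)
      where
      iter-iter : ∀ c → iter (iter f k) c x ≡ x
      iter-iter zero    = refl
      iter-iter (suc c) = trans (cong (iter f k) (iter-iter c)) e

    iter-comm : ∀ m n x → iter f m (iter f n x) ≡ iter f n (iter f m x)
    iter-comm m n x = trans (sym (iter-+ m n x)) (trans (cong (λ k → iter f k x) (ℕP.+-comm m n)) (iter-+ n m x))

    iter-closed : {P : X → Set} → (∀ x → P x → P (f x)) → ∀ m x → P x → P (iter f m x)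
    iter-closed c zero    x p = p
    iter-closed c (suc m) x p = c _ (iter-closed c m x p)

  iter-absorb : ∀ {f : X → X} {x z a b} → f z ≡ z → a ≤ b → iter f a x ≡ z → iter f b x ≡ z
  iter-absorb {f = f} {x} {z} {a} {b} fz a≤b e = trans (cong (λ k → iter f k x) (sym (ℕP.m∸n+n≡m a≤b)))
    (trans (iter-+ f (b ∸ a) a x) (trans (cong (iter f (b ∸ a)) e) (iter-fix f (b ∸ a) fz)))

  iter-cong : {f g : X → X} → (∀ x → f x ≡ g x) → ∀ m x → iter f m x ≡ iter g m x
  iter-cong e zero    x = refl
  iter-cong {f = f} e (suc m) x = trans (cong f (iter-cong e m x)) (e _)

  ∣! : ∀ {d n} → 1 ≤ d → d ≤ n → d ∣ n !
  ∣! {suc d} {n} _ d≤n = ∣-trans (m∣m*n (d !)) (m≤n⇒m!∣n! d≤n)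

  n≤n! : ∀ n → n ≤ n !
  n≤n! zero    = z≤n
  n≤n! (suc n) = ℕP.m≤m*n (suc n) (n !) {{>-nonZero (ℕP.1≤n! n)}}

  module _ (f : X → X) (A : Card {X} All N) where
    private module A = Card A

    eventually-periodic : ∀ x → ∃₂ λ i d → i < N × 1 ≤ d × d ≤ N × iter f (d + i) x ≡ iter f i x
    eventually-periodic x with FinP.pigeonhole (ℕP.n<1+n N) (λ i → A.index (iter f (toℕ i) x) tt)
    ... | i , j , i<j , e = toℕ i , toℕ j ∸ toℕ i , ≤-trans i<j j≤N , ℕP.m<n⇒0<n∸m i<j , ≤-trans (ℕP.m∸n≤m _ (toℕ i)) j≤N
        , trans (cong (λ k → iter f k x) (ℕP.m∸n+n≡m (ℕP.<⇒≤ i<j)))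
                (trans (sym (A.elem-index _ _)) (trans (cong A.elem (sym e)) (A.elem-index _ _)))
      where
      j≤N : toℕ j ≤ N
      j≤N = ℕP.≤-pred (FinP.toℕ<n j)

    -- N! exceeds every preperiod and is a multiple of every period.
    iter-idempotent : ∀ x → iter f (N !) (iter f (N !) x) ≡ iter f (N !) x
    iter-idempotent x with eventually-periodic x
    ... | i , d , i<N , 1≤d , d≤N , e = subst (λ y → iter f (N !) y ≡ y) N!≡ (iter-fix-∣ f (∣! 1≤d d≤N) per)
      where
      r = N ! ∸ i
      N!≡ : iter f r (iter f i x) ≡ iter f (N !) x
      N!≡ = trans (sym (iter-+ f r i x)) (cong (λ k → iter f k x) (ℕP.m∸n+n≡m (≤-trans (ℕP.<⇒≤ i<N) (n≤n! N))))
      per : iter f d (iter f r (iter f i x)) ≡ iter f r (iter f i x)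
      per = trans (iter-comm f d r _) (cong (iter f r) (trans (sym (iter-+ f d i x)) e))

  Injective : (X → Y) → Set
  Injective f = ∀ {x y} → f x ≡ f y → x ≡ y

  iter-inj : {f : X → X} → Injective f → ∀ n → Injective (iter f n)
  iter-inj f-inj zero    e = e
  iter-inj f-inj (suc n) e = iter-inj f-inj n (f-inj e)

  -- Cancelling one injective iterate from the idempotence of the N!-th iterate leaves the identity.
  iter-N! : {f : X → X} → Injective f → Card {X} All N → ∀ x → iter f (N !) x ≡ x
  iter-N! {N = N} {f} f-inj A x = iter-inj f-inj (N !) (iter-idempotent f A x)

  module _ {f : X → X} (f-inj : Injective f) {P : X → Set} (P-f : ∀ x → P x → P (f x)) (A : Card P N) where
    private module A = Card A

    periodic : ∀ x → P x → ∃ λ k → 1 ≤ k × iter f k x ≡ x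
    periodic x px with FinP.pigeonhole (ℕP.n<1+n N) (λ i → A.index (iter f (toℕ i) x) (iter-closed f P-f (toℕ i) x px))
    ... | i , j , i<j , e = toℕ j ∸ toℕ i , ℕP.m<n⇒0<n∸m i<j ,
        iter-inj f-inj (toℕ i) (trans (sym (iter-+ f (toℕ i) (toℕ j ∸ toℕ i) x))
          (trans (cong (λ k → iter f k x) (ℕP.m+[n∸m]≡n (ℕP.<⇒≤ i<j)))
                 (trans (sym (A.elem-index _ _)) (trans (cong A.elem (sym e)) (A.elem-index _ _)))))

  module Orbits {X : Set} (_≟_ : (x y : X) → Dec (x ≡ y)) {f : X → X} (f-inj : Injective f) where

    Exact : ℕ → X → Set
    Exact k x = 1 ≤ k × iter f k x ≡ x × (∀ j → 1 ≤ j → j < k → iter f j x ≢ x)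

    Orbit : ℕ → X → X → Set
    Orbit k x y = ∃ λ (j : Fin k) → iter f (toℕ j) x ≡ y

    orbit? : ∀ k x y → Dec (Orbit k x y)
    orbit? k x y = FinP.any? λ j → iter f (toℕ j) x ≟ y

    exact-∣ : ∀ {k l x} → Exact k x → iter f l x ≡ x → k ∣ l
    exact-∣ {k} {l} {x} (1≤k , per , min) e = m%n≡0⇒n∣m l k {{nz}} rem≡0
      where
      nz = >-nonZero 1≤k
      instance _ = nz
      rem : iter f (l % k) x ≡ x
      rem = trans (cong (iter f (l % k)) (sym (iter-fix-∣ f (n∣m*n (l / k)) per)))
              (trans (sym (iter-+ f (l % k) (l / k * k) x))
                (trans (cong (λ m → iter f m x) (sym (m≡m%n+[m/n]*n l k))) e))
      rem≡0 : l % k ≡ 0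
      rem≡0 with l % k | rem | m%n<n l k
      ... | zero  | _ | _ = refl
      ... | suc m | r | r<k = contradiction r (min (suc m) (s≤s z≤n) r<k)

    module _ {k x} (ex : Exact k x) where
      private
        1≤k = proj₁ ex
        per = proj₁ (proj₂ ex)
        min = proj₂ (proj₂ ex)

      iter-< : ∀ {i j} → i < j → j < k → iter f i x ≢ iter f j x
      iter-< {i} {j} i<j j<k e = min (j ∸ i) (ℕP.m<n⇒0<n∸m i<j) (ℕP.≤-<-trans (ℕP.m∸n≤m j i) j<k)
        (sym (iter-inj f-inj i (trans e (trans (cong (λ m → iter f m x) (sym (ℕP.m+[n∸m]≡n (ℕP.<⇒≤ i<j)))) (iter-+ f i (j ∸ i) x)))))

      iter-orbit-inj : ∀ {i j} → i < k → j < k → iter f i x ≡ iter f j x → i ≡ j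
      iter-orbit-inj {i} {j} i<k j<k e with <-cmp i j
      ... | tri< i<j _ _ = contradiction e (iter-< i<j j<k)
      ... | tri≈ _ i≡j _ = i≡j
      ... | tri> _ _ j<i = contradiction (sym e) (iter-< j<i i<k)

      card-orbit : Card (Orbit k x) k
      card-orbit = mkCard (λ j → iter f (toℕ j) x) (λ j → j , refl) (λ _ → proj₁) (λ _ → proj₂)
        λ {i} {j} e → FinP.toℕ-injective (iter-orbit-inj (FinP.toℕ<n i) (FinP.toℕ<n j) e)

      iter-orbit : ∀ m → m ≤ k → Orbit k x (iter f m x)
      iter-orbit m m≤k with ℕP.m≤n⇒m<n∨m≡n m≤k
      ... | inj₁ m<k = fromℕ< m<k , cong (λ m → iter f m x) (FinP.toℕ-fromℕ< m<k)
      ... | inj₂ refl = fromℕ< 1≤k , trans (cong (λ m → iter f m x) (FinP.toℕ-fromℕ< 1≤k)) (sym per)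

      -- Closing an orbit under preimages makes its complement stable under `f`, so that orbits can
      -- be removed one after another. The predecessor of `x` itself is `iter f (k ∸ 1) x`.
      orbit-f⁻ : ∀ y → Orbit k x (f y) → Orbit k x y
      orbit-f⁻ y (j , e) = go (toℕ j) (FinP.toℕ<n j) e
        where
        go : ∀ m → m < k → iter f m x ≡ f y → Orbit k x y
        go (suc m) m<k e = subst (Orbit k x) (f-inj e) (iter-orbit m (≤-trans (ℕP.n≤1+n m) (ℕP.<⇒≤ m<k)))
        go zero    _   e = subst (Orbit k x)
          (f-inj (trans (trans (cong (λ m → iter f m x) (ℕP.m+[n∸m]≡n 1≤k)) per) e)) (iter-orbit (k ∸ 1) (ℕP.m∸n≤m k 1))

      orbit-⊆ : {P : X → Set} → (∀ y → P y → P (f y)) → P x → ∀ y → Orbit k x y → P y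
      orbit-⊆ P-f px y (j , refl) = iter-closed f P-f (toℕ j) x px

      orbit-fix : ∀ l y → Orbit k x y → iter f l x ≡ x → iter f l y ≡ y
      orbit-fix l y (j , refl) e = trans (iter-comm f l (toℕ j) x) (cong (iter f (toℕ j)) e)

      orbit-fix⁻ : ∀ l y → Orbit k x y → iter f l y ≡ y → iter f l x ≡ x
      orbit-fix⁻ l y (j , refl) e = iter-inj f-inj (toℕ j) (trans (iter-comm f (toℕ j) l x) e)

      remove-f : {P : X → Set} → (∀ y → P y → P (f y)) → ∀ y → P y × ¬ Orbit k x y → P (f y) × ¬ Orbit k x (f y)
      remove-f P-f y (p , ¬o) = P-f y p , λ o → ¬o (orbit-f⁻ y o)

    -- Orbits of length k are removed until nothing is left. This plays the part of Lagrange's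
    -- theorem for multiplication and addition in the field and for T on a kernel.
    exact-divides : ∀ {k} N → Acc _<_ N → {P : X → Set} → (∀ y → P y → P (f y)) → (∀ y → P y → Exact k y) → Card P N → k ∣ N
    exact-divides zero _ _ _ _ = _ ∣0
    exact-divides {k} N@(suc N′) (acc rs) P-f P-ex A with Card.elem A zero | Card.elem-∈ A zero
    ... | x | px with card-minus A (orbit? k x) (card-orbit (P-ex x px)) (orbit-⊆ (P-ex x px) P-f px)
    ... | M , B , e = subst (k ∣_) (sym e) (∣m∣n⇒∣m+n ∣-refl
          (exact-divides M (rs (subst (M <_) (sym e) (ℕP.m<n+m M (proj₁ (P-ex x px))))) (remove-f (P-ex x px) P-f) (λ y → P-ex y ∘ proj₁) B))

  -- The maps are total while the laws hold only on `P` and `Q`; an induction can thus shrink the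
  -- two sets and keep the types.
  record Conjugate {X Y : Set} (f : X → X) (g : Y → Y) (P : X → Set) (Q : Y → Set) : Set where
    field
      to      : X → Y
      from    : Y → X
      to-∈    : ∀ x → P x → Q (to x)
      from-∈  : ∀ y → Q y → P (from y)
      from-to : ∀ x → P x → from (to x) ≡ x
      to-from : ∀ y → Q y → to (from y) ≡ y
      comm    : ∀ x → P x → to (f x) ≡ g (to x)

  module Glue {X Y : Set} (_≟X_ : (x y : X) → Dec (x ≡ y)) (_≟Y_ : (x y : Y) → Dec (x ≡ y))
              {f : X → X} {g : Y → Y} (f-inj : Injective f) (g-inj : Injective g)
              {k x y} (ex : Orbits.Exact _≟X_ f-inj k x) (ey : Orbits.Exact _≟Y_ g-inj k y) where
    private
      module F = Orbits _≟X_ f-inj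
      module G = Orbits _≟Y_ g-inj

    glue : (X → Y) → X → Y
    glue φ z with F.orbit? k x z
    ... | yes (j , _) = iter g (toℕ j) y
    ... | no _        = φ z

    glue-out : ∀ φ z → ¬ F.Orbit k x z → glue φ z ≡ φ z
    glue-out φ z ¬o with F.orbit? k x z
    ... | yes o = contradiction o ¬o
    ... | no _  = refl

    glue-< : ∀ φ m → m < k → glue φ (iter f m x) ≡ iter g m y
    glue-< φ m m<k with F.orbit? k x (iter f m x)
    ... | yes (j , e) = cong (λ m → iter g m y) (F.iter-orbit-inj ex (FinP.toℕ<n j) m<k e)
    ... | no ¬o       = contradiction (F.iter-orbit ex m (ℕP.<⇒≤ m<k)) ¬o

    -- The endpoint m = k is the wrap-around of the cycle, needed for commutation at its last point.
    glue-≤ : ∀ φ m → m ≤ k → glue φ (iter f m x) ≡ iter g m y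
    glue-≤ φ m m≤k with ℕP.m≤n⇒m<n∨m≡n m≤k
    ... | inj₁ m<k = glue-< φ m m<k
    ... | inj₂ refl = trans (cong (glue φ) (proj₁ (proj₂ ex))) (trans (glue-< φ 0 (proj₁ ex)) (sym (proj₁ (proj₂ ey))))

  module PermConj {X Y : Set} (_≟X_ : (x y : X) → Dec (x ≡ y)) (_≟Y_ : (x y : Y) → Dec (x ≡ y)) (x₀ : X) (y₀ : Y)
                  {f : X → X} {g : Y → Y} (f-inj : Injective f) (g-inj : Injective g) where
    private
      module F = Orbits _≟X_ f-inj
      module G = Orbits _≟Y_ g-inj

    FixX : (X → Set) → ℕ → X → Set
    FixX P k x = P x × iter f k x ≡ x

    FixY : (Y → Set) → ℕ → Y → Set
    FixY Q k y = Q y × iter g k y ≡ y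

    -- Equality of fixed-point counts, put as transport of an arbitrary count, so that no counting
    -- function has to be chosen.
    SameFix : (X → Set) → (Y → Set) → Set
    SameFix P Q = ∀ k → 1 ≤ k → ∀ M → Card (FixX P k) M → Card (FixY Q k) M

    -- The length k is minimal over the whole set and not only for one point: this yields an exact
    -- cycle and also excludes all shorter ones.
    minimal-cycle : ∀ {N P} → (∀ x → P x → P (f x)) → Card P N → ∀ x → P x →
      ∃₂ λ k x → P x × F.Exact k x × (∀ j → 1 ≤ j → j < k → ∀ z → ¬ FixX P j z)
    minimal-cycle P-f A x px with periodic f-inj P-f A x px
    ... | l , 1≤l , e with least (λ k → (1 ℕ.≤? k) ×-dec search A (λ x → iter f k x ≟X x)) l (1≤l , x , px , e)
    ... | k , _ , (1≤k , z , pz , fz) , min = k , z , pz ,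
        (1≤k , fz , λ j 1≤j j<k e → min j j<k (1≤j , z , pz , e)) , λ j 1≤j j<k w fw → min j j<k (1≤j , w , fw)

    module _ {P : X → Set} {Q : Y → Set} (P-f : ∀ x → P x → P (f x)) (Q-g : ∀ y → Q y → Q (g y)) where

      -- The k-th powers have equally many fixed points, so `Q` contains one as well; a smaller
      -- period j of it would contradict that the j-th power has none on either side.
      matching-cycle : ∀ {N k x} → Card P N → SameFix P Q → P x → F.Exact k x →
        (∀ j → 1 ≤ j → j < k → ∀ z → ¬ FixX P j z) → ∃ λ y → Q y × G.Exact k y
      matching-cycle {k = k} A same px (1≤k , fx , _) min with card-dec A (λ x → iter f k x ≟X x)
      ... | M , C = Card.elem D i , proj₁ (Card.elem-∈ D i) , 1≤k , proj₂ (Card.elem-∈ D i) ,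
          λ j 1≤j j<k e → FinP.¬Fin0 (Card.index (same j 1≤j 0 (card-empty (min j 1≤j j<k))) _ (proj₁ (Card.elem-∈ D i) , e))
        where
        D = same k 1≤k M C
        i = Card.index C _ (px , fx)

      module _ {k x y} (ex : F.Exact k x) (ey : G.Exact k y) (px : P x) (qy : Q y) where

        private
          fx : iter f k x ≡ x
          fx = proj₁ (proj₂ ex)
          gy : iter g k y ≡ y
          gy = proj₁ (proj₂ ey)
          module To = Glue _≟X_ _≟Y_ f-inj g-inj ex ey
          module From = Glue _≟Y_ _≟X_ g-inj f-inj ey ex

        P∖ : X → Set
        P∖ z = P z × ¬ F.Orbit k x z

        Q∖ : Y → Set
        Q∖ z = Q z × ¬ G.Orbit k y z

        -- A cycle of length k contributes k fixed points to the l-th power if k divides l, and none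
        -- otherwise, on both sides alike.
        remove-same : SameFix P Q → SameFix P∖ Q∖
        remove-same same l 1≤l M C with k ∣? l
        ... | no k∤l = card-⇔ (same l 1≤l M (card-⇔ C (λ { z ((pz , _) , e) → pz , e })
                         (λ { z (pz , e) → (pz , λ o → k∤l (F.exact-∣ ex (F.orbit-fix⁻ ex l z o e))) , e })))
                         (λ { z (qz , e) → (qz , λ o → k∤l (G.exact-∣ ey (G.orbit-fix⁻ ey l z o e))) , e })
                         (λ { z ((qz , _) , e) → qz , e })
        ... | yes k∣l with card-minus D (G.orbit? k y) (G.card-orbit ey)
                             (λ z o → G.orbit-⊆ ey Q-g qy z o , G.orbit-fix ey l z o (iter-fix-∣ g k∣l gy))
          where
          split : ∀ z → FixX P l z → FixX P∖ l z ⊎ F.Orbit k x z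
          split z (pz , e) with F.orbit? k x z
          ... | yes o = inj₂ o
          ... | no ¬o = inj₁ ((pz , ¬o) , e)
          D : Card (FixY Q l) (M + k)
          D = same l 1≤l (M + k) (card-⇔ (card-⊎ C (F.card-orbit ex) (λ { _ ((_ , ¬o) , _) o → ¬o o }))
                (λ { z (inj₁ ((pz , _) , e)) → pz , e
                   ; z (inj₂ o) → F.orbit-⊆ ex P-f px z o , F.orbit-fix ex l z o (iter-fix-∣ f k∣l fx) })
                split)
        ... | M′ , E , e = subst (Card _) (sym (ℕP.+-cancelˡ-≡ k M M′ (trans (ℕP.+-comm k M) e)))
              (card-⇔ E (λ { _ ((q , e) , ¬o) → (q , ¬o) , e }) (λ { _ ((q , ¬o) , e) → (q , e) , ¬o }))

        glue-conjugate : Conjugate f g P∖ Q∖ → Conjugate f g P Q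
        glue-conjugate rec = record
          { to = to ; from = from
          ; to-∈ = λ z pz → to-∈ z pz (F.orbit? k x z)
          ; from-∈ = λ z qz → from-∈ z qz (G.orbit? k y z)
          ; from-to = λ z pz → from-to z pz (F.orbit? k x z)
          ; to-from = λ z qz → to-from z qz (G.orbit? k y z)
          ; comm = λ z pz → comm z pz (F.orbit? k x z) }
          where
          module C = Conjugate rec
          to : X → Y
          to = To.glue C.to
          from : Y → X
          from = From.glue C.from
          to-∈ : ∀ z → P z → Dec (F.Orbit k x z) → Q (to z)
          to-∈ z pz (yes (j , refl)) = subst Q (sym (To.glue-< C.to (toℕ j) (FinP.toℕ<n j))) (iter-closed g Q-g (toℕ j) y qy)
          to-∈ z pz (no ¬o) = subst Q (sym (To.glue-out C.to z ¬o)) (proj₁ (C.to-∈ z (pz , ¬o)))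
          from-∈ : ∀ z → Q z → Dec (G.Orbit k y z) → P (from z)
          from-∈ z qz (yes (j , refl)) = subst P (sym (From.glue-< C.from (toℕ j) (FinP.toℕ<n j))) (iter-closed f P-f (toℕ j) x px)
          from-∈ z qz (no ¬o) = subst P (sym (From.glue-out C.from z ¬o)) (proj₁ (C.from-∈ z (qz , ¬o)))
          from-to : ∀ z → P z → Dec (F.Orbit k x z) → from (to z) ≡ z
          from-to z pz (yes (j , refl)) = trans (cong from (To.glue-< C.to (toℕ j) (FinP.toℕ<n j))) (From.glue-< C.from (toℕ j) (FinP.toℕ<n j))
          from-to z pz (no ¬o) = trans (cong from (To.glue-out C.to z ¬o))
            (trans (From.glue-out C.from _ (proj₂ (C.to-∈ z (pz , ¬o)))) (C.from-to z (pz , ¬o)))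
          to-from : ∀ z → Q z → Dec (G.Orbit k y z) → to (from z) ≡ z
          to-from z qz (yes (j , refl)) = trans (cong to (From.glue-< C.from (toℕ j) (FinP.toℕ<n j))) (To.glue-< C.to (toℕ j) (FinP.toℕ<n j))
          to-from z qz (no ¬o) = trans (cong to (From.glue-out C.from z ¬o))
            (trans (To.glue-out C.to _ (proj₂ (C.from-∈ z (qz , ¬o)))) (C.to-from z (qz , ¬o)))
          comm : ∀ z → P z → Dec (F.Orbit k x z) → to (f z) ≡ g (to z)
          comm z pz (yes (j , refl)) = trans (To.glue-≤ C.to (suc (toℕ j)) (FinP.toℕ<n j))
            (cong g (sym (To.glue-< C.to (toℕ j) (FinP.toℕ<n j))))
          comm z pz (no ¬o) = trans (To.glue-out C.to (f z) (λ o → ¬o (F.orbit-f⁻ ex z o)))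
            (trans (C.comm z (pz , ¬o)) (cong g (sym (To.glue-out C.to z ¬o))))

    -- Cycles of minimal length on both sides are matched and removed.
    conjugate : ∀ N → Acc _<_ N → {P : X → Set} {Q : Y → Set} →
      (∀ x → P x → P (f x)) → (∀ y → Q y → Q (g y)) → Card P N → Card Q N → SameFix P Q → Conjugate f g P Q
    -- On empty sets any maps will do; the base points `x₀` and `y₀` supply constant ones.
    conjugate zero _ P-f Q-g A B same = record
      { to = λ _ → y₀ ; from = λ _ → x₀
      ; to-∈ = λ x p → ⊥-elim (noX x p) ; from-∈ = λ y q → ⊥-elim (noY y q)
      ; from-to = λ x p → ⊥-elim (noX x p) ; to-from = λ y q → ⊥-elim (noY y q) ; comm = λ x p → ⊥-elim (noX x p) }
      where
      noX = λ x p → FinP.¬Fin0 (Card.index A x p)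
      noY = λ y q → FinP.¬Fin0 (Card.index B y q)
    conjugate N@(suc _) (acc rs) {P} {Q} P-f Q-g A B same =
      case minimal-cycle P-f A (Card.elem A zero) (Card.elem-∈ A zero) of λ where
        (k , x , px , ex , min) → case matching-cycle P-f Q-g A same px ex min of λ where
          (y , qy , ey) → case card-minus A (F.orbit? k x) (F.card-orbit ex) (F.orbit-⊆ ex P-f px) of λ where
            (M , A′ , N≡) → case card-minus B (G.orbit? k y) (G.card-orbit ey) (G.orbit-⊆ ey Q-g qy) of λ where
              (M′ , B′ , N≡′) → glue-conjugate P-f Q-g ex ey px qy
                (conjugate M (rs (subst (M <_) (sym N≡) (ℕP.m<n+m M (proj₁ ex))))
                  (F.remove-f ex P-f) (G.remove-f ey Q-g) A′
                  (subst (Card _) (ℕP.+-cancelˡ-≡ k M′ M (trans (sym N≡′) N≡)) B′)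
                  (remove-same P-f Q-g ex ey px qy same))

  infix 4 _≃_
  -- Isomorphism of functional graphs, between possibly different carriers, so that spaces and
  -- products of blocks can be compared.
  _≃_ : {X Y : Set} → (X → X) → (Y → Y) → Set
  f ≃ g = Conjugate f g All All

  mk≃ : {X Y : Set} {f : X → X} {g : Y → Y} (to : X → Y) (from : Y → X) → (∀ x → from (to x) ≡ x) → (∀ y → to (from y) ≡ y) →
        (∀ x → to (f x) ≡ g (to x)) → f ≃ g
  mk≃ to from from-to to-from comm = record
    { to = to ; from = from ; to-∈ = _ ; from-∈ = _ ; from-to = λ x _ → from-to x ; to-from = λ y _ → to-from y ; comm = λ x _ → comm x }

  module _ {X Y : Set} {f : X → X} {g : Y → Y} (c : f ≃ g) where
    private module C = Conjugate c

    ≃-to-inj : Injective C.to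
    ≃-to-inj {x} {y} e = trans (sym (C.from-to x tt)) (trans (cong C.from e) (C.from-to y tt))

    ≃-sym : g ≃ f
    ≃-sym = mk≃ C.from C.to (λ y → C.to-from y tt) (λ x → C.from-to x tt)
      λ y → ≃-to-inj (trans (C.to-from _ tt) (trans (cong g (sym (C.to-from y tt))) (sym (C.comm _ tt))))

    ≃-iter : ∀ k → iter f k ≃ iter g k
    ≃-iter k = mk≃ C.to C.from (λ x → C.from-to x tt) (λ y → C.to-from y tt) (comm k)
      where
      comm : ∀ k x → C.to (iter f k x) ≡ iter g k (C.to x)
      comm zero    x = refl
      comm (suc k) x = trans (C.comm _ tt) (cong g (comm k x))

    ≃-card-fix : ∀ {N} → Card (λ x → f x ≡ x) N → Card (λ y → g y ≡ y) N
    ≃-card-fix A = card-bij A C.to C.from (λ x e → trans (sym (C.comm x tt)) (cong C.to e))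
      (λ y e → ≃-to-inj (trans (C.comm _ tt) (trans (cong g (C.to-from y tt)) (trans e (sym (C.to-from y tt))))))
      (λ y _ → C.to-from y tt) (λ _ _ _ _ → ≃-to-inj)

  ≃-refl : {X : Set} {f : X → X} → f ≃ f
  ≃-refl = mk≃ id id (λ _ → refl) (λ _ → refl) (λ _ → refl)

  ≃-trans : {X Y Z : Set} {f : X → X} {g : Y → Y} {h : Z → Z} → f ≃ g → g ≃ h → f ≃ h
  ≃-trans c d = mk≃ (D.to ∘ C.to) (C.from ∘ D.from)
    (λ x → trans (cong C.from (D.from-to _ tt)) (C.from-to x tt))
    (λ z → trans (cong D.to (C.to-from _ tt)) (D.to-from z tt))
    (λ x → trans (cong D.to (C.comm x tt)) (D.comm _ tt))
    where
    module C = Conjugate c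
    module D = Conjugate d

  infixr 4 _⊗_
  _⊗_ : {X Y : Set} → (X → X) → (Y → Y) → X × Y → X × Y
  (f ⊗ g) (x , y) = f x , g y

  iter-⊗ : {X Y : Set} (f : X → X) (g : Y → Y) → ∀ k xy → iter (f ⊗ g) k xy ≡ (iter f k ⊗ iter g k) xy
  iter-⊗ f g zero    xy = refl
  iter-⊗ f g (suc k) xy = cong (f ⊗ g) (iter-⊗ f g k xy)

  ≃-⊗ : {X Y Z W : Set} {f : X → X} {g : Y → Y} {h : Z → Z} {i : W → W} → f ≃ g → h ≃ i → (f ⊗ h) ≃ (g ⊗ i)
  ≃-⊗ c d = mk≃ (λ { (x , z) → C.to x , D.to z }) (λ { (y , w) → C.from y , D.from w })
    (λ { (x , z) → cong₂ _,_ (C.from-to x tt) (D.from-to z tt) })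
    (λ { (y , w) → cong₂ _,_ (C.to-from y tt) (D.to-from w tt) })
    (λ { (x , z) → cong₂ _,_ (C.comm x tt) (D.comm z tt) })
    where
    module C = Conjugate c
    module D = Conjugate d

  ≃-swap : {X Y Z : Set} {f : X → X} {g : Y → Y} {h : Z → Z} → (f ⊗ g ⊗ h) ≃ (g ⊗ f ⊗ h)
  ≃-swap = mk≃ (λ { (x , y , z) → y , x , z }) (λ { (x , y , z) → y , x , z }) (λ _ → refl) (λ _ → refl) (λ _ → refl)

  ≃-assoc : {X Y Z : Set} {f : X → X} {g : Y → Y} {h : Z → Z} → ((f ⊗ g) ⊗ h) ≃ (f ⊗ g ⊗ h)
  ≃-assoc = mk≃ (λ { ((x , y) , z) → x , y , z }) (λ { (x , y , z) → (x , y) , z }) (λ _ → refl) (λ _ → refl) (λ _ → refl)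

open FiniteSets

all-dec : ∀ {N} {X : Set} → Card {X} All N → {P : X → Set} → (∀ x → Dec (P x)) → Dec (∀ x → P x)
all-dec A {P} P? with search A (λ x → ¬? (P? x))
... | yes (x , _ , ¬p) = no λ all → ¬p (all x)
... | no none = yes λ x → case P? x of λ { (yes p) → p ; (no ¬p) → contradiction (x , tt , ¬p) none }

-- Linear algebra over a finite field, with dimensions compared by counting.

module LinAlg {q : ℕ} (F : FiniteField q) where
  open FiniteField F

  K : CommutativeRing _ _
  K = record { isCommutativeRing = isCommutativeRing }

  module K = CommutativeRing K
  module KP = Algebra.Properties.Ring K.ring

  V : ℕ → Set
  V = Vect F

  infixl 6 _⊞_ _⊟_
  infixr 7 _∙_

  _⊞_ : ∀ {n} → V n → V n → V n
  _⊞_ = _+V_ F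

  _∙_ : ∀ {n} → Fin q → V n → V n
  _∙_ = _·V_ F

  0v : ∀ {n} → V n
  0v = Vec.replicate _ 0F

  neg : ∀ {n} → V n → V n
  neg = Vec.map -F_

  _⊟_ : ∀ {n} → V n → V n → V n
  u ⊟ v = u ⊞ neg v

  _≟v_ : ∀ {n} (u v : V n) → Dec (u ≡ v)
  _≟v_ = VecP.≡-dec Fin._≟_

  V-group : ℕ → AbelianGroup _ _
  V-group n = record
    { Carrier = V n ; _≈_ = _≡_ ; _∙_ = _⊞_ ; ε = 0v ; _⁻¹ = neg
    ; isAbelianGroup = record
      { isGroup = record
        { isMonoid = record
          { isSemigroup = record { isMagma = isMagma _⊞_ ; assoc = VecP.zipWith-assoc K.+-assoc }
          ; identity = VecP.zipWith-identityˡ K.+-identityˡ , VecP.zipWith-identityʳ K.+-identityʳ }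
        ; inverse = VecP.zipWith-inverseˡ K.-‿inverseˡ , VecP.zipWith-inverseʳ K.-‿inverseʳ
        ; ⁻¹-cong = cong neg }
      ; comm = VecP.zipWith-comm K.+-comm } }

  module VG {n} = AbelianGroup (V-group n)
  module VP {n} = Algebra.Properties.AbelianGroup (V-group n)

  open VG using () renaming (assoc to ⊞-assoc; comm to ⊞-comm; identityˡ to ⊞-identityˡ; identityʳ to ⊞-identityʳ;
                             inverseʳ to ⊟-self; inverseˡ to neg-⊞) public

  ∙-distribˡ : ∀ {n} c (u v : V n) → c ∙ (u ⊞ v) ≡ c ∙ u ⊞ c ∙ v
  ∙-distribˡ c []      []      = refl
  ∙-distribˡ c (x ∷ u) (y ∷ v) = cong₂ _∷_ (K.distribˡ c x y) (∙-distribˡ c u v)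

  ∙-distribʳ : ∀ {n} c d (v : V n) → (c +F d) ∙ v ≡ c ∙ v ⊞ d ∙ v
  ∙-distribʳ c d []      = refl
  ∙-distribʳ c d (x ∷ v) = cong₂ _∷_ (K.distribʳ x c d) (∙-distribʳ c d v)

  ∙-assoc : ∀ {n} c d (v : V n) → (c *F d) ∙ v ≡ c ∙ d ∙ v
  ∙-assoc c d []      = refl
  ∙-assoc c d (x ∷ v) = cong₂ _∷_ (K.*-assoc c d x) (∙-assoc c d v)

  1∙ : ∀ {n} (v : V n) → 1F ∙ v ≡ v
  1∙ []      = refl
  1∙ (x ∷ v) = cong₂ _∷_ (K.*-identityˡ x) (1∙ v)

  0∙ : ∀ {n} (v : V n) → 0F ∙ v ≡ 0v
  0∙ []      = refl
  0∙ (x ∷ v) = cong₂ _∷_ (K.zeroˡ x) (0∙ v)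

  ∙0 : ∀ {n} c → c ∙ 0v {n} ≡ 0v
  ∙0 {zero}  c = refl
  ∙0 {suc n} c = cong₂ _∷_ (K.zeroʳ c) (∙0 c)

  neg-∙ : ∀ {n} (v : V n) → neg v ≡ (-F 1F) ∙ v
  neg-∙ []      = refl
  neg-∙ (x ∷ v) = cong₂ _∷_ (sym (KP.-1*x≈-x x)) (neg-∙ v)

  interchange : ∀ {n} (a b c d : V n) → (a ⊞ b) ⊞ (c ⊞ d) ≡ (a ⊞ c) ⊞ (b ⊞ d)
  interchange a b c d = trans (⊞-assoc a b _) (trans (cong (a ⊞_)
    (trans (sym (⊞-assoc b c d)) (trans (cong (_⊞ d) (⊞-comm b c)) (⊞-assoc c b d)))) (sym (⊞-assoc a c _)))

  ⊟≡0 : ∀ {n} {u v : V n} → u ⊟ v ≡ 0v → u ≡ v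
  ⊟≡0 {u = u} {v} = VP.x∙y⁻¹≈ε⇒x≈y u v

  ⊟-⊞ : ∀ {n} (u v : V n) → (u ⊟ v) ⊞ v ≡ u
  ⊟-⊞ u v = trans (⊞-assoc u _ v) (trans (cong (u ⊞_) (neg-⊞ v)) (⊞-identityʳ u))

  ⊞-⊟ : ∀ {n} (u v : V n) → u ⊞ (v ⊟ u) ≡ v
  ⊞-⊟ u v = trans (⊞-comm u _) (⊟-⊞ v u)

  ⊞-cancel : ∀ {n} (u v : V n) → (u ⊞ v) ⊟ u ≡ v
  ⊞-cancel u v = VP.xyx⁻¹≈y u v

  IsLin : ∀ {m n} → (V m → V n) → Set
  IsLin T = (∀ u v → T (u ⊞ v) ≡ T u ⊞ T v) × (∀ c v → T (c ∙ v) ≡ c ∙ T v)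

  module _ {m n} {T : V m → V n} (L : IsLin T) where

    lin-0 : T 0v ≡ 0v
    lin-0 = trans (cong T (sym (0∙ 0v))) (trans (proj₂ L 0F 0v) (0∙ _))

    lin-neg : ∀ v → T (neg v) ≡ neg (T v)
    lin-neg v = trans (cong T (neg-∙ v)) (trans (proj₂ L _ v) (sym (neg-∙ _)))

    lin-⊟ : ∀ u v → T (u ⊟ v) ≡ T u ⊟ T v
    lin-⊟ u v = trans (proj₁ L u (neg v)) (cong (T u ⊞_) (lin-neg v))

    lin-inj : (∀ v → T v ≡ 0v → v ≡ 0v) → Injective T
    lin-inj ker {u} {v} e = ⊟≡0 (ker _ (trans (lin-⊟ u v) (trans (cong (_⊟ T v) e) (⊟-self _))))

  lin-∘ : ∀ {l m n} {S : V m → V n} {T : V l → V m} → IsLin S → IsLin T → IsLin (S ∘ T)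
  lin-∘ {S = S} (S+ , S·) (T+ , T·) = (λ u v → trans (cong S (T+ u v)) (S+ _ _)) , (λ c v → trans (cong S (T· c v)) (S· c _))

  lin-iter : ∀ {n} {T : V n → V n} → IsLin T → ∀ k → IsLin (iter T k)
  lin-iter L zero    = (λ _ _ → refl) , (λ _ _ → refl)
  lin-iter L (suc k) = lin-∘ L (lin-iter L k)

  comb : ∀ {n k} → Vec (V n) k → V k → V n
  comb []       []       = 0v
  comb (b ∷ bs) (c ∷ cs) = c ∙ b ⊞ comb bs cs

  comb-lin : ∀ {n k} (bs : Vec (V n) k) → IsLin (comb bs)
  comb-lin [] = (λ { [] [] → sym (⊞-identityˡ 0v) }) , (λ { c [] → sym (∙0 c) })
  comb-lin (b ∷ bs) with comb-lin bs
  ... | + , · = (λ { (x ∷ u) (y ∷ v) → trans (cong₂ _⊞_ (∙-distribʳ x y b) (+ u v)) (interchange _ _ _ _) })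
              , (λ { c (x ∷ u) → trans (cong₂ _⊞_ (∙-assoc c x b) (· c u)) (sym (∙-distribˡ c _ _)) })

  matrix : ∀ {k n} → (V k → V n) → Vec (V n) k
  matrix {zero}  T = []
  matrix {suc k} T = T (1F ∷ 0v) ∷ matrix (λ v → T (0F ∷ v))

  comb-matrix : ∀ {k n} {T : V k → V n} → IsLin T → ∀ v → comb (matrix T) v ≡ T v
  comb-matrix L [] = sym (lin-0 L)
  comb-matrix {T = T} L (c ∷ cs) = trans (cong₂ _⊞_ (sym (proj₂ L c _)) (comb-matrix L′ cs))
    (trans (sym (proj₁ L _ _)) (cong T (cong₂ _∷_ (trans (K.+-identityʳ _) (K.*-identityʳ c))
      (trans (cong (_⊞ cs) (∙0 c)) (⊞-identityˡ cs)))))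
    where
    L′ : IsLin (λ v → T (0F ∷ v))
    L′ = (λ u v → trans (cong (λ z → T (z ∷ (u ⊞ v))) (sym (K.+-identityˡ 0F))) (proj₁ L _ _))
       , (λ c v → trans (cong (λ z → T (z ∷ (c ∙ v))) (sym (K.zeroʳ c))) (proj₂ L c _))

  1<q : 1 < q
  1<q = go 0F 1F 0≢1
    where
    go : ∀ {q} (x y : Fin q) → x ≢ y → 1 < q
    go {1}           zero zero x≢y = contradiction refl x≢y
    go {suc (suc q)} _    _    _   = s≤s (s≤s z≤n)

  inv : Fin q → Fin q
  inv c with c Fin.≟ 0F
  ... | yes _  = 0F
  ... | no c≢0 = proj₁ (inverse c c≢0)

  inv-* : ∀ {c} → c ≢ 0F → inv c *F c ≡ 1F
  inv-* {c} c≢0 with c Fin.≟ 0F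
  ... | yes e  = contradiction e c≢0
  ... | no c≢0 = trans (K.*-comm _ c) (proj₂ (inverse c c≢0))

  ∙-cancel : ∀ {n c} {v : V n} → c ≢ 0F → c ∙ v ≡ 0v → v ≡ 0v
  ∙-cancel {c = c} {v} c≢0 e = trans (sym (1∙ v)) (trans (cong (_∙ v) (sym (inv-* c≢0)))
    (trans (∙-assoc _ c v) (trans (cong (inv c ∙_) e) (∙0 _))))

  card-V : ∀ n → Card {V n} All (q ^ n)
  card-V = card-Vec (card-Fin q)

  searchV : ∀ {n} {P : V n → Set} → (∀ v → Dec (P v)) → Dec (∃ P)
  searchV P? = map′ (λ { (v , _ , p) → v , p }) (λ { (v , p) → v , tt , p }) (search (card-V _) P?)

  allV : ∀ {n} {P : V n → Set} → (∀ v → Dec (P v)) → Dec (∀ v → P v)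
  allV = all-dec (card-V _)

  -- Dimensions are compared through cardinalities; this takes the place of the exchange lemma.
  q^-mono⁻ : ∀ {m n} → q ^ m ≤ q ^ n → m ≤ n
  q^-mono⁻ {m} {n} le = ℕP.≮⇒≥ λ n<m → ℕP.<⇒≱ (ℕP.^-monoʳ-< q 1<q n<m) le

  q^-inj : ∀ {m n} → q ^ m ≡ q ^ n → m ≡ n
  q^-inj e = ℕP.≤-antisym (q^-mono⁻ (ℕP.≤-reflexive e)) (q^-mono⁻ (ℕP.≤-reflexive (sym e)))

  record Subspace {n} (P : V n → Set) : Set where
    field
      dec   : ∀ v → Dec (P v)
      zero∈ : P 0v
      add   : ∀ u v → P u → P v → P (u ⊞ v)
      scale : ∀ c v → P v → P (c ∙ v)

    sub : ∀ u v → P u → P v → P (u ⊟ v)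
    sub u v p r = add _ _ p (subst P (sym (neg-∙ v)) (scale _ v r))

  kernel : ∀ {m n} {T : V m → V n} → IsLin T → Subspace (λ v → T v ≡ 0v)
  kernel {T = T} L = record
    { dec = λ v → T v ≟v 0v ; zero∈ = lin-0 L
    ; add = λ u v p r → trans (proj₁ L u v) (trans (cong₂ _⊞_ p r) (⊞-identityˡ 0v))
    ; scale = λ c v p → trans (proj₂ L c v) (trans (cong (c ∙_) p) (∙0 c)) }

  record Basis {n} (P : V n → Set) (d : ℕ) : Set where
    field
      vectors : Vec (V n) d
      injective : Injective (comb vectors)
      comb-∈ : ∀ c → P (comb vectors c)
      spans : ∀ v → P v → ∃ λ c → comb vectors c ≡ v

    -- Coordinates are found by exhaustive search; the zero vector is a default for vectors outside
    -- the span.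
    coord : V n → V d
    coord v with searchV (λ c → comb vectors c ≟v v)
    ... | yes (c , _) = c
    ... | no _        = 0v

    comb-coord : ∀ v → P v → comb vectors (coord v) ≡ v
    comb-coord v p with searchV (λ c → comb vectors c ≟v v)
    ... | yes (c , e) = e
    ... | no none     = contradiction (spans v p) none

    coord-comb : ∀ c → coord (comb vectors c) ≡ c
    coord-comb c = injective (comb-coord _ (comb-∈ c))

    coord-+ : ∀ u v → P u → P v → P (u ⊞ v) → coord (u ⊞ v) ≡ coord u ⊞ coord v
    coord-+ u v p r s = injective (trans (comb-coord _ s)
      (sym (trans (proj₁ (comb-lin vectors) _ _) (cong₂ _⊞_ (comb-coord u p) (comb-coord v r)))))

    coord-∙ : ∀ c v → P v → P (c ∙ v) → coord (c ∙ v) ≡ c ∙ coord v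
    coord-∙ c v p s = injective (trans (comb-coord _ s) (sym (trans (proj₂ (comb-lin vectors) c _) (cong (c ∙_) (comb-coord v p)))))

    card : Card P (q ^ d)
    card = card-bij (card-V d) (comb vectors) coord (λ c _ → comb-∈ c) _ comb-coord (λ _ _ _ _ → injective)

  module _ {n} {P : V n → Set} (S : Subspace P) where
    open Subspace S

    -- As long as some vector of P lies outside the span it is adjoined and stays independent of the
    -- others. At most n vectors fit, since n + 1 independent ones would give q^(n+1) ≤ q^n.
    extend-basis : ∀ {k} fuel → k + fuel ≡ n → (bs : Vec (V n) k) → Injective (comb bs) → (∀ c → P (comb bs c)) → ∃ (Basis P)
    extend-basis {k} fuel k+f bs bs-inj bs-∈ with searchV (λ v → dec v ×-dec ¬? (searchV λ c → comb bs c ≟v v))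
    ... | no none = k , record { vectors = bs ; injective = bs-inj ; comb-∈ = bs-∈
          ; spans = λ v p → case searchV (λ c → comb bs c ≟v v) of λ { (yes c) → c ; (no ¬c) → contradiction (v , p , ¬c) none } }
    ... | yes (v , p , ¬c) = continue fuel k+f
      where
      in-span : ∀ c cs → c ≢ 0F → c ∙ v ⊞ comb bs cs ≡ 0v → comb bs ((-F inv c) ∙ cs) ≡ v
      in-span c cs c≢0 e = ⊟≡0 (∙-cancel c≢0 (trans (∙-distribˡ c _ _) (trans (cong₂ _⊞_ lhs rhs)
         (trans (sym (∙-distribˡ (-F 1F) _ _)) (trans (cong ((-F 1F) ∙_) (trans (⊞-comm _ _) e)) (∙0 _))))))
        where
        lhs : c ∙ comb bs ((-F inv c) ∙ cs) ≡ (-F 1F) ∙ comb bs cs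
        lhs = trans (cong (c ∙_) (proj₂ (comb-lin bs) _ cs)) (trans (sym (∙-assoc c _ _)) (cong (_∙ comb bs cs)
          (trans (sym (KP.-‿distribʳ-* c (inv c))) (cong -F_ (trans (K.*-comm c _) (inv-* c≢0))))))
        rhs : c ∙ neg v ≡ (-F 1F) ∙ c ∙ v
        rhs = trans (cong (c ∙_) (neg-∙ v)) (trans (sym (∙-assoc c _ v)) (trans (cong (_∙ v) (K.*-comm c _)) (∙-assoc _ c v)))
      bs′-ker : ∀ c → comb (v ∷ bs) c ≡ 0v → c ≡ 0v
      bs′-ker (c ∷ cs) e = case c Fin.≟ 0F of λ where
          (yes refl) → cong (0F ∷_) (bs-inj (trans (sym (⊞-identityˡ _))
            (trans (cong (_⊞ comb bs cs) (sym (0∙ v))) (trans e (sym (lin-0 (comb-lin bs)))))))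
          (no c≢0) → contradiction ((-F inv c) ∙ cs , in-span c cs c≢0 e) ¬c
      bs′-inj : Injective (comb (v ∷ bs))
      bs′-inj = lin-inj (comb-lin (v ∷ bs)) bs′-ker
      bs′-∈ : ∀ c → P (comb (v ∷ bs) c)
      bs′-∈ (c ∷ cs) = add _ _ (scale c v p) (bs-∈ cs)
      continue : ∀ fuel → k + fuel ≡ n → ∃ (Basis P)
      continue (suc fuel) k+f = extend-basis fuel (trans (sym (ℕP.+-suc k fuel)) k+f) (v ∷ bs) bs′-inj bs′-∈
      continue zero k+0 = contradiction
        (q^-mono⁻ (card-≤ (card-V (suc k)) (card-V n) (comb (v ∷ bs)) _ (λ _ _ _ _ → bs′-inj)))
        (ℕP.<⇒≱ (s≤s (ℕP.≤-reflexive (trans (sym k+0) (ℕP.+-identityʳ k)))))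

    basis : ∃ (Basis P)
    basis = extend-basis n refl [] (λ { {[]} {[]} _ → refl }) (λ { [] → zero∈ })

    dim : ℕ
    dim = proj₁ basis

    card-subspace : Card P (q ^ dim)
    card-subspace = Basis.card (proj₂ basis)

-- Decomposition into indecomposable blocks.

module Decomposition {q : ℕ} (F : FiniteField q) where
  open FiniteField F using (0F; 1F)
  open LinAlg F

  Block : Set
  Block = Σ ℕ λ n → Σ (V n → V n) IsLin

  Product : List Block → Set
  Product []             = ⊤
  Product ((n , _) ∷ bs) = V n × Product bs

  step : ∀ bs → Product bs → Product bs
  step []                 = id
  step ((n , T , _) ∷ bs) = T ⊗ step bs

  step-++ : ∀ bs cs → step (bs ++ cs) ≃ (step bs ⊗ step cs)
  step-++ []       cs = mk≃ (tt ,_) proj₂ (λ _ → refl) (λ _ → refl) (λ _ → refl)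
  step-++ (b ∷ bs) cs = ≃-trans (≃-⊗ ≃-refl (step-++ bs cs)) (≃-sym ≃-assoc)

  -- Phrased through idempotent endomorphisms commuting with T, because the proof produces
  -- idempotents: powers of polynomials in T, and projections onto cyclic submodules.
  Indecomposable : ∀ {n} → (V n → V n) → Set
  Indecomposable T = ∀ E → IsLin E → (∀ v → E (E v) ≡ E v) → (∀ v → E (T v) ≡ T (E v)) →
                     (∀ v → E v ≡ 0v) ⊎ (∀ v → E v ≡ v)

  record Splitting {n} (T E : V n → V n) : Set where
    field
      lin      : IsLin E
      idem     : ∀ v → E (E v) ≡ E v
      commutes : ∀ v → E (T v) ≡ T (E v)
      nonzero  : ∃ λ v → E v ≢ 0v
      non-id   : ∃ λ v → E v ≢ v

  -- There are finitely many matrices, so a nontrivial commuting idempotent is found by search;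
  -- `comb-matrix` transfers a failed search to all linear maps.
  indecomposable? : ∀ {n} {T : V n → V n} → Indecomposable T ⊎ ∃ (Splitting T)
  indecomposable? {n} {T} with search (card-Vec (card-V n) n) splits?
    where
    splits? : (A : Vec (V n) n) → Dec (((∀ v → comb A (comb A v) ≡ comb A v) × (∀ v → comb A (T v) ≡ T (comb A v)))
                                       × ((∃ λ v → comb A v ≢ 0v) × (∃ λ v → comb A v ≢ v)))
    splits? A = (allV (λ v → _ ≟v _) ×-dec allV (λ v → _ ≟v _))
                ×-dec (searchV (λ v → ¬? (_ ≟v _)) ×-dec searchV (λ v → ¬? (_ ≟v _)))
  ... | yes (A , _ , (i , c) , nz , ni) = inj₂ (comb A , record
        { lin = comb-lin A ; idem = i ; commutes = c ; nonzero = nz ; non-id = ni })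
  ... | no none = inj₁ trivial
    where
    trivial : Indecomposable T
    trivial E L i c with allV (λ v → E v ≟v 0v) | allV (λ v → E v ≟v v)
    ... | yes z | _     = inj₁ z
    ... | no _  | yes j = inj₂ j
    ... | no nz | no nj = contradiction (A , tt , ((λ v → trans (trans (EA _) (cong E (EA v))) (trans (i v) (sym (EA v))))
                                                 , (λ v → trans (EA _) (trans (c v) (cong T (sym (EA v))))))
                                       , counter nz , counter nj) none
      where
      A = matrix E
      EA : ∀ v → comb A v ≡ E v
      EA = comb-matrix L
      counter : {g : V n → V n} → ¬ (∀ v → E v ≡ g v) → ∃ λ v → comb A v ≢ g v
      counter {g} ne with searchV (λ v → ¬? (comb A v ≟v g v))
      ... | yes x  = x
      ... | no all = contradiction (λ v → case comb A v ≟v g v of λ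
                       { (yes e) → trans (sym (EA v)) e ; (no ¬e) → contradiction (v , ¬e) all }) ne

  basis-nonempty : ∀ {n d} {P : V n → Set} → Basis P d → ∀ v → P v → v ≢ 0v → 1 ≤ d
  basis-nonempty {d = suc d} B v p v≢0 = s≤s z≤n
  basis-nonempty {d = zero}  B v p v≢0 with Basis.vectors B | Basis.spans B v p
  ... | [] | [] , e = contradiction (sym e) v≢0

  module _ {n} {T E : V n → V n} (L : IsLin T) (S : Splitting T E) where
    open Splitting S

    image-E : Subspace (λ v → E v ≡ v)
    image-E = record
      { dec = λ v → E v ≟v v ; zero∈ = lin-0 lin
      ; add = λ u v p r → trans (proj₁ lin u v) (cong₂ _⊞_ p r)
      ; scale = λ c v p → trans (proj₂ lin c v) (cong (c ∙_) p) }

    restrict : ∀ {P d} → Subspace P → Basis P d → (∀ v → P v → P (T v)) → Block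
    restrict {P} {d} S B T-P = d , T′ , (λ u v → trans (cong (coord ∘ T) (proj₁ (comb-lin vectors) u v))
        (trans (cong coord (proj₁ L _ _)) (coord-+ _ _ (in′ u) (in′ v) (Subspace.add S _ _ (in′ u) (in′ v)))))
      , (λ c v → trans (cong (coord ∘ T) (proj₂ (comb-lin vectors) c v))
        (trans (cong coord (proj₂ L _ _)) (coord-∙ c _ (in′ v) (Subspace.scale S c _ (in′ v)))))
      where
      open Basis B
      T′ : V d → V d
      T′ = coord ∘ T ∘ comb vectors
      in′ : ∀ c → P (T (comb vectors c))
      in′ c = T-P _ (comb-∈ c)

    module _ {d₁ d₂} (B₁ : Basis (λ v → E v ≡ v) d₁) (B₂ : Basis (λ v → E v ≡ 0v) d₂) where
      private
        module B₁ = Basis B₁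
        module B₂ = Basis B₂

      T-P₁ : ∀ v → E v ≡ v → E (T v) ≡ T v
      T-P₁ v e = trans (commutes v) (cong T e)

      T-P₂ : ∀ v → E v ≡ 0v → E (T v) ≡ 0v
      T-P₂ v e = trans (commutes v) (trans (cong T e) (lin-0 L))

      E-⊟ : ∀ v → E (v ⊟ E v) ≡ 0v
      E-⊟ v = trans (lin-⊟ lin v (E v)) (trans (cong (λ w → E v ⊟ w) (idem v)) (⊟-self _))

      coords : V n → V d₁ × V d₂
      coords v = B₁.coord (E v) , B₂.coord (v ⊟ E v)

      combine : V d₁ × V d₂ → V n
      combine (a , b) = comb B₁.vectors a ⊞ comb B₂.vectors b

      combine-coords : ∀ v → combine (coords v) ≡ v
      combine-coords v = trans (cong₂ _⊞_ (B₁.comb-coord _ (idem v)) (B₂.comb-coord _ (E-⊟ v))) (⊞-⊟ (E v) v)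

      E-combine : ∀ x → E (combine x) ≡ comb B₁.vectors (proj₁ x)
      E-combine (a , b) = trans (proj₁ lin _ _) (trans (cong₂ _⊞_ (B₁.comb-∈ a) (B₂.comb-∈ b)) (⊞-identityʳ _))

      coords-combine : ∀ x → coords (combine x) ≡ x
      coords-combine x@(a , b) = cong₂ _,_ (trans (cong B₁.coord (E-combine x)) (B₁.coord-comb a))
        (trans (cong B₂.coord (trans (cong (combine x ⊟_) (E-combine x)) (⊞-cancel _ _))) (B₂.coord-comb b))

      -- Image and kernel of `E` together parametrize the space bijectively, so q^d₁ q^d₂ = q^n.
      dims-add : d₁ + d₂ ≡ n
      dims-add = q^-inj (trans (ℕP.^-distribˡ-+-* q d₁ d₂)
        (card-unique (card-bij {Q = All} (card-× (card-V d₁) (card-V d₂)) combine coords _ _ (λ v _ → combine-coords v)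
          λ x y _ _ e → trans (sym (coords-combine x)) (trans (cong coords e) (coords-combine y))) (card-V n) _ _))

      coords-comm : ∀ v → coords (T v) ≡ (B₁.coord (T (comb B₁.vectors (B₁.coord (E v)))) , B₂.coord (T (comb B₂.vectors (B₂.coord (v ⊟ E v)))))
      coords-comm v = cong₂ _,_ (cong B₁.coord (trans (commutes v) (cong T (sym (B₁.comb-coord _ (idem v))))))
        (cong B₂.coord (trans (trans (cong (T v ⊟_) (commutes v)) (sym (lin-⊟ L v (E v)))) (cong T (sym (B₂.comb-coord _ (E-⊟ v))))))

      split-by : ∃₂ λ (b₁ b₂ : Block) → 1 ≤ proj₁ b₁ × 1 ≤ proj₁ b₂ × proj₁ b₁ + proj₁ b₂ ≡ n × (T ≃ (proj₁ (proj₂ b₁) ⊗ proj₁ (proj₂ b₂)))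
      split-by = restrict image-E B₁ T-P₁ , restrict (kernel lin) B₂ T-P₂ ,
        basis-nonempty B₁ (E (proj₁ nonzero)) (idem _) (proj₂ nonzero) ,
        basis-nonempty B₂ (proj₁ non-id ⊟ E (proj₁ non-id)) (E-⊟ _) (λ e → proj₂ non-id (sym (⊟≡0 e))) ,
        dims-add , mk≃ coords combine combine-coords coords-combine coords-comm

    split : ∃₂ λ (b₁ b₂ : Block) → 1 ≤ proj₁ b₁ × 1 ≤ proj₁ b₂ × proj₁ b₁ + proj₁ b₂ ≡ n × (T ≃ (proj₁ (proj₂ b₁) ⊗ proj₁ (proj₂ b₂)))
    split = split-by (proj₂ (basis image-E)) (proj₂ (basis (kernel lin)))

  data Indecomposables : List Block → Set where
    []  : Indecomposables []
    _∷_ : ∀ {n T L bs} → 1 ≤ n × Indecomposable T → Indecomposables bs → Indecomposables ((n , T , L) ∷ bs)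

  ++-indec : ∀ {bs cs} → Indecomposables bs → Indecomposables cs → Indecomposables (bs ++ cs)
  ++-indec []      ys = ys
  ++-indec (x ∷ xs) ys = x ∷ ++-indec xs ys

  total-dim : List Block → ℕ
  total-dim []       = 0
  total-dim (b ∷ bs) = proj₁ b + total-dim bs

  total-dim-++ : ∀ bs cs → total-dim (bs ++ cs) ≡ total-dim bs + total-dim cs
  total-dim-++ []       cs = refl
  total-dim-++ (b ∷ bs) cs = trans (cong (proj₁ b +_) (total-dim-++ bs cs)) (sym (ℕP.+-assoc (proj₁ b) _ _))

  decompose : ∀ n → Acc _<_ n → {T : V n → V n} → IsLin T →
              ∃ λ bs → Indecomposables bs × total-dim bs ≡ n × (T ≃ step bs)
  decompose zero _ {T} L = [] , [] , refl , mk≃ _ (λ _ → []) (λ { [] → refl }) (λ _ → refl) (λ _ → refl)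
  decompose n@(suc _) (acc rs) {T} L = case indecomposable? {T = T} of λ where
    (inj₁ ind) → (n , T , L) ∷ [] , (s≤s z≤n , ind) ∷ [] , ℕP.+-identityʳ n ,
                 mk≃ (_, tt) proj₁ (λ _ → refl) (λ _ → refl) (λ _ → refl)
    (inj₂ (E , S)) → case split L S of λ where
      ((a , T₁ , L₁) , (b , T₂ , L₂) , 1≤a , 1≤b , a+b , iso) →
        case decompose a (rs (subst (a <_) a+b (ℕP.m<m+n a 1≤b))) L₁ of λ where
          (bs , ind₁ , dim₁ , iso₁) → case decompose b (rs (subst (b <_) a+b (ℕP.m<n+m b 1≤a))) L₂ of λ where
            (cs , ind₂ , dim₂ , iso₂) → bs ++ cs , ++-indec ind₁ ind₂ ,
              trans (total-dim-++ bs cs) (trans (cong₂ _+_ dim₁ dim₂) a+b) ,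
              ≃-trans iso (≃-trans (≃-⊗ iso₁ iso₂) (≃-sym (step-++ bs cs)))

-- Frobenius, roots of polynomials, and arithmetic of the finite field.

C-absorb : ∀ n k → suc k * (suc n choose suc k) ≡ suc n * (n choose k)
C-absorb zero    zero    = refl
C-absorb zero    (suc k) = trans (cong (suc (suc k) *_) (k>n⇒nCk≡0 {1} {suc (suc k)} (s≤s (s≤s z≤n))))
                             (trans (ℕP.*-zeroʳ (suc (suc k))) (cong (1 *_) (sym (k>n⇒nCk≡0 {0} {suc k} (s≤s z≤n)))))
C-absorb (suc n) zero    = trans (ℕP.*-identityˡ _) (trans (nC1≡n (suc (suc n))) (sym (ℕP.*-identityʳ _)))
C-absorb (suc n) (suc k) = begin
  suc (suc k) * (suc (suc n) choose suc (suc k))                ≡⟨ cong (suc (suc k) *_) (sym (nCk+nC[k+1]≡[n+1]C[k+1] (suc n) (suc k))) ⟩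
  suc (suc k) * (c + (suc n choose suc (suc k)))                ≡⟨ ℕP.*-distribˡ-+ (suc (suc k)) c _ ⟩
  (c + suc k * c) + suc (suc k) * (suc n choose suc (suc k))    ≡⟨ cong₂ (λ a b → (c + a) + b) (C-absorb n k) (C-absorb n (suc k)) ⟩
  (c + suc n * (n choose k)) + suc n * (n choose suc k)              ≡⟨ ℕP.+-assoc c _ _ ⟩
  c + (suc n * (n choose k) + suc n * (n choose suc k))              ≡⟨ cong (c +_) (sym (ℕP.*-distribˡ-+ (suc n) (n choose k) _)) ⟩
  c + suc n * (n choose k + n choose suc k)                          ≡⟨ cong (λ a → c + suc n * a) (nCk+nC[k+1]≡[n+1]C[k+1] n k) ⟩
  suc (suc n) * c                                          ∎
  where
  open ≡-Reasoning
  c = suc n choose suc k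

-- In k C(p, k) = p C(p-1, k-1) the prime p divides the right side but is too large to divide k.
prime∣C : ∀ {p k} → Prime p → 1 ≤ k → k < p → p ∣ (p choose k)
prime∣C {suc p} {suc k} pr _ k<p with euclidsLemma (suc k) (suc p choose suc k) pr (subst (suc p ∣_) (sym (C-absorb p k)) (m∣m*n (p choose k)))
... | inj₁ p∣k = contradiction (∣⇒≤ p∣k) (ℕP.<⇒≱ k<p)
... | inj₂ p∣C = p∣C

module CharacteristicP {a ℓ} (R : CommutativeRing a ℓ) where
  open CommutativeRing R hiding (refl; sym; trans; zero) renaming (_+_ to _+R_; _*_ to _*R_)
  open Algebra.Properties.Semiring.Mult semiring renaming (_×_ to _×R_)
  open Algebra.Properties.Semiring.Exp semiring renaming (_^_ to _^R_)
  open Algebra.Properties.Semiring.Sum semiring renaming (sum to ∑)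
  open Algebra.Properties.CommutativeSemiring.Binomial commutativeSemiring
  open Relation.Binary.Reasoning.Setoid setoid

  module Frobenius {p : ℕ} (pr : Prime p) (char : ∀ x → (p ×R x) ≈ 0#) where

    ×-∣ : ∀ {n} x → p ∣ n → (n ×R x) ≈ 0#
    ×-∣ x (divides m refl) = begin
      ((m * p) ×R x)   ≈⟨ ×-assocˡ x m p ⟨
      (m ×R (p ×R x))  ≈⟨ ×-congʳ m (char x) ⟩
      (m ×R 0#)        ≈⟨ ×-zero m ⟩
      0#               ∎
      where
      ×-zero : ∀ m → (m ×R 0#) ≈ 0#
      ×-zero zero    = CommutativeRing.refl R
      ×-zero (suc m) = CommutativeRing.trans R (+-identityˡ _) (×-zero m)

    frobenius : ∀ x y → (x +R y) ^R p ≈ x ^R p +R y ^R p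
    frobenius x y = go p refl pr
      where
      go : ∀ n → n ≡ p → Prime n → (x +R y) ^R n ≈ x ^R n +R y ^R n
      go (suc n) refl pr = begin
        (x +R y) ^R suc n                             ≈⟨ theorem (suc n) x y ⟩
        t zero +R ∑ (t ∘ suc)                       ≈⟨ +-cong t-zero (sum-init-last (t ∘ suc)) ⟩
        y ^R suc n +R (∑ (λ i → t (suc (Fin.inject₁ i))) +R t (suc (Fin.fromℕ n)))
          ≈⟨ +-congˡ (+-cong (CommutativeRing.trans R (sum-cong-≋ t-mid) (sum-replicate-zero n)) t-last) ⟩
        y ^R suc n +R (0# +R x ^R suc n)              ≈⟨ +-congˡ (+-identityˡ _) ⟩
        y ^R suc n +R x ^R suc n                      ≈⟨ +-comm _ _ ⟩
        x ^R suc n +R y ^R suc n                      ∎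
        where
        t = binomialTerm x y (suc n)
        t-zero : t zero ≈ y ^R suc n
        t-zero = CommutativeRing.trans R (+-identityʳ _) (*-identityˡ _)
        t-mid : ∀ i → t (suc (Fin.inject₁ i)) ≈ 0#
        t-mid i = ×-∣ _ (prime∣C pr (s≤s z≤n) (s≤s (subst (_< n) (sym (FinP.toℕ-inject₁ i)) (FinP.toℕ<n i))))
        t-last : t (suc (Fin.fromℕ n)) ≈ x ^R suc n
        t-last rewrite FinP.toℕ-fromℕ n | nCn≡1 (suc n) | ℕP.n∸n≡0 n = CommutativeRing.trans R (+-identityʳ _) (*-identityʳ _)

    frobenius^ : ∀ m x y → (x +R y) ^R (p ^ m) ≈ x ^R (p ^ m) +R y ^R (p ^ m)
    frobenius^ zero    x y = CommutativeRing.trans R (*-identityʳ _) (+-cong (CommutativeRing.sym R (*-identityʳ _)) (CommutativeRing.sym R (*-identityʳ _)))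
    frobenius^ (suc m) x y = begin
      (x +R y) ^R (p * p ^ m)                       ≈⟨ ^-assocʳ _ p (p ^ m) ⟨
      ((x +R y) ^R p) ^R (p ^ m)                    ≈⟨ ^-congˡ (p ^ m) (frobenius x y) ⟩
      (x ^R p +R y ^R p) ^R (p ^ m)                 ≈⟨ frobenius^ m _ _ ⟩
      (x ^R p) ^R (p ^ m) +R (y ^R p) ^R (p ^ m)    ≈⟨ +-cong (^-assocʳ _ p (p ^ m)) (^-assocʳ _ p (p ^ m)) ⟩
      x ^R (p * p ^ m) +R y ^R (p * p ^ m)          ∎

module Polynomials {a ℓ} (R : CommutativeRing a ℓ) where
  open CommutativeRing R hiding (refl; sym; trans; zero) renaming (_+_ to _+R_; _*_ to _*R_; -_ to -R_; _-_ to _-R_)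
  open Algebra.Properties.Semiring.Exp semiring renaming (_^_ to _^R_)
  open Relation.Binary.Reasoning.Setoid setoid
  open Algebra.Properties.Ring ring

  -- cs lists the non-leading coefficients of a monic polynomial.
  monic : ∀ {m} → Vec Carrier m → Carrier → Carrier
  monic []       x = 1#
  monic (c ∷ cs) x = c +R x *R monic cs x

  -- Synthetic division by x - r: the quotient stays monic and the remainder is the value at r.
  divide : ∀ {m} (cs : Vec Carrier (suc m)) r → ∃ λ (ds : Vec Carrier m) → ∀ x → monic cs x ≈ (x -R r) *R monic ds x +R monic cs r
  divide (c ∷ []) r = [] , λ x → begin
    c +R x *R 1#                               ≈⟨ +-comm c _ ⟩
    x *R 1# +R c                               ≈⟨ +-congʳ (*-congʳ (CommutativeRing.sym R (split x r))) ⟩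
    ((x -R r) +R r) *R 1# +R c                 ≈⟨ +-congʳ (distribʳ 1# _ r) ⟩
    ((x -R r) *R 1# +R r *R 1#) +R c           ≈⟨ +-assoc _ _ c ⟩
    (x -R r) *R 1# +R (r *R 1# +R c)           ≈⟨ +-congˡ (+-comm _ c) ⟩
    (x -R r) *R 1# +R (c +R r *R 1#)           ∎
    where
    split : ∀ x r → (x -R r) +R r ≈ x
    split x r = CommutativeRing.trans R (+-assoc _ _ _) (CommutativeRing.trans R (+-congˡ (-‿inverseˡ r)) (+-identityʳ x))
  divide (c ∷ cs@(_ ∷ _)) r with divide cs r
  ... | ds , div = (monic cs r ∷ ds) , λ x → begin
    c +R x *R monic cs x                                             ≈⟨ +-congˡ (*-congˡ (div x)) ⟩
    c +R x *R ((x -R r) *R monic ds x +R ρ)                          ≈⟨ +-congˡ (distribˡ x _ ρ) ⟩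
    c +R (x *R ((x -R r) *R monic ds x) +R x *R ρ)                   ≈⟨ +-congˡ (+-cong (CommutativeRing.trans R (CommutativeRing.sym R (*-assoc _ _ _))
                                                                          (CommutativeRing.trans R (*-congʳ (*-comm x _)) (*-assoc _ _ _)))
                                                                          (CommutativeRing.trans R (*-congʳ (CommutativeRing.sym R (split x r))) (distribʳ ρ _ r))) ⟩
    c +R ((x -R r) *R (x *R monic ds x) +R ((x -R r) *R ρ +R r *R ρ))  ≈⟨ +-congˡ (CommutativeRing.sym R (+-assoc _ _ _)) ⟩
    c +R (((x -R r) *R (x *R monic ds x) +R (x -R r) *R ρ) +R r *R ρ)  ≈⟨ +-congˡ (+-congʳ (CommutativeRing.trans R (+-comm _ _) (CommutativeRing.sym R (distribˡ _ ρ _)))) ⟩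
    c +R ((x -R r) *R (ρ +R x *R monic ds x) +R r *R ρ)                ≈⟨ CommutativeRing.trans R (CommutativeRing.sym R (+-assoc _ _ _)) (CommutativeRing.trans R (+-congʳ (+-comm c _)) (+-assoc _ _ _)) ⟩
    (x -R r) *R (ρ +R x *R monic ds x) +R (c +R r *R ρ)                ∎
    where
    ρ = monic cs r
    split : ∀ x r → (x -R r) +R r ≈ x
    split x r = CommutativeRing.trans R (+-assoc _ _ _) (CommutativeRing.trans R (+-congˡ (-‿inverseˡ r)) (+-identityʳ x))

  module Roots (1≉0 : ¬ (1# ≈ 0#)) (domain : ∀ x y → x *R y ≈ 0# → x ≈ 0# ⊎ y ≈ 0#) where

    roots-≤ : ∀ {m} (cs : Vec Carrier m) rs → AllPairs (λ x y → ¬ (x ≈ y)) rs → ListAll.All (λ r → monic cs r ≈ 0#) rs → List.length rs ≤ m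
    roots-≤ cs       []       _        _        = z≤n
    roots-≤ []       (r ∷ rs) _        (z ∷ _)  = contradiction z 1≉0
    roots-≤ (c ∷ cs) (r ∷ rs) (r≉ ∷ d) (z ∷ zs) with divide (c ∷ cs) r
    ... | ds , div = s≤s (roots-≤ ds rs d (ListAll.zipWith root (r≉ , zs)))
      where
      root : ∀ {x} → ¬ (r ≈ x) × monic (c ∷ cs) x ≈ 0# → monic ds x ≈ 0#
      root {x} (r≉x , zx) with domain (x -R r) (monic ds x) (CommutativeRing.trans R (CommutativeRing.sym R (+-identityʳ _))
                                (CommutativeRing.trans R (+-congˡ (CommutativeRing.sym R z)) (CommutativeRing.trans R (CommutativeRing.sym R (div x)) zx)))
      ... | inj₁ e = contradiction (CommutativeRing.sym R (x∙y⁻¹≈ε⇒x≈y x r e)) r≉x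
      ... | inj₂ e = e

    power-roots-≤ : ∀ n → 2 ≤ n → ∀ rs → AllPairs (λ x y → ¬ (x ≈ y)) rs → ListAll.All (λ r → r ^R n ≈ r) rs → List.length rs ≤ n
    power-roots-≤ 1 (s≤s ())
    -- The vector lists the coefficients of X^(n+2) - X below the leading one.
    power-roots-≤ (suc (suc n)) _ rs d zs = roots-≤ (0# ∷ (-R 1#) ∷ Vec.replicate n 0#) rs d (ListAll.map root zs)
      where
      monic-0 : ∀ n x → monic (Vec.replicate n 0#) x ≈ x ^R n
      monic-0 zero    x = CommutativeRing.refl R
      monic-0 (suc n) x = CommutativeRing.trans R (+-identityˡ _) (*-congˡ (monic-0 n x))
      root : ∀ {r} → r ^R suc (suc n) ≈ r → 0# +R r *R ((-R 1#) +R r *R monic (Vec.replicate n 0#) r) ≈ 0#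
      root {r} e = begin
        0# +R r *R ((-R 1#) +R r *R monic (Vec.replicate n 0#) r)  ≈⟨ +-identityˡ _ ⟩
        r *R ((-R 1#) +R r *R monic (Vec.replicate n 0#) r)        ≈⟨ *-congˡ (+-congˡ (*-congˡ (monic-0 n r))) ⟩
        r *R ((-R 1#) +R r ^R suc n)                               ≈⟨ distribˡ r _ _ ⟩
        r *R (-R 1#) +R r ^R suc (suc n)                           ≈⟨ +-cong (CommutativeRing.trans R (*-comm r _) (-1*x≈-x r)) e ⟩
        (-R r) +R r                                                ≈⟨ -‿inverseˡ r ⟩
        0#                                                         ∎

module FieldFacts {q : ℕ} (F : FiniteField q) where
  open LinAlg F
  open FiniteField F using (0F; 1F; 0≢1) renaming (_+F_ to _+K_; _*F_ to _*K_)
  open Algebra.Properties.Semiring.Exp K.semiring public using () renaming (_^_ to _^K_)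
  open Algebra.Properties.Semiring.Mult K.semiring public using (×1-homo-*; ×-assoc-*) renaming (_×_ to _×K_)

  exact-period : {X : Set} (_≟_ : (x y : X) → Dec (x ≡ y)) {f : X → X} (f-inj : Injective f) {N : ℕ} → Card {X} All N →
                 ∀ x → ∃ λ k → Orbits.Exact _≟_ f-inj k x
  exact-period _≟_ {f} f-inj A x with periodic f-inj {P = All} _ A x tt
  ... | l , 1≤l , e with least (λ k → (1 ℕ.≤? k) ×-dec (iter f k x ≟ x)) l (1≤l , e)
  ... | k , _ , (1≤k , fx) , min = k , 1≤k , fx , λ j 1≤j j<k e → min j j<k (1≤j , e)

  *-cancel : ∀ {c x y} → c ≢ 0F → c *K x ≡ c *K y → x ≡ y
  *-cancel {c} {x} {y} c≢0 e = trans (sym (undo x)) (trans (cong (inv c *K_) e) (undo y))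
    where
    undo : ∀ x → inv c *K (c *K x) ≡ x
    undo x = trans (sym (K.*-assoc _ c x)) (trans (cong (_*K x) (inv-* c≢0)) (K.*-identityˡ x))

  *≡0 : ∀ {c x} → c *K x ≡ 0F → c ≡ 0F ⊎ x ≡ 0F
  *≡0 {c} e with c Fin.≟ 0F
  ... | yes c≡0 = inj₁ c≡0
  ... | no c≢0  = inj₂ (*-cancel c≢0 (trans e (sym (K.zeroʳ c))))

  iter-c* : ∀ c k x → iter (c *K_) k x ≡ (c ^K k) *K x
  iter-c* c zero    x = sym (K.*-identityˡ x)
  iter-c* c (suc k) x = trans (cong (c *K_) (iter-c* c k x)) (sym (K.*-assoc c _ x))

  iter-1+ : ∀ k x → iter (1F +K_) k x ≡ (k ×K 1F) +K x
  iter-1+ zero    x = sym (K.+-identityˡ x)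
  iter-1+ (suc k) x = trans (cong (1F +K_) (iter-1+ k x)) (sym (K.+-assoc 1F _ x))

  -- Lagrange: multiplication by c permutes the nonzero elements in cycles of equal length.
  fermat : ∀ c → c ^K q ≡ c
  fermat c with c Fin.≟ 0F
  ... | yes refl = zero-pow q 1<q
    where
    zero-pow : ∀ n → 1 < n → 0F ^K n ≡ 0F
    zero-pow (suc n) _ = K.zeroˡ _
  ... | no c≢0 with exact-period Fin._≟_ (*-cancel c≢0) (card-Fin q) 1F
                  | card-minus (card-Fin q) {Q = _≡ 0F} (Fin._≟ 0F) (card-single 0F refl (λ _ → sym)) _
  ... | o , 1≤o , e , min | M , A , q≡ = trans (cong (c ^K_) q≡) (trans (cong (c *K_) c^M) (K.*-identityʳ c))
    where
    c^o : c ^K o ≡ 1F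
    c^o = trans (sym (K.*-identityʳ _)) (trans (sym (iter-c* c o 1F)) e)
    open Orbits Fin._≟_ {f = c *K_} (*-cancel c≢0)
    exact : ∀ x → x ≢ 0F → Exact o x
    exact x x≢0 = 1≤o , trans (iter-c* c o x) (trans (cong (_*K x) c^o) (K.*-identityˡ x)) , λ j 1≤j j<o ej →
      min j 1≤j j<o (trans (iter-c* c j 1F) (trans (K.*-identityʳ _) (*-cancel x≢0
        (trans (K.*-comm x _) (trans (sym (iter-c* c j x)) (trans ej (sym (K.*-identityʳ x))))))))
    o∣M : o ∣ M
    o∣M = exact-divides M (<-wellFounded M) (λ y y≢0 → (_ , λ e → [ c≢0 , proj₂ y≢0 ]′ (*≡0 e))) (λ y y≢0 → exact y (proj₂ y≢0)) A
    c^M : c ^K M ≡ 1F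
    c^M = trans (sym (K.*-identityʳ _)) (trans (sym (iter-c* c M 1F)) (iter-fix-∣ (c *K_) o∣M e))

  -- The additive counterpart of `fermat`: translation by 1 has cycles of equal length, which
  -- therefore divides q.
  q×1 : (q ×K 1F) ≡ 0F
  q×1 with exact-period Fin._≟_ (λ {x} {y} → KP+.∙-cancelˡ 1F x y) (card-Fin q) 0F
    where module KP+ = Algebra.Properties.AbelianGroup K.+-abelianGroup
  ... | o , 1≤o , e , min = trans (sym (K.+-identityʳ _)) (trans (sym (iter-1+ q 0F)) (iter-fix-∣ (1F +K_) o∣q e))
    where
    module KP+ = Algebra.Properties.AbelianGroup K.+-abelianGroup
    open Orbits Fin._≟_ {f = 1F +K_} (λ {x} {y} → KP+.∙-cancelˡ 1F x y)
    iter-shift : ∀ j x → iter (1F +K_) j x ≡ iter (1F +K_) j 0F +K x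
    iter-shift j x = trans (iter-1+ j x) (cong (_+K x) (sym (trans (iter-1+ j 0F) (K.+-identityʳ _))))
    o∣q : o ∣ q
    o∣q = exact-divides q (<-wellFounded q) {P = All} _ (λ y _ → 1≤o , trans (iter-shift o y) (trans (cong (_+K y) e) (K.+-identityˡ y)) ,
            λ j 1≤j j<o ej → min j 1≤j j<o (KP+.∙-cancelʳ y _ _ (trans (sym (iter-shift j y)) (trans ej (sym (K.+-identityˡ y)))))) (card-Fin q)

  module _ {p k} (q≡p^k : q ≡ p ^ k) where

    -- q · 1 = 0 is a product of k factors p · 1, and a field has no zero divisors.
    p×1 : (p ×K 1F) ≡ 0F
    p×1 = go k (trans (cong (_×K 1F) (sym q≡p^k)) q×1)
      where
      go : ∀ k → ((p ^ k) ×K 1F) ≡ 0F → (p ×K 1F) ≡ 0F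
      go zero    e = contradiction (trans (sym e) (K.+-identityʳ 1F)) 0≢1
      go (suc k) e with *≡0 (trans (sym (×1-homo-* p (p ^ k))) e)
      ... | inj₁ e′ = e′
      ... | inj₂ e′ = go k e′

module Congruence {a ℓ} (R : CommutativeRing a ℓ) (N : CommutativeRing.Carrier R) where
  open CommutativeRing R hiding (refl; sym; trans; zero) renaming (_+_ to _+R_; _*_ to _*R_; -_ to -R_)
  open Algebra.Properties.Semiring.Exp semiring renaming (_^_ to _^R_)
  open Relation.Binary.Reasoning.Setoid setoid
  open Algebra.Properties.Ring ring
  private
    module R = CommutativeRing R

  infix 4 _≡N_
  -- Congruence modulo the ideal (N) with an explicit cofactor. Calculations in the residue ring are
  -- done this way, without forming the quotient.
  _≡N_ : Carrier → Carrier → Set _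
  x ≡N y = ∃ λ h → x ≈ y +R N *R h

  ≡N-reflexive : ∀ {x y} → x ≈ y → x ≡N y
  ≡N-reflexive {x} {y} e = 0# , R.trans e (R.sym (R.trans (+-congˡ (zeroʳ N)) (+-identityʳ y)))

  ≡N-sym : ∀ {x y} → x ≡N y → y ≡N x
  ≡N-sym {x} {y} (h , e) = -R h , (begin
    y                               ≈⟨ +-identityʳ y ⟨
    y +R 0#                         ≈⟨ +-congˡ (-‿inverseʳ (N *R h)) ⟨
    y +R (N *R h +R -R (N *R h))    ≈⟨ +-assoc _ _ _ ⟨
    (y +R N *R h) +R -R (N *R h)    ≈⟨ +-cong (R.sym e) (-‿distribʳ-* N h) ⟩
    x +R N *R (-R h)                ∎)

  ≡N-trans : ∀ {x y z} → x ≡N y → y ≡N z → x ≡N z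
  ≡N-trans {x} {y} {z} (h , e) (k , f) = k +R h , (begin
    x                              ≈⟨ e ⟩
    y +R N *R h                    ≈⟨ +-congʳ f ⟩
    (z +R N *R k) +R N *R h        ≈⟨ +-assoc _ _ _ ⟩
    z +R (N *R k +R N *R h)        ≈⟨ +-congˡ (distribˡ N k h) ⟨
    z +R N *R (k +R h)             ∎)

  ≡N-* : ∀ {x y} z → x ≡N y → z *R x ≡N z *R y
  ≡N-* {x} {y} z (h , e) = z *R h , (begin
    z *R x                      ≈⟨ *-congˡ e ⟩
    z *R (y +R N *R h)          ≈⟨ distribˡ z y _ ⟩
    z *R y +R z *R (N *R h)     ≈⟨ +-congˡ (R.trans (R.sym (*-assoc _ _ _)) (R.trans (*-congʳ (*-comm z N)) (*-assoc _ _ _))) ⟩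
    z *R y +R N *R (z *R h)     ∎)

  ≡N-+ˡ : ∀ {x y} z → x ≡N y → z +R x ≡N z +R y
  ≡N-+ˡ z (h , e) = h , R.trans (+-congˡ e) (R.sym (+-assoc _ _ _))

  ≡N-resp : ∀ {x x′ y y′} → x ≈ x′ → y ≈ y′ → x ≡N y → x′ ≡N y′
  ≡N-resp e f (h , r) = h , R.trans (R.sym e) (R.trans r (+-congʳ f))

  ≡N-*-cong : ∀ {x y z w} → x ≡N y → z ≡N w → x *R z ≡N y *R w
  ≡N-*-cong {x} {y} {z} {w} p r = ≡N-trans (≡N-* x r) (≡N-resp (*-comm w x) (*-comm w y) (≡N-* w p))

  ≡N-+-cong : ∀ {x y z w} → x ≡N y → z ≡N w → x +R z ≡N y +R w
  ≡N-+-cong {x} {y} {z} {w} p r = ≡N-trans (≡N-+ˡ x r) (≡N-resp (+-comm w x) (+-comm w y) (≡N-+ˡ w p))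

  ≡N-^ : ∀ {x y} k → x ≡N y → x ^R k ≡N y ^R k
  ≡N-^ zero    p = ≡N-reflexive R.refl
  ≡N-^ (suc k) p = ≡N-*-cong p (≡N-^ k p)

  1^ : ∀ k → 1# ^R k ≈ 1#
  1^ zero    = R.refl
  1^ (suc k) = R.trans (*-identityˡ _) (1^ k)

-- Polynomials in an endomorphism and Fitting's dichotomy.

module Operators {q : ℕ} (F : FiniteField q) where
  open FiniteField F using (0F; 1F; 0≢1; -F_) renaming (_+F_ to _+K_; _*F_ to _*K_)
  open LinAlg F
  open FieldFacts F

  infixl 6 _⊕_
  infixl 7 _⊛_
  -- Polynomials in an endomorphism, for which X stands.
  data Op : Set where
    con     : Fin q → Op
    X       : Op
    _⊕_ _⊛_ : Op → Op → Op

  infixr 8 _⋆_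
  _⋆_ : Op → ℕ → Op
  g ⋆ zero  = con 1F
  g ⋆ suc k = g ⊛ g ⋆ k

  initial : ∀ {m} → V (suc m) → V m
  initial {zero}  (c ∷ []) = []
  initial {suc m} (c ∷ cs) = c ∷ initial cs

  final : ∀ {m} → V (suc m) → Fin q
  final {zero}  (c ∷ []) = c
  final {suc m} (c ∷ cs) = final cs

  module Eval {n} {T : V n → V n} (L : IsLin T) where

    ev : Op → V n → V n
    ev (con c) v = c ∙ v
    ev X       v = T v
    ev (g ⊕ h) v = ev g v ⊞ ev h v
    ev (g ⊛ h) v = ev g (ev h v)

    ev-lin : ∀ g → IsLin (ev g)
    ev-lin (con c) = ∙-distribˡ c , λ d v → trans (sym (∙-assoc c d v)) (trans (cong (_∙ v) (K.*-comm c d)) (∙-assoc d c v))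
    ev-lin X       = L
    ev-lin (g ⊕ h) with ev-lin g | ev-lin h
    ... | g+ , g∙ | h+ , h∙ = (λ u v → trans (cong₂ _⊞_ (g+ u v) (h+ u v)) (interchange _ _ _ _))
                            , (λ c v → trans (cong₂ _⊞_ (g∙ c v) (h∙ c v)) (sym (∙-distribˡ c _ _)))
    ev-lin (g ⊛ h) = lin-∘ (ev-lin g) (ev-lin h)

    ev-0 : ∀ g → ev g 0v ≡ 0v
    ev-0 g = lin-0 (ev-lin g)

    module _ {S : V n → V n} (LS : IsLin S) (ST : ∀ v → S (T v) ≡ T (S v)) where

      -- Stated for any linear map commuting with T; used twice, it shows that two polynomials in T
      -- commute.
      ev-natural : ∀ g v → S (ev g v) ≡ ev g (S v)
      ev-natural (con c) v = proj₂ LS c v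
      ev-natural X       v = ST v
      ev-natural (g ⊕ h) v = trans (proj₁ LS _ _) (cong₂ _⊞_ (ev-natural g v) (ev-natural h v))
      ev-natural (g ⊛ h) v = trans (ev-natural g _) (cong (ev g) (ev-natural h v))

    ev-comm : ∀ g h v → ev g (ev h v) ≡ ev h (ev g v)
    ev-comm g h v = ev-natural (ev-lin g) (λ w → sym (ev-natural L (λ _ → refl) g w)) h v

    ev-⋆ : ∀ g k v → ev (g ⋆ k) v ≡ iter (ev g) k v
    ev-⋆ g zero    v = 1∙ v
    ev-⋆ g (suc k) v = cong (ev g) (ev-⋆ g k v)

    ev-closed : {P : V n → Set} → (∀ u v → P u → P v → P (u ⊞ v)) → (∀ c v → P v → P (c ∙ v)) → (∀ v → P v → P (T v)) →
                ∀ g v → P v → P (ev g v)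
    ev-closed add scale T-P (con c) v p = scale c v p
    ev-closed add scale T-P X       v p = T-P v p
    ev-closed add scale T-P (g ⊕ h) v p = add _ _ (ev-closed add scale T-P g v p) (ev-closed add scale T-P h v p)
    ev-closed add scale T-P (g ⊛ h) v p = ev-closed add scale T-P g _ (ev-closed add scale T-P h v p)

    opOf : ∀ {m} → V m → Op
    opOf []      = con 0F
    opOf (c ∷ a) = con c ⊕ X ⊛ opOf a

    opOf-+ : ∀ {m} (a b : V m) u → ev (opOf (a ⊞ b)) u ≡ ev (opOf a) u ⊞ ev (opOf b) u
    opOf-+ []      []      u = sym (trans (cong₂ _⊞_ (0∙ u) refl) (⊞-identityˡ _))
    opOf-+ (x ∷ a) (y ∷ b) u = trans (cong₂ _⊞_ (∙-distribʳ x y u) (trans (cong T (opOf-+ a b u)) (proj₁ L _ _))) (interchange _ _ _ _)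

    opOf-∙ : ∀ {m} c (a : V m) u → ev (opOf (c ∙ a)) u ≡ c ∙ ev (opOf a) u
    opOf-∙ c []      u = trans (0∙ u) (sym (trans (cong (c ∙_) (0∙ u)) (∙0 c)))
    opOf-∙ c (x ∷ a) u = trans (cong₂ _⊞_ (∙-assoc c x u) (trans (cong T (opOf-∙ c a u)) (proj₂ L c _))) (sym (∙-distribˡ c _ _))

    opOf-snoc : ∀ {m} (a : V (suc m)) u → ev (opOf a) u ≡ ev (opOf (initial a)) u ⊞ final a ∙ iter T m u
    opOf-snoc {zero}  (c ∷ []) u = trans (cong (c ∙ u ⊞_) (trans (cong T (0∙ u)) (lin-0 L)))
      (trans (⊞-identityʳ _) (sym (trans (cong (_⊞ c ∙ u) (0∙ u)) (⊞-identityˡ _))))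
    opOf-snoc {suc m} (c ∷ cs) u = trans (cong (λ w → c ∙ u ⊞ T w) (opOf-snoc cs u))
      (trans (cong (c ∙ u ⊞_) (trans (proj₁ L _ _) (cong (T (ev (opOf (initial cs)) u) ⊞_) (proj₂ L _ _)))) (sym (⊞-assoc _ _ _)))

    Span : ℕ → V n → V n → Set
    Span m u x = ∃ λ (a : V m) → ev (opOf a) u ≡ x

    span-power : ∀ j u → Span (suc j) u (iter T j u)
    span-power zero    u = 1F ∷ [] , trans (cong₂ _⊞_ (1∙ u) (trans (cong T (0∙ u)) (lin-0 L))) (⊞-identityʳ u)
    span-power (suc j) u with span-power j u
    ... | a , e = 0F ∷ a , trans (cong₂ _⊞_ (0∙ u) (cong T e)) (⊞-identityˡ _)

    span-suc : ∀ {m u x} → Span m u x → Span (suc m) u x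
    span-suc {u = u} (a , e) = pad a , trans (opOf-pad a) e
      where
      pad : ∀ {m} → V m → V (suc m)
      pad []      = 0F ∷ []
      pad (c ∷ a) = c ∷ pad a
      opOf-pad : ∀ {m} (a : V m) → ev (opOf (pad a)) u ≡ ev (opOf a) u
      opOf-pad []      = trans (cong₂ _⊞_ (0∙ u) (trans (cong T (0∙ u)) (lin-0 L))) (trans (⊞-identityʳ _) (sym (0∙ u)))
      opOf-pad (c ∷ a) = cong (λ w → c ∙ u ⊞ T w) (opOf-pad a)

    span-≤ : ∀ {m u x} k → Span m u x → Span (k + m) u x
    span-≤ zero    s = s
    span-≤ (suc k) s = span-suc (span-≤ k s)

    span-add : ∀ {m u} x y → Span m u x → Span m u y → Span m u (x ⊞ y)
    span-add x y (a , e) (b , f) = a ⊞ b , trans (opOf-+ a b _) (cong₂ _⊞_ e f)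

    span-scale : ∀ {m u} c x → Span m u x → Span m u (c ∙ x)
    span-scale c x (a , e) = c ∙ a , trans (opOf-∙ c a _) (cong (c ∙_) e)

    -- T raises degrees by one, and the only monomial that leaves the span is T^m u, which is
    -- assumed to lie in it.
    span-T : ∀ {m u} → Span m u (iter T m u) → ∀ x → Span m u x → Span m u (T x)
    span-T {m} {u} s x (a , e) = subst (Span m u) (trans (sym (opOf-snoc (0F ∷ a) u)) (trans (cong₂ _⊞_ (0∙ u) (cong T e)) (⊞-identityˡ _)))
      (span-add _ _ (initial (0F ∷ a) , refl) (span-scale (final (0F ∷ a)) _ s))

    span-all : ∀ {m u} → Span (suc m) u (iter T (suc m) u) → ∀ g → Span (suc m) u (ev g u)
    span-all {m} {u} s g = ev-closed span-add span-scale (span-T s) g u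
      (subst (λ k → Span k u u) (ℕP.+-comm m 1) (span-≤ m (span-power 0 u)))

    M : ℕ
    M = (q ^ n) !

    M-pred : ℕ
    M-pred = M ∸ 1

    M≡ : suc M-pred ≡ M
    M≡ = ℕP.m+[n∸m]≡n (ℕP.1≤n! (q ^ n))

    iter-M : ∀ (f : V n → V n) v → iter f M (iter f M v) ≡ iter f M v
    iter-M f = iter-idempotent f (card-V n)

    -- All polynomials in T are represented by those of degree below 2M, since T^(2M) = T^M.
    B : ℕ
    B = suc (M-pred + M)

    -- With B = 2M, the vector T^B u equals T^M u, which has degree below B. Bounding the degree
    -- makes membership in R u, with R the algebra generated by T, a finite search.
    represent : ∀ g u → Span B u (ev g u)
    represent g u = span-all (subst (Span B u)
        (trans (sym (iter-M T u)) (trans (sym (iter-+ T M M u)) (cong (λ k → iter T (k + M) u) (sym M≡))))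
      (subst (λ k → Span k u (iter T M u)) (ℕP.+-suc M-pred M) (span-≤ M-pred (span-power M u)))) g

    Unit : Op → Set
    Unit g = ∃ λ h → ∀ v → ev h (ev g v) ≡ v

    Nilpotent : Op → Set
    Nilpotent g = ∃ λ a → ∀ v → iter (ev g) a v ≡ 0v

    unit-inj : ∀ {g v} → Unit g → ev g v ≡ 0v → v ≡ 0v
    unit-inj {v = v} (h , u) e = trans (sym (u v)) (trans (cong (ev h) e) (ev-0 h))

    module _ (commute : ∀ E → IsLin E → (∀ v → E (E v) ≡ E v) → (∀ v → E (T v) ≡ T (E v)) → (∀ v → E v ≡ 0v) ⊎ (∀ v → E v ≡ v)) where

      -- g^M is an idempotent commuting with T, hence 0 or 1. In the first case g is nilpotent, in
      -- the second g^(M-1) is its inverse.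
      fitting : ∀ g → Unit g ⊎ Nilpotent g
      fitting g with commute (ev (g ⋆ M)) (ev-lin (g ⋆ M))
                       (λ v → trans (ev-⋆ g M _) (trans (cong (iter (ev g) M) (ev-⋆ g M v)) (trans (iter-M (ev g) v) (sym (ev-⋆ g M v)))))
                       (λ v → ev-comm (g ⋆ M) X v)
      ... | inj₁ z = inj₂ (M , λ v → trans (sym (ev-⋆ g M v)) (z v))
      ... | inj₂ i = inj₁ (g ⋆ M-pred , λ v → trans (ev-comm (g ⋆ M-pred) g v)
                       (trans (cong (λ k → ev (g ⋆ k) v) M≡) (i v)))

    -- Operators are identified when they agree on `P`. The whole space gives the algebra generated
    -- by T, and P = ker N gives its residue field.
    module OpRing (P : V n → Set) (P-ev : ∀ g v → P v → P (ev g v)) where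

      infix 4 _≈_
      record _≈_ (g h : Op) : Set where
        constructor agree
        field at : ∀ v → P v → ev g v ≡ ev h v
      open _≈_ public

      ring : CommutativeRing _ _
      ring = record
        { Carrier = Op ; _≈_ = _≈_ ; _+_ = _⊕_ ; _*_ = _⊛_ ; -_ = con (-F 1F) ⊛_ ; 0# = con 0F ; 1# = con 1F
        ; isCommutativeRing = record
          { isRing = record
            { +-isAbelianGroup = record
              { isGroup = record
                { isMonoid = record
                  { isSemigroup = record
                    { isMagma = record
                      { isEquivalence = record
                        { refl = agree λ _ _ → refl
                        ; sym = λ e → agree λ v p → sym (at e v p)
                        ; trans = λ e f → agree λ v p → trans (at e v p) (at f v p) }
                      ; ∙-cong = λ e f → agree λ v p → cong₂ _⊞_ (at e v p) (at f v p) }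
                    ; assoc = λ g h k → agree λ v _ → ⊞-assoc (ev g v) (ev h v) (ev k v) }
                  ; identity = (λ g → agree λ v _ → trans (cong (_⊞ ev g v) (0∙ v)) (⊞-identityˡ _))
                             , (λ g → agree λ v _ → trans (cong (ev g v ⊞_) (0∙ v)) (⊞-identityʳ _)) }
                ; inverse = (λ g → agree λ v _ → trans (cong (_⊞ ev g v) (sym (neg-∙ (ev g v)))) (trans (neg-⊞ (ev g v)) (sym (0∙ v))))
                          , (λ g → agree λ v _ → trans (cong (ev g v ⊞_) (sym (neg-∙ (ev g v)))) (trans (⊟-self (ev g v)) (sym (0∙ v))))
                ; ⁻¹-cong = λ e → agree λ v p → cong ((-F 1F) ∙_) (at e v p) }
              ; comm = λ g h → agree λ v _ → ⊞-comm (ev g v) (ev h v) }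
            ; *-cong = λ {g} {g′} {h} e f → agree λ v p → trans (at e (ev h v) (P-ev h v p)) (cong (ev g′) (at f v p))
            ; *-assoc = λ g h k → agree λ v _ → refl
            ; *-identity = (λ g → agree λ v _ → 1∙ _) , (λ g → agree λ v _ → cong (ev g) (1∙ v))
            ; distrib = (λ g h k → agree λ v _ → proj₁ (ev-lin g) _ _) , (λ g h k → agree λ v _ → refl) }
          ; *-comm = λ g h → agree λ v _ → ev-comm g h v } }

      open Algebra.Properties.Semiring.Exp (CommutativeRing.semiring ring) public using () renaming (_^_ to _^R_)
      open Algebra.Properties.Semiring.Mult (CommutativeRing.semiring ring) public using () renaming (_×_ to _×R_)

      ev-^ : ∀ g k v → ev (g ^R k) v ≡ iter (ev g) k v
      ev-^ g zero    v = 1∙ v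
      ev-^ g (suc k) v = cong (ev g) (ev-^ g k v)

      ev-× : ∀ k g v → ev (k ×R g) v ≡ (k ×K 1F) ∙ ev g v
      ev-× zero    g v = trans (0∙ v) (sym (0∙ _))
      ev-× (suc k) g v = trans (cong (ev g v ⊞_) (ev-× k g v))
        (trans (cong (_⊞ (k ×K 1F) ∙ ev g v) (sym (1∙ (ev g v)))) (sym (∙-distribʳ 1F _ _)))

      con-^ : ∀ c k → con c ^R k ≈ con (c ^K k)
      con-^ c zero    = agree λ v p → refl
      con-^ c (suc k) = agree λ v p → trans (cong (c ∙_) (at (con-^ c k) v p)) (sym (∙-assoc c _ v))

-- Indecomposable modules over a local ring with principal maximal ideal.

module UniserialTheory {q : ℕ} (F : FiniteField q) where
  open FiniteField F using (0F; 1F; 0≢1; -F_) renaming (_+F_ to _+K_; _*F_ to _*K_)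
  open LinAlg F
  open Operators F

  module Uniserial {n} {T : V n → V n} (L : IsLin T) (N : Op) where
    open Eval L

    Divisible : Op → Set
    Divisible g = ∃ λ h → ∀ v → ev g v ≡ ev N (ev h v)

    top : ∀ {v₀} → v₀ ≢ 0v → Nilpotent N → ∃₂ λ l v → iter (ev N) l v ≢ 0v × (∀ v → iter (ev N) (suc l) v ≡ 0v)
    top {v₀} v₀≢0 (a , Na) with least (λ a → allV λ v → iter (ev N) a v ≟v 0v) a Na
    ... | zero  , _ , z , _   = contradiction (z v₀) v₀≢0
    ... | suc l , _ , z , min with searchV (λ v → ¬? (iter (ev N) l v ≟v 0v))
    ... | yes (v , nz) = l , v , nz , z
    ... | no all = contradiction (λ v → case iter (ev N) l v ≟v 0v of λ { (yes e) → e ; (no ¬e) → contradiction (v , ¬e) all }) (min l (ℕP.n<1+n l))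

    -- By `dichotomy` the algebra R of polynomials in T is local with maximal ideal (N); `l` is the
    -- largest exponent with N^l nonzero, and `v` witnesses this.
    module Structure (dichotomy : ∀ g → Unit g ⊎ Divisible g)
                     {l v} (top-v : iter (ev N) l v ≢ 0v) (nil : ∀ x → iter (ev N) (suc l) x ≡ 0v) where

      N^ : ∀ j → IsLin (iter (ev N) j)
      N^ = lin-iter (ev-lin N)

      ev-N^ : ∀ g j x → iter (ev N) j (ev g x) ≡ ev g (iter (ev N) j x)
      ev-N^ g j x = trans (sym (ev-⋆ N j _)) (trans (ev-comm (N ⋆ j) g x) (cong (ev g) (ev-⋆ N j x)))

      record Submodule (W : V n → Set) : Set where
        field
          dec    : ∀ x → Dec (W x)
          zero∈  : W 0v
          add    : ∀ x y → W x → W y → W (x ⊞ y)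
          ev-∈   : ∀ g x → W x → W (ev g x)

        neg-∈ : ∀ x → W x → W (neg x)
        neg-∈ x w = subst W (sym (neg-∙ x)) (ev-∈ (con _) x w)

        sub : ∀ x y → W x → W y → W (x ⊟ y)
        sub x y w z = add _ _ w (neg-∈ y z)

        swap : ∀ x y → W (x ⊟ y) → W (y ⊟ x)
        swap x y w = subst W (VP.⁻¹-anti-homo‿- x y) (neg-∈ _ w)

        independent? : ∀ u x → Dec (∃ λ (a : V B) → W (x ⊟ ev (opOf a) u))
        independent? u x = searchV λ a → dec _

        modulo : ∀ {u x} g → W (x ⊟ ev g u) → ∃ λ (a : V B) → W (x ⊟ ev (opOf a) u)
        modulo {u} {x} g w with represent g u
        ... | a , e = a , subst (λ y → W (x ⊟ y)) (sym e) w

      -- W meets R v only in 0.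
      Avoids : (V n → Set) → Set
      Avoids W = ∀ g → W (ev g v) → ev g v ≡ 0v

      module _ {W : V n → Set} (S : Submodule W) where
        open Submodule S

        adjoin : ∀ u → Submodule (λ x → ∃ λ (a : V B) → W (x ⊟ ev (opOf a) u))
        adjoin u = record
          { dec = independent? u
          ; zero∈ = modulo (con 0F) (subst W (sym (trans (cong (0v ⊟_) (0∙ u)) (⊟-self 0v))) zero∈)
          ; add = λ { x y (a , w) (b , z) → modulo (opOf a ⊕ opOf b) (subst W (add-⊟ x _ y _) (add _ _ w z)) }
          ; ev-∈ = λ { g x (a , w) → modulo (g ⊛ opOf a) (subst W (lin-⊟ (ev-lin g) x _) (ev-∈ g _ w)) } }
          where
          add-⊟ : ∀ (x s y t : V n) → (x ⊟ s) ⊞ (y ⊟ t) ≡ (x ⊞ y) ⊟ (s ⊞ t)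
          add-⊟ x s y t = trans (interchange x _ y _) (cong (x ⊞ y ⊞_) (VP.⁻¹-∙-comm s t))

        ⊆-adjoin : ∀ u x → W x → ∃ λ (a : V B) → W (x ⊟ ev (opOf a) u)
        ⊆-adjoin u x w = modulo (con 0F) (sub _ _ w (subst W (sym (0∙ u)) zero∈))

        ∈-adjoin : ∀ u → ∃ λ (a : V B) → W (u ⊟ ev (opOf a) u)
        ∈-adjoin u = modulo (con 1F) (subst W (sym (trans (cong (u ⊟_) (1∙ u)) (⊟-self u))) zero∈)

        module _ (avoids : Avoids W) where

          InSum : V n → Set
          InSum x = ∃ λ (a : V B) → W (x ⊟ ev (opOf a) v)

          -- Along u, N u, N² u, ..., 0 the sum W + R v is eventually entered; the last vector
          -- before the first entry is taken.
          boundary : ∀ u → ¬ InSum u → ∃ λ u′ → ¬ InSum u′ × InSum (ev N u′)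
          boundary u ¬in with least (λ j → independent? v (iter (ev N) j u)) (suc l)
                                (modulo (con 0F) (sub _ _ (subst W (sym (nil u)) zero∈) (subst W (sym (0∙ v)) zero∈)))
          ... | zero  , _ , i , _   = contradiction i ¬in
          ... | suc j , _ , i , min = iter (ev N) j u , min j (ℕP.n<1+n j) , i

          -- Let N u = a v modulo W. If a were a unit, applying N^l would put a N^l v into W, so N^l
          -- v = 0 as W avoids R v. Hence a v = N h v, and u - h v is the corrected vector.
          adjust : ∀ u → ¬ InSum u → InSum (ev N u) → ∃ λ u′ → ¬ InSum u′ × W (ev N u′)
          adjust u ¬in (a , w) with dichotomy (opOf a)
          ... | inj₁ unit = contradiction (unit-inj {opOf a} unit (trans (sym (ev-N^ (opOf a) l v))
                  (trans (sym (ev-⋆ N l _)) (avoids (N ⋆ l ⊛ opOf a) in-W)))) top-v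
            where
            in-W : W (ev (N ⋆ l) (ev (opOf a) v))
            in-W = subst W (trans (cong neg (trans (cong (_⊟ iter (ev N) l (ev (opOf a) v)) (trans (iter-comm (ev N) l 1 u) (nil u))) (⊞-identityˡ _)))
                              (trans (VP.⁻¹-involutive _) (sym (ev-⋆ N l _))))
                     (neg-∈ _ (subst W (trans (ev-⋆ N l _) (lin-⊟ (N^ l) _ _)) (ev-∈ (N ⋆ l) _ w)))
          ... | inj₂ (h , div) = u ⊟ ev h v , (λ { (b , w′) → ¬in (modulo (opOf b ⊕ h) (subst W (regroup _ _ _) w′)) })
                               , subst W (trans (cong (ev N u ⊟_) (div v)) (sym (lin-⊟ (ev-lin N) u _))) w
            where
            regroup : ∀ (x y z : V n) → (x ⊟ y) ⊟ z ≡ x ⊟ (z ⊞ y)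
            regroup x y z = trans (⊞-assoc x _ _) (cong (x ⊞_) (trans (VP.⁻¹-∙-comm y z) (cong neg (⊞-comm y z))))

          -- Suppose g v = a u modulo W. A unit a would place u in W + R v; otherwise a = N h and a
          -- u = h N u lies in W, so g v lies in W and vanishes.
          adjoin-avoids : ∀ u → ¬ InSum u → W (ev N u) → Avoids (λ x → ∃ λ (a : V B) → W (x ⊟ ev (opOf a) u))
          adjoin-avoids u ¬in Nu g (a , w) with dichotomy (opOf a)
          ... | inj₁ (h , inv) = contradiction (modulo (h ⊛ g) (swap _ _ (subst W (trans (lin-⊟ (ev-lin h) _ _) (cong (ev h (ev g v) ⊟_) (inv u))) (ev-∈ h _ w)))) ¬in
          ... | inj₂ (h , div) = avoids g (subst W (⊟-⊞ _ _) (add _ _ w (subst W (sym (trans (div u) (ev-comm N h u))) (ev-∈ h _ Nu))))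

      -- A maximal submodule avoiding Rv is a complement of Rv.
      complement : ∀ fuel {m W} (S : Submodule W) → Avoids W → Card W m → q ^ n < fuel + m →
                   ∃ λ W → Submodule W × Avoids W × (∀ x → ∃ λ (a : V B) → W (x ⊟ ev (opOf a) v))
      complement fuel {m} {W} S avoids A bound with allV (Submodule.independent? S v)
      ... | yes all = W , S , avoids , all
      ... | no ¬all with searchV (λ x → ¬? (Submodule.independent? S v x))
      ... | no none = contradiction (λ x → case Submodule.independent? S v x of λ { (yes i) → i ; (no ¬i) → contradiction (x , ¬i) none }) ¬all
      ... | yes (u , ¬in) = extend fuel bound (boundary S avoids u ¬in)
        where
        -- Each adjunction enlarges W strictly, and its cardinality never exceeds q^n, so the fuel
        -- cannot run out.
        extend : ∀ fuel → q ^ n < fuel + m → (∃ λ u → ¬ InSum S avoids u × InSum S avoids (ev N u)) →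
                 ∃ λ W → Submodule W × Avoids W × (∀ x → ∃ λ (a : V B) → W (x ⊟ ev (opOf a) v))
        extend zero       bound _ = contradiction bound (ℕP.≤⇒≯ (card-≤ A (card-V n) id _ (λ _ _ _ _ e → e)))
        extend (suc fuel) bound (u₁ , ¬in₁ , Nu₁) with adjust S avoids u₁ ¬in₁ Nu₁
        ... | u₂ , ¬in₂ , Nu₂ with card-dec (card-V n) (Submodule.independent? S u₂)
        ... | m′ , A′ = complement fuel (adjoin S u₂) (adjoin-avoids S avoids u₂ ¬in₂ Nu₂) (card-⇔ A′ (λ _ → proj₂) (λ _ w → tt , w))
              (≤-trans bound (≤-trans (ℕP.≤-reflexive (sym (ℕP.+-suc fuel m))) (ℕP.+-monoʳ-≤ fuel m<m′)))
          where
          m<m′ : suc m ≤ m′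
          m<m′ = subst (_≤ m′) (ℕP.+-comm m 1) (card-≤ (card-⊎ A (card-single {P = u₂ ≡_} u₂ refl (λ _ → id))
                   (λ { x w refl → ¬in₂ (⊆-adjoin S v u₂ w) })) A′ id
                   (λ { x (inj₁ w) → tt , ⊆-adjoin S u₂ x w ; x (inj₂ refl) → tt , ∈-adjoin S u₂ }) (λ _ _ _ _ e → e))

      module _ {W : V n → Set} (S : Submodule W) (avoids : Avoids W) (spans : ∀ x → ∃ λ (a : V B) → W (x ⊟ ev (opOf a) v)) where
        open Submodule S

        projection : V n → V n
        projection x with independent? v x
        ... | yes (a , _) = ev (opOf a) v
        ... | no _        = 0v

        -- Two candidates for the component along `v` differ by an element of both W and R v, which
        -- is 0. The component is thus independent of the coefficients found by search.
        projection-unique : ∀ {x} g → W (x ⊟ ev g v) → projection x ≡ ev g v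
        projection-unique {x} g w with independent? v x
        ... | no none     = contradiction (spans x) none
        ... | yes (a , z) = ⊟≡0 (trans (sym eq) (avoids (opOf a ⊕ con (-F 1F) ⊛ g) (subst W (sym eq) in-W)))
          where
          eq : ev (opOf a ⊕ con (-F 1F) ⊛ g) v ≡ ev (opOf a) v ⊟ ev g v
          eq = cong (ev (opOf a) v ⊞_) (sym (neg-∙ _))
          in-W : W (ev (opOf a) v ⊟ ev g v)
          in-W = subst W (trans (sym (⊞-assoc _ x _)) (cong (_⊟ ev g v) (⊟-⊞ _ x))) (add _ _ (swap _ _ z) w)

        projection-lin : IsLin projection
        projection-lin = (λ x y → case spans x of λ { (a , w) → case spans y of λ { (b , z) →
            trans (projection-unique (opOf a ⊕ opOf b) (proj-add w z)) (cong₂ _⊞_ (sym (projection-unique (opOf a) w)) (sym (projection-unique (opOf b) z))) } })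
          , (λ c x → case spans x of λ { (a , w) → trans (projection-unique (con c ⊛ opOf a) (subst W (lin-⊟ (ev-lin (con c)) x _) (ev-∈ (con c) _ w)))
                                                     (cong (c ∙_) (sym (projection-unique (opOf a) w))) })
          where
          proj-add : ∀ {x y s t : V n} → W (x ⊟ s) → W (y ⊟ t) → W ((x ⊞ y) ⊟ (s ⊞ t))
          proj-add {x} {y} {s} {t} w z = subst W (trans (interchange x _ y _) (cong (x ⊞ y ⊞_) (VP.⁻¹-∙-comm s t))) (add _ _ w z)

        projection-ev : ∀ g → projection (ev g v) ≡ ev g v
        projection-ev g = projection-unique g (subst W (sym (⊟-self _)) zero∈)

        projection-idem : ∀ x → projection (projection x) ≡ projection x
        projection-idem x = case spans x of λ { (a , w) → trans (cong projection (projection-unique (opOf a) w))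
          (trans (projection-ev (opOf a)) (sym (projection-unique (opOf a) w))) }

        projection-comm : ∀ x → projection (T x) ≡ T (projection x)
        projection-comm x = case spans x of λ { (a , w) → trans (projection-unique (X ⊛ opOf a) (subst W (lin-⊟ L x _) (ev-∈ X _ w)))
          (cong T (sym (projection-unique (opOf a) w))) }

      module _ (commute : ∀ E → IsLin E → (∀ v → E (E v) ≡ E v) → (∀ v → E (T v) ≡ T (E v)) → (∀ v → E v ≡ 0v) ⊎ (∀ v → E v ≡ v)) where

        -- The projection onto R v along a complement is an idempotent commuting with T, hence 0 or
        -- 1; as it fixes the nonzero vector `v`, it is the identity.
        cyclic : ∀ x → ∃ λ g → x ≡ ev g v
        cyclic x with complement (suc (q ^ n)) trivial (λ _ e → e) (card-single 0v refl (λ _ e → sym e)) (ℕP.m≤m+n _ 1)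
          where
          trivial : Submodule (_≡ 0v)
          trivial = record { dec = _≟v 0v ; zero∈ = refl ; add = λ { _ _ refl refl → ⊞-identityˡ 0v } ; ev-∈ = λ { g _ refl → ev-0 g } }
        ... | W , S , avoids , spans with commute (projection S avoids spans) (projection-lin S avoids spans)
                                            (projection-idem S avoids spans) (projection-comm S avoids spans)
        ... | inj₂ i = case spans x of λ { (a , w) → opOf a , trans (sym (i x)) (projection-unique S avoids spans (opOf a) w) }
        ... | inj₁ z = contradiction (trans (cong (iter (ev N) l) v≡0) (lin-0 (N^ l))) top-v
          where
          v≡0 : v ≡ 0v
          v≡0 = trans (sym (1∙ v)) (trans (sym (projection-ev S avoids spans (con 1F))) (z _))

        -- Write x = N^j g v with j < l. A unit g would give N^(j+1) v = 0 from N x = 0, so N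
        -- divides g and one more factor is gained.
        kernel-divides : ∀ {x} → ev N x ≡ 0v → ∀ j → j ≤ l → ∃ λ g → x ≡ iter (ev N) j (ev g v)
        kernel-divides {x} Nx zero    _   = cyclic x
        kernel-divides {x} Nx (suc j) j<l with kernel-divides Nx j (ℕP.<⇒≤ j<l)
        ... | g , e with dichotomy g
        ... | inj₂ (h , div) = h , trans e (trans (cong (iter (ev N) j) (div v)) (iter-comm (ev N) j 1 _))
        ... | inj₁ unit = contradiction
              (trans (cong (λ k → iter (ev N) k v) (sym (ℕP.m∸n+n≡m j<l))) (trans (iter-+ (ev N) (l ∸ suc j) (suc j) v)
                (trans (cong (iter (ev N) (l ∸ suc j)) (unit-inj {g} unit (trans (sym (ev-N^ g (suc j) v)) (trans (cong (ev N) (sym e)) Nx))))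
                       (lin-0 (N^ (l ∸ suc j)))))) top-v

        kernel-generated : ∀ {x} → ev N x ≡ 0v → ∃ λ g → x ≡ ev g (iter (ev N) l v)
        kernel-generated Nx with kernel-divides Nx l ≤-refl
        ... | g , e = g , trans e (ev-N^ g l v)

        section : ℕ → V n → V n
        section s x with searchV (λ y → iter (ev N) s y ≟v x)
        ... | yes (y , _) = y
        ... | no _        = 0v

        iter-section : ∀ {s x} → s ≤ l → ev N x ≡ 0v → iter (ev N) s (section s x) ≡ x
        iter-section {s} {x} s≤l Nx with searchV (λ y → iter (ev N) s y ≟v x)
        ... | yes (y , e) = e
        ... | no none     = case kernel-divides Nx s s≤l of λ { (g , e) → contradiction (ev g v , sym e) none }

        -- N^s maps ker N^(s+1) onto ker N with fibres ker N^s. It is surjective because, for s ≤ l,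
        -- every element of ker N is divisible by N^s.
        card-kernel : ∀ {κ} → Card (λ x → ev N x ≡ 0v) κ → ∀ s → s ≤ suc l → Card (λ x → iter (ev N) s x ≡ 0v) (κ ^ s)
        card-kernel A zero    _         = card-single 0v refl (λ _ e → sym e)
        card-kernel A (suc s) (s≤s s≤l) = card-bij (card-× A (card-kernel A s (ℕP.m≤n⇒m≤1+n s≤l))) from to
          (λ { (x , y) (Nx , Ny) → trans (cong (ev N) (lower x y Nx Ny)) Nx })
          (λ z Nz → Nz , trans (lin-⊟ (N^ s) _ _) (trans (cong (iter (ev N) s z ⊟_) (iter-section s≤l Nz)) (⊟-self _)))
          (λ z Nz → ⊞-⊟ _ z)
          (λ { (x , y) (x′ , y′) (Nx , Ny) (Nx′ , Ny′) e → inj (trans (sym (lower x y Nx Ny)) (trans (cong (iter (ev N) s) e) (lower x′ y′ Nx′ Ny′))) e })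
          where
          from : V n × V n → V n
          from (x , y) = section s x ⊞ y
          to : V n → V n × V n
          to z = iter (ev N) s z , z ⊟ section s (iter (ev N) s z)
          lower : ∀ x y → ev N x ≡ 0v → iter (ev N) s y ≡ 0v → iter (ev N) s (section s x ⊞ y) ≡ x
          lower x y Nx Ny = trans (proj₁ (N^ s) _ _) (trans (cong₂ _⊞_ (iter-section s≤l Nx) Ny) (⊞-identityʳ x))
          inj : ∀ {x x′ y y′} → x ≡ x′ → section s x ⊞ y ≡ section s x′ ⊞ y′ → (x , y) ≡ (x′ , y′)
          inj {x} refl e = cong (x ,_) (VP.∙-cancelˡ (section s x) _ _ e)

        card-all : ∀ {κ} → Card (λ x → ev N x ≡ 0v) κ → κ ^ suc l ≡ q ^ n
        card-all A = card-unique (card-kernel A (suc l) ≤-refl) (card-V n) _ (λ x _ → nil x)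

-- Prime powers and valuations.

n<b^n : ∀ {b} → 1 < b → ∀ n → n < b ^ n
n<b^n     1<b zero    = s≤s z≤n
n<b^n {b} 1<b (suc n) = ≤-trans (s≤s (n<b^n 1<b n)) (subst (b ^ n <_) (ℕP.*-comm (b ^ n) b)
  (ℕP.m<m*n (b ^ n) b {{>-nonZero (≤-trans (s≤s z≤n) (n<b^n 1<b n))}} 1<b))

module PrimeFacts {p : ℕ} (pr : Prime p) where

  private instance
    p≢0 : NonZero p
    p≢0 = prime⇒nonZero pr

  2≤p : 2 ≤ p
  2≤p = ℕ.nonTrivial⇒n>1 p {{prime⇒nonTrivial pr}}

  n<p^n : ∀ n → n < p ^ n
  n<p^n = n<b^n 2≤p

  valuation : ∀ m → Acc _<_ m → 1 ≤ m → ∃₂ λ e t → m ≡ e * p ^ t × ¬ p ∣ e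
  valuation m (acc rs) 1≤m with p ∣? m
  ... | no p∤m = m , 0 , sym (ℕP.*-identityʳ m) , p∤m
  ... | yes (divides zero refl) = contradiction 1≤m λ ()
  ... | yes (divides c@(suc _) refl) with valuation c (rs (ℕP.m<m*n c p 2≤p)) (s≤s z≤n)
  ... | e , t , c≡ , p∤e = e , suc t , trans (cong (_* p) c≡) (trans (ℕP.*-assoc e _ p) (cong (e *_) (ℕP.*-comm _ p))) , p∤e

  coprime : ∀ {e} → ¬ p ∣ e → Coprimality.Coprime e p
  coprime p∤e (d∣e , d∣p) with prime⇒irreducible pr d∣p
  ... | inj₁ d≡1  = d≡1
  ... | inj₂ refl = contradiction d∣e p∤e

  ∣-cancel-p^ : ∀ {e} → ¬ p ∣ e → ∀ s {k} → e ∣ k * p ^ s → e ∣ k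
  ∣-cancel-p^ {e} p∤e zero    {k} d = subst (e ∣_) (ℕP.*-identityʳ k) d
  ∣-cancel-p^ {e} p∤e (suc s) {k} d = Coprimality.coprime-divisor (coprime p∤e) (subst (e ∣_) (ℕP.*-comm k p)
    (∣-cancel-p^ p∤e s {k * p} (subst (e ∣_) (sym (ℕP.*-assoc k p (p ^ s))) d)))

  prime-power-divisor : ∀ {d} t → d ∣ p ^ t → ∃ λ s → d ≡ p ^ s
  prime-power-divisor {zero} t d∣ = contradiction (0∣⇒≡0 d∣) (ℕ.≢-nonZero⁻¹ _ {{ℕP.m^n≢0 p t}})
  prime-power-divisor {d@(suc _)} t d∣ with valuation d (<-wellFounded d) (s≤s z≤n)
  ... | e , s , d≡ , p∤e = s , trans d≡ (trans (cong (_* p ^ s) e≡1) (ℕP.*-identityˡ _))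
    where
    e≡1 : e ≡ 1
    e≡1 = ∣1⇒≡1 (∣-cancel-p^ p∤e t {1} (subst (e ∣_) (sym (ℕP.*-identityˡ (p ^ t))) (∣-trans (subst (e ∣_) (sym d≡) (m∣m*n (p ^ s))) d∣)))

-- Nilpotent indecomposable blocks.

module BlockTypes {q : ℕ} (F : FiniteField q) where
  open FiniteField F using (0F; 1F; 0≢1; -F_) renaming (_+F_ to _+K_; _*F_ to _*K_)
  open LinAlg F
  open Decomposition F
  open FieldFacts F
  open Operators F
  open UniserialTheory F

  nonzero-vector : ∀ {n} → 1 ≤ n → ∃ λ (v : V n) → v ≢ 0v
  nonzero-vector {suc n} _ = (1F ∷ 0v) , λ e → 0≢1 (sym (VecP.∷-injectiveˡ e))

  -- Multiplication by X on F_q[X]/(X^n), in coefficients from the constant term upwards.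
  shift : ∀ {n} → V n → V n
  shift a = initial (0F ∷ a)

  module NilpotentBlock {n} {T : V n → V n} (L : IsLin T) (ind : Indecomposable T)
                        {l v} (top-v : iter T l v ≢ 0v) (nil : ∀ x → iter T (suc l) x ≡ 0v) where
    open Eval L
    open Uniserial L X

    -- The splitting g = g(0) + X h by recursion on the expression; the scalar depends on the
    -- expression only.
    constant-term : ∀ g → ∃₂ λ c h → ∀ v → ev g v ≡ c ∙ v ⊞ T (ev h v)
    constant-term (con c) = c , con 0F , λ v → sym (trans (cong (c ∙ v ⊞_) (trans (cong T (0∙ v)) (lin-0 L))) (⊞-identityʳ _))
    constant-term X       = 0F , con 1F , λ v → sym (trans (cong₂ _⊞_ (0∙ v) (cong T (1∙ v))) (⊞-identityˡ _))
    constant-term (g ⊕ g′) with constant-term g | constant-term g′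
    ... | c , h , e | c′ , h′ , e′ = c +K c′ , h ⊕ h′ , λ v → trans (cong₂ _⊞_ (e v) (e′ v))
          (trans (interchange _ _ _ _) (cong₂ _⊞_ (sym (∙-distribʳ c c′ v)) (sym (proj₁ L _ _))))
    constant-term (g ⊛ g′) with constant-term g | constant-term g′
    ... | c , h , e | c′ , h′ , e′ = c *K c′ , con c ⊛ h′ ⊕ h ⊛ g′ , λ v → trans (e (ev g′ v))
          (trans (cong (_⊞ T (ev h (ev g′ v))) (trans (cong (c ∙_) (e′ v)) (∙-distribˡ c _ _)))
            (trans (⊞-assoc _ _ _) (cong₂ _⊞_ (sym (∙-assoc c c′ v)) (trans (cong (_⊞ T (ev h (ev g′ v))) (sym (proj₂ L c _))) (sym (proj₁ L _ _))))))

    private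
      w₀ = iter T l v

    -- On the nonzero vector T^l v, which T kills, g acts as the scalar g(0). If that is nonzero, g
    -- is not nilpotent, hence a unit by `fitting`.
    dichotomy : ∀ g → Unit g ⊎ Divisible g
    dichotomy g with constant-term g
    ... | c , h , e with c Fin.≟ 0F
    ... | yes refl = inj₂ (h , λ v → trans (e v) (trans (cong (_⊞ T (ev h v)) (0∙ v)) (⊞-identityˡ _)))
    ... | no c≢0 with fitting ind g
    ... | inj₁ u = inj₁ u
    ... | inj₂ (a , z) = contradiction (z w₀) (proj₁ (iter-closed (ev g) {P = λ w → w ≢ 0v × T w ≡ 0v} survive a w₀ (top-v , nil v)))
      where
      survive : ∀ w → w ≢ 0v × T w ≡ 0v → ev g w ≢ 0v × T (ev g w) ≡ 0v
      survive w (w≢0 , Tw) = (λ z → w≢0 (∙-cancel c≢0 (trans (sym (trans (e w) (trans (cong (c ∙ w ⊞_) (trans (ev-comm X h w) (trans (cong (ev h) Tw) (ev-0 h)))) (⊞-identityʳ _)))) z)))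
                           , trans (ev-comm X g w) (trans (cong (ev g) Tw) (ev-0 g))

    open Structure dichotomy {l} {v} top-v nil

    card-kernel-T : Card (λ x → T x ≡ 0v) q
    card-kernel-T = record
      { elem = _∙ w₀
      ; elem-∈ = λ c → trans (proj₂ L c _) (trans (cong (c ∙_) (nil v)) (∙0 c))
      ; index = λ x Tx → proj₁ (constant-term (proj₁ (kernel-generated ind Tx)))
      ; elem-index = λ x Tx → sym (coefficient x Tx (kernel-generated ind Tx))
      ; elem-inj = λ {c} {d} e → c-inj (trans (∙-distribʳ c (-F d) w₀) (trans (cong₂ _⊞_ e (neg-scalar d)) (⊟-self _))) }
      where
      coefficient : ∀ x → T x ≡ 0v → (kg : ∃ λ g → x ≡ ev g w₀) → x ≡ proj₁ (constant-term (proj₁ kg)) ∙ w₀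
      coefficient x Tx (g , e) with constant-term g
      ... | c , h , f = trans e (trans (f w₀) (trans (cong (c ∙ w₀ ⊞_) (trans (ev-comm X h w₀) (trans (cong (ev h) (nil v)) (ev-0 h)))) (⊞-identityʳ _)))
      neg-scalar : ∀ d → (-F d) ∙ w₀ ≡ neg (d ∙ w₀)
      neg-scalar d = trans (cong (_∙ w₀) (sym (KP.-1*x≈-x d))) (trans (∙-assoc _ d w₀) (sym (neg-∙ _)))
      c-inj : ∀ {c d} → (c +K (-F d)) ∙ w₀ ≡ 0v → c ≡ d
      c-inj {c} {d} e with (c +K (-F d)) Fin.≟ 0F
      ... | yes z = KP.x∙y⁻¹≈ε⇒x≈y c d z
      ... | no nz = contradiction (∙-cancel nz e) top-v

    power-in-span : Span (suc l) v (iter T (suc l) v)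
    power-in-span = subst (Span (suc l) v) (sym (nil v)) (subst (Span (suc l) v) (0∙ w₀) (span-scale 0F w₀ (span-power l v)))

    coefficients : ∀ x → ∃ λ (a : V (suc l)) → ev (opOf a) v ≡ x
    coefficients x = spanned (cyclic ind x)
      where
      spanned : (∃ λ g → x ≡ ev g v) → Span (suc l) v x
      spanned (g , e) = subst (Span (suc l) v) (sym e) (span-all {l} {v} power-in-span g)

    -- The first j coefficients have been stripped off as zero. Applying T^(l-j) to the rest kills
    -- everything except the next coefficient times T^l v, so that coefficient vanishes as well.
    opOf-inj₀ : ∀ {m} j → j + m ≡ suc l → (a : V m) → iter T j (ev (opOf a) v) ≡ 0v → a ≡ 0v
    opOf-inj₀ j e [] _ = refl
    opOf-inj₀ {suc m} j e (c ∷ a) z with c Fin.≟ 0F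
    ... | yes refl = cong (0F ∷_) (opOf-inj₀ (suc j) (trans (sym (ℕP.+-suc j m)) e) a
                       (trans (iter-comm T 1 j _) (trans (cong (iter T j) (sym (trans (cong (_⊞ T (ev (opOf a) v)) (0∙ v)) (⊞-identityˡ _)))) z)))
    ... | no c≢0 = contradiction (∙-cancel c≢0 (begin
          c ∙ iter T l v                                              ≡⟨ sym (⊞-identityʳ _) ⟩
          c ∙ iter T l v ⊞ 0v                                         ≡⟨ cong₂ _⊞_ (sym (proj₂ (lin-iter L l) c v)) (sym (trans (iter-comm T l 1 _) (nil _))) ⟩
          iter T l (c ∙ v) ⊞ iter T l (T (ev (opOf a) v))             ≡⟨ sym (proj₁ (lin-iter L l) _ _) ⟩
          iter T l (ev (opOf (c ∷ a)) v)                              ≡⟨ cong (λ k → iter T k (ev (opOf (c ∷ a)) v)) (sym m+j) ⟩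
          iter T (m + j) (ev (opOf (c ∷ a)) v)                        ≡⟨ iter-+ T m j _ ⟩
          iter T m (iter T j (ev (opOf (c ∷ a)) v))                   ≡⟨ cong (iter T m) z ⟩
          iter T m 0v                                                 ≡⟨ lin-0 (lin-iter L m) ⟩
          0v                                                          ∎)) top-v
      where
      open ≡-Reasoning
      m+j : m + j ≡ l
      m+j = ℕP.suc-injective (trans (cong suc (ℕP.+-comm m j)) (trans (sym (ℕP.+-suc j m)) e))

    conj-shift : T ≃ shift {n}
    conj-shift = subst (λ k → T ≃ shift {k}) (q^-inj (card-all ind card-kernel-T))
      (≃-sym (mk≃ (λ a → ev (opOf a) v) (λ x → proj₁ (coefficients x))
        (λ a → lin-inj Φ-lin (opOf-inj₀ 0 refl) (proj₂ (coefficients (ev (opOf a) v)))) (λ x → proj₂ (coefficients x)) comm))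
      where
      Φ-lin : IsLin (λ (a : V (suc l)) → ev (opOf a) v)
      Φ-lin = (λ a b → opOf-+ a b v) , (λ c a → opOf-∙ c a v)
      comm : ∀ a → ev (opOf (shift a)) v ≡ T (ev (opOf a) v)
      comm a = sym (trans (sym (trans (cong (_⊞ T (ev (opOf a) v)) (0∙ v)) (⊞-identityˡ _)))
        (trans (opOf-snoc (0F ∷ a) v) (trans (cong (λ w → ev (opOf (shift a)) v ⊞ final (0F ∷ a) ∙ w) (nil v)) (trans (cong (ev (opOf (shift a)) v ⊞_) (∙0 (final (0F ∷ a)))) (⊞-identityʳ _)))))

  nilpotent-block : ∀ {n} {T : V n → V n} (L : IsLin T) → 1 ≤ n → Indecomposable T → Eval.Nilpotent L X → T ≃ shift {n}
  nilpotent-block L 1≤n ind nilT with Uniserial.top L X (proj₂ (nonzero-vector 1≤n)) nilT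
  ... | l , v , top-v , nil = NilpotentBlock.conj-shift L ind {l} {v} top-v nil

-- Invertible indecomposable blocks.

module InvertibleTypes {q : ℕ} (F : FiniteField q) {p k : ℕ} (pr : Prime p) (q≡p^k : q ≡ p ^ k) where
  open FiniteField F using (0F; 1F; 0≢1; -F_) renaming (_+F_ to _+K_; _*F_ to _*K_)
  open LinAlg F
  open Decomposition F
  open FieldFacts F
  open Operators F
  open UniserialTheory F
  open BlockTypes F
  open PrimeFacts pr

  -- e is the prime-to-p part of the order of T, L the nilpotency index of T^e - 1, and d the degree of the residue field.
  record InvertibleType {n} (T : V n → V n) (e : ℕ) : Set where
    field
      1≤e      : 1 ≤ e
      p∤e      : ¬ p ∣ e
      d L t    : ℕ
      1≤d      : 1 ≤ d
      1≤L      : 1 ≤ L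
      e∣q^d-1  : e ∣ q ^ d ∸ 1
      minimal  : ∀ d′ → 1 ≤ d′ → e ∣ q ^ d′ ∸ 1 → d ≤ d′
      n≡d*L    : n ≡ d * L
      order    : ∀ v → iter T (e * p ^ t) v ≡ v
      order-∣  : ∀ l → (∀ v → iter T l v ≡ v) → e * p ^ t ∣ l
      fix-none : ∀ l → ¬ e ∣ l → ∀ v → iter T l v ≡ v → v ≡ 0v
      fix-card : ∀ s → Card (λ v → iter T (e * p ^ s) v ≡ v) (q ^ (d * (p ^ s ⊓ L)))

  1≤q^ : ∀ d → 1 ≤ q ^ d
  1≤q^ d = ℕP.m^n>0 q {{>-nonZero (ℕP.<⇒≤ 1<q)}} d

  c^q^d : ∀ c d → c ^K (q ^ d) ≡ c
  c^q^d c zero    = K.*-identityʳ c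
  c^q^d c (suc d) = trans (sym (^-assocʳ c q (q ^ d))) (trans (cong (_^K (q ^ d)) (fermat c)) (c^q^d c d))
    where open Algebra.Properties.Semiring.Exp K.semiring using (^-assocʳ)

  module Invertible {n} {T : V n → V n} (LT : IsLin T) where
    open Eval LT
    open OpRing All (λ _ _ _ → tt)
    private module R = CommutativeRing ring

    char : ∀ g → (p ×R g) ≈ con 0F
    char g = agree λ v _ → trans (ev-× p g v) (trans (cong (_∙ ev g v) (p×1 {p} {k} q≡p^k)) (trans (0∙ _) (sym (0∙ v))))

    open CharacteristicP ring using (module Frobenius)
    open Frobenius pr char
    open Algebra.Properties.Semiring.Exp R.semiring using (^-assocʳ; ^-congˡ)
    open Algebra.Properties.CommutativeSemiring.Exp R.commutativeSemiring using (^-distrib-*)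

    power-minus-1 : ℕ → Op
    power-minus-1 m = X ⋆ m ⊕ con (-F 1F)

    ev-power-minus-1 : ∀ m v → ev (power-minus-1 m) v ≡ iter T m v ⊟ v
    ev-power-minus-1 m v = cong₂ _⊞_ (ev-⋆ X m v) (sym (neg-∙ v))

    -- With N = T^m - 1 this is (1 + N)^(p^s) = 1 + N^(p^s) in characteristic p. It turns kernels of
    -- powers of N into fixed points of powers of T.
    freshman : ∀ m s v → iter (ev (power-minus-1 m)) (p ^ s) v ≡ iter T (m * p ^ s) v ⊟ v
    freshman m s v = begin
      iter (ev N) (p ^ s) v                          ≡⟨ sym (ev-^ N (p ^ s) v) ⟩
      ev (N ^R (p ^ s)) v                            ≡⟨ sym (⊞-cancel v _) ⟩
      (v ⊞ ev (N ^R (p ^ s)) v) ⊟ v                  ≡⟨ cong (λ w → (w ⊞ ev (N ^R (p ^ s)) v) ⊟ v) (sym (trans (at (1^ (p ^ s)) v tt) (1∙ v))) ⟩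
      ev ((con 1F ^R (p ^ s)) ⊕ (N ^R (p ^ s))) v ⊟ v      ≡⟨ cong (_⊟ v) (sym (at (frobenius^ s (con 1F) N) v tt)) ⟩
      ev ((con 1F ⊕ N) ^R (p ^ s)) v ⊟ v             ≡⟨ cong (_⊟ v) (trans (ev-^ (con 1F ⊕ N) (p ^ s) v) (iter-cong 1+N (p ^ s) v)) ⟩
      iter (iter T m) (p ^ s) v ⊟ v                  ≡⟨ cong (_⊟ v) (trans (sym (iter-* T (p ^ s) m v)) (cong (λ j → iter T j v) (ℕP.*-comm (p ^ s) m))) ⟩
      iter T (m * p ^ s) v ⊟ v                       ∎
      where
      open ≡-Reasoning
      N = power-minus-1 m
      open Congruence ring N using (1^)
      1+N : ∀ v → ev (con 1F ⊕ N) v ≡ iter T m v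
      1+N v = trans (cong₂ _⊞_ (1∙ v) (ev-power-minus-1 m v)) (⊞-⊟ v _)

    fix⇔ : ∀ m s v → (iter (ev (power-minus-1 m)) (p ^ s) v ≡ 0v → iter T (m * p ^ s) v ≡ v)
                   × (iter T (m * p ^ s) v ≡ v → iter (ev (power-minus-1 m)) (p ^ s) v ≡ 0v)
    fix⇔ m s v = (λ e → ⊟≡0 (trans (sym (freshman m s v)) e)) , (λ e → trans (freshman m s v) (trans (cong (_⊟ v) e) (⊟-self v)))

    module _ (e : ℕ) where

      private N = power-minus-1 e
      open Congruence ring N

      X^e≡1 : X ^R e ≡N con 1F
      X^e≡1 = con 1F , agree λ v _ → trans (ev-^ X e v) (sym (trans (cong₂ _⊞_ (1∙ v) (trans (cong (ev N) (1∙ v)) (ev-power-minus-1 e v))) (⊞-⊟ v _)))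

      X^q^d : ∀ d → e ∣ q ^ d ∸ 1 → X ^R (q ^ d) ≡N X
      X^q^d d (divides c eq) = ≡N-resp (R.reflexive (cong (X ^R_) (sym exponent))) (R.*-identityʳ X)
        (≡N-* X (≡N-resp (^-assocʳ X e c) (1^ c) (≡N-^ c X^e≡1)))
        where
        exponent : q ^ d ≡ suc (e * c)
        exponent = trans (sym (ℕP.m+[n∸m]≡n (1≤q^ d))) (cong suc (trans eq (ℕP.*-comm c e)))

      -- The map g ↦ g^(q^d) respects sums and products, fixes the coefficients by `fermat`, and
      -- fixes X modulo N because T^e ≡ 1 and e divides q^d - 1.
      frobenius-≡N : ∀ d → e ∣ q ^ d ∸ 1 → ∀ g → g ^R (q ^ d) ≡N g
      frobenius-≡N d e∣ (con c) = ≡N-reflexive (R.trans (con-^ c (q ^ d)) (R.reflexive (cong con (c^q^d c d))))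
      frobenius-≡N d e∣ X       = X^q^d d e∣
      frobenius-≡N d e∣ (g ⊕ h) = ≡N-resp
        (R.trans (R.sym (frobenius^ (k * d) g h)) (R.reflexive (cong ((g ⊕ h) ^R_) (sym q^d))))
        R.refl (≡N-+-cong (subst (λ m → g ^R m ≡N g) q^d (frobenius-≡N d e∣ g)) (subst (λ m → h ^R m ≡N h) q^d (frobenius-≡N d e∣ h)))
        where
        q^d : q ^ d ≡ p ^ (k * d)
        q^d = trans (cong (_^ d) q≡p^k) (ℕP.^-*-assoc p k d)
      frobenius-≡N d e∣ (g ⊛ h) = ≡N-resp (R.sym (^-distrib-* g h (q ^ d))) R.refl (≡N-*-cong (frobenius-≡N d e∣ g) (frobenius-≡N d e∣ h))

      frobenius^-≡N : ∀ d → e ∣ q ^ d ∸ 1 → ∀ j g → g ^R ((q ^ d) ^ j) ≡N g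
      frobenius^-≡N d e∣ zero    g = ≡N-reflexive (R.*-identityʳ g)
      frobenius^-≡N d e∣ (suc j) g = ≡N-trans (≡N-resp (^-assocʳ g (q ^ d) ((q ^ d) ^ j)) R.refl (frobenius^-≡N d e∣ j (g ^R (q ^ d))))
                                       (frobenius-≡N d e∣ g)

      -- Iterating the congruence gives g ≡ g^((q^d)^a) modulo N, and the right side is 0 once the
      -- exponent exceeds the nilpotency index. So the radical is generated by N.
      nilpotent-divisible : ∀ d → 1 ≤ d → e ∣ q ^ d ∸ 1 → ∀ g → Nilpotent g → Uniserial.Divisible LT N g
      nilpotent-divisible d 1≤d e∣ g (a , z) with ≡N-sym (frobenius^-≡N d e∣ a g)
      ... | h , eq = h , λ v → trans (at eq v tt) (trans (cong (_⊞ ev N (ev h v)) (trans (ev-^ g ((q ^ d) ^ a) v) (vanish v))) (⊞-identityˡ _))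
        where
        1<q^d : 1 < q ^ d
        1<q^d = ≤-trans 1<q (subst (_≤ q ^ d) (ℕP.^-identityʳ q) (ℕP.^-monoʳ-≤ q {{>-nonZero (ℕP.<⇒≤ 1<q)}} 1≤d))
        vanish : ∀ v → iter (ev g) ((q ^ d) ^ a) v ≡ 0v
        vanish v = iter-absorb (ev-0 g) (ℕP.<⇒≤ (n<b^n 1<q^d a)) (z v)

    module _ (T-inj : Injective T) where

      order-exists : ∃ λ o → 1 ≤ o × (∀ v → iter T o v ≡ v) × (∀ l → (∀ v → iter T l v ≡ v) → o ∣ l)
      order-exists with least (λ o → (1 ℕ.≤? o) ×-dec allV (λ v → iter T o v ≟v v)) M (ℕP.1≤n! (q ^ n) , iter-N! T-inj (card-V n))
      ... | o , _ , (1≤o , per) , min = o , 1≤o , per , divisor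
        where
        instance _ = >-nonZero 1≤o
        divisor : ∀ l → (∀ v → iter T l v ≡ v) → o ∣ l
        divisor l fix = m%n≡0⇒n∣m l o rem≡0
          where
          rem : ∀ v → iter T (l % o) v ≡ v
          rem v = trans (cong (iter T (l % o)) (sym (iter-fix-∣ T (n∣m*n (l / o)) (per v))))
            (trans (sym (iter-+ T (l % o) (l / o * o) v)) (trans (cong (λ m → iter T m v) (sym (m≡m%n+[m/n]*n l o))) (fix v)))
          rem≡0 : l % o ≡ 0
          rem≡0 with l % o | rem | m%n<n l o
          ... | zero  | _ | _   = refl
          ... | suc m | r | r<o = contradiction (s≤s z≤n , r) (min (suc m) r<o)

      module _ (ind : Indecomposable T) (1≤n : 1 ≤ n) {e t}
               (p∤e : ¬ p ∣ e) (order : ∀ v → iter T (e * p ^ t) v ≡ v) (order-∣ : ∀ l → (∀ v → iter T l v ≡ v) → e * p ^ t ∣ l) where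

        private N = power-minus-1 e

        -- If T^l - 1 is nilpotent, then T^(l p^a) = 1 for some a, so e p^t divides l p^a; the
        -- factor p^a is cancelled as p does not divide e.
        nilpotent-∣ : ∀ l → Nilpotent (power-minus-1 l) → e ∣ l
        nilpotent-∣ l (a , z) = ∣-cancel-p^ p∤e a (∣-trans (m∣m*n (p ^ t)) (order-∣ (l * p ^ a) λ v → proj₁ (fix⇔ l a v) (vanish v)))
          where
          vanish : ∀ v → iter (ev (power-minus-1 l)) (p ^ a) v ≡ 0v
          vanish v = iter-absorb (ev-0 (power-minus-1 l)) (ℕP.<⇒≤ (n<p^n a)) (z v)

        fixed-zero : ∀ l → ¬ e ∣ l → ∀ v → iter T l v ≡ v → v ≡ 0v
        fixed-zero l e∤l v fix with fitting ind (power-minus-1 l)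
        ... | inj₁ u = unit-inj {power-minus-1 l} u (trans (ev-power-minus-1 l v) (trans (cong (_⊟ v) fix) (⊟-self v)))
        ... | inj₂ z = contradiction (nilpotent-∣ l z) e∤l

        N-nilpotent : Nilpotent N
        N-nilpotent = p ^ t , λ v → proj₂ (fix⇔ e t v) (order v)

        module _ (1≤e : 1 ≤ e) {d} (A : Card (λ v → ev N v ≡ 0v) (q ^ d)) where

          -- On ker N the power T^e is the identity, while no smaller positive power fixes a nonzero
          -- vector. Its q^d - 1 nonzero vectors therefore fall into cycles of length exactly e.
          e∣q^d-1 : e ∣ q ^ d ∸ 1
          e∣q^d-1 with card-minus A {Q = _≡ 0v} (_≟v 0v) (card-single 0v refl (λ _ → sym)) (λ { v refl → ev-0 N })
          ... | m , A′ , q^d≡ = subst (e ∣_) (cong (_∸ 1) (sym q^d≡))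
                (Orbits.exact-divides _≟v_ T-inj m (<-wellFounded m)
                  (λ v w → trans (ev-comm N X v) (trans (cong T (proj₁ w)) (lin-0 LT)) , λ z → proj₂ w (T-inj (trans z (sym (lin-0 LT)))))
                  (λ v w → 1≤e , ⊟≡0 (trans (sym (ev-power-minus-1 e v)) (proj₁ w)) , λ j 1≤j j<e fix →
                     proj₂ w (fixed-zero j (λ e∣j → ℕP.<⇒≱ j<e (∣⇒≤ {{>-nonZero 1≤j}} e∣j)) v fix)) A′)

          module _ (1≤d : 1 ≤ d) {l v} (top-v : iter (ev N) l v ≢ 0v) (nil : ∀ x → iter (ev N) (suc l) x ≡ 0v) where

            dichotomy : ∀ g → Unit g ⊎ Uniserial.Divisible LT N g
            dichotomy g with fitting ind g
            ... | inj₁ u = inj₁ u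
            ... | inj₂ z = inj₂ (nilpotent-divisible e d 1≤d e∣q^d-1 g z)

            open Uniserial.Structure LT N dichotomy {l} {v} top-v nil

            private w₀ = iter (ev N) l v

            Ker : V n → Set
            Ker x = ev N x ≡ 0v

            Ker-ev : ∀ g x → Ker x → Ker (ev g x)
            Ker-ev g x Nx = trans (ev-comm N g x) (trans (cong (ev g) Nx) (ev-0 g))

            module W = OpRing Ker Ker-ev

            W-domain : ∀ g h → g ⊛ h W.≈ con 0F → g W.≈ con 0F ⊎ h W.≈ con 0F
            W-domain g h z with dichotomy g
            ... | inj₁ u         = inj₂ (W.agree λ x Nx → trans (unit-inj {g} u (trans (W.at z x Nx) (0∙ x))) (sym (0∙ x)))
            ... | inj₂ (f , div) = inj₁ (W.agree λ x Nx → trans (div x) (trans (ev-comm N f x) (trans (cong (ev f) Nx) (trans (ev-0 f) (sym (0∙ x))))))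

            W-1≉0 : ¬ (con 1F W.≈ con 0F)
            W-1≉0 z = top-v (trans (sym (1∙ w₀)) (trans (W.at z w₀ (nil v)) (0∙ w₀)))

            generator : ∀ x → Ker x → Op
            generator x Nx = proj₁ (kernel-generated ind Nx)

            -- The kernel of N is a field on which y^(q^d′) = y.
            d-minimal : ∀ d′ → 1 ≤ d′ → e ∣ q ^ d′ ∸ 1 → d ≤ d′
            d-minimal d′ 1≤d′ e∣ = q^-mono⁻ (subst (_≤ q ^ d′) (trans (ListP.length-tabulate op) refl)
              (Polynomials.Roots.power-roots-≤ W.ring W-1≉0 W-domain (q ^ d′)
                (≤-trans 1<q (subst (_≤ q ^ d′) (ℕP.^-identityʳ q) (ℕP.^-monoʳ-≤ q {{>-nonZero (ℕP.<⇒≤ 1<q)}} 1≤d′)))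
                (List.tabulate op) (AllPairsP.tabulate⁺ distinct) (ListAllP.tabulate⁺ root)))
              where
              module A = Card A
              -- Each vector of ker N is some operator applied to N^l v; these q^d operators are
              -- pairwise distinct on ker N and are roots of y^(q^d′) - y.
              op : Fin (q ^ d) → Op
              op i = generator (A.elem i) (A.elem-∈ i)
              op-w₀ : ∀ i → A.elem i ≡ ev (op i) w₀
              op-w₀ i = proj₂ (kernel-generated ind (A.elem-∈ i))
              distinct : ∀ {i j} → i ≢ j → ¬ (op i W.≈ op j)
              distinct {i} {j} i≢j e = i≢j (A.elem-inj (trans (op-w₀ i) (trans (W.at e w₀ (nil v)) (sym (op-w₀ j)))))
              root : ∀ i → (op i W.^R (q ^ d′)) W.≈ op i
              root i with frobenius-≡N e d′ e∣ (op i)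
              ... | h , eq = W.agree λ x Nx → trans (W.ev-^ (op i) (q ^ d′) x) (trans (sym (ev-^ (op i) (q ^ d′) x)) (trans (at eq x tt)
                    (trans (cong (ev (op i) x ⊞_) (trans (ev-comm N h x) (trans (cong (ev h) Nx) (ev-0 h)))) (⊞-identityʳ _))))

            invertible-type′ : InvertibleType T e
            invertible-type′ = record
              { 1≤e = 1≤e ; p∤e = p∤e ; d = d ; L = suc l ; t = t ; 1≤d = 1≤d ; 1≤L = s≤s z≤n
              ; e∣q^d-1 = e∣q^d-1 ; minimal = d-minimal
              ; n≡d*L = q^-inj (trans (sym (card-all ind A)) (ℕP.^-*-assoc q d (suc l)))
              ; order = order ; order-∣ = order-∣ ; fix-none = fixed-zero
              ; fix-card = fix-card }
              where
              -- The kernels of N^(p^s) grow by a factor q^d with each power of N until N^(l+1) = 0;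
              -- this is where the minimum with L comes from.
              fix-card : ∀ s → Card (λ v → iter T (e * p ^ s) v ≡ v) (q ^ (d * (p ^ s ⊓ suc l)))
              fix-card s with ℕP.≤-total (p ^ s) (suc l)
              ... | inj₁ le = subst (Card _) (trans (ℕP.^-*-assoc q d (p ^ s)) (cong (λ m → q ^ (d * m)) (sym (ℕP.m≤n⇒m⊓n≡m le))))
                    (card-⇔ (card-kernel ind A (p ^ s) le) (λ v → proj₁ (fix⇔ e s v)) (λ v → proj₂ (fix⇔ e s v)))
              ... | inj₂ ge = subst (Card _) (trans (sym (card-all ind A)) (trans (ℕP.^-*-assoc q d (suc l)) (cong (λ m → q ^ (d * m)) (sym (ℕP.m≥n⇒m⊓n≡n ge)))))
                    (card-⇔ (card-V n) (λ v _ → proj₁ (fix⇔ e s v) (iter-absorb (ev-0 N) ge (nil v))) _)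

    invertible-type : Injective T → Indecomposable T → 1 ≤ n → ∃ (InvertibleType T)
    invertible-type T-inj ind 1≤n = case order-exists T-inj of λ where
      (o , 1≤o , order , order-∣) → case valuation o (<-wellFounded o) 1≤o of λ where
        (e , t , refl , p∤e) →
          let 1≤e = ℕP.n≢0⇒n>0 λ { refl → p∤e (p ∣0) }
              N   = power-minus-1 e
              S   = kernel (ev-lin N)
          in case Uniserial.top LT N (proj₂ (nonzero-vector 1≤n)) (N-nilpotent T-inj ind 1≤n {e} {t} p∤e order order-∣) of λ where
            (l , v , top-v , nil) → e , invertible-type′ T-inj ind 1≤n {e} {t} p∤e order order-∣ 1≤e (card-subspace S)
              (basis-nonempty (proj₂ (basis S)) _ (nil v) top-v) {l} {v} top-v nil

  indecomposable-type : ∀ {n} {T : V n → V n} → IsLin T → 1 ≤ n → Indecomposable T → (T ≃ shift {n}) ⊎ ∃ (InvertibleType T)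
  indecomposable-type {T = T} L 1≤n ind with Eval.fitting L ind X
  ... | inj₂ nilT = inj₁ (nilpotent-block L 1≤n ind nilT)
  ... | inj₁ unit = inj₂ (Invertible.invertible-type L (lin-inj L λ v → Eval.unit-inj L {X} unit) ind 1≤n)


  module _ {X : Set} {f : X → X} (f-inj : Injective f) where

    fix-gcd : ∀ {x} a b → iter f a x ≡ x → iter f b x ≡ x → iter f (gcd a b) x ≡ x
    fix-gcd {x} a b fa fb with Bézout.identity (gcd-GCD a b)
    ... | Bézout.+- u v eq = trans (cong (iter f (gcd a b)) (sym (iter-fix-∣ f (n∣m*n v) fb)))
          (trans (sym (iter-+ f (gcd a b) (v * b) x)) (trans (cong (λ m → iter f m x) eq) (iter-fix-∣ f (n∣m*n u) fa)))
    ... | Bézout.-+ u v eq = trans (cong (iter f (gcd a b)) (sym (iter-fix-∣ f (n∣m*n u) fa)))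
          (trans (sym (iter-+ f (gcd a b) (u * a) x)) (trans (cong (λ m → iter f m x) eq) (iter-fix-∣ f (n∣m*n v) fb)))

  order-inj : {X : Set} {f : X → X} → ∀ o → 1 ≤ o → (∀ x → iter f o x ≡ x) → Injective f
  order-inj {f = f} (suc o) _ per {x} {y} e = trans (sym (per x)) (trans (iter-comm f 1 o x)
    (trans (cong (iter f o) e) (trans (sym (iter-comm f 1 o y)) (per y))))

  -- The quotient of the gcd by e divides p^u. Only fixed points of T^(e p^s) are then left to
  -- count.
  gcd-∣-p^ : ∀ {e l} u → ¬ p ∣ e → e ∣ l → ∃ λ s → gcd l (e * p ^ u) ≡ e * p ^ s
  gcd-∣-p^ {e} {l} u p∤e e∣l with gcd-greatest e∣l (m∣m*n (p ^ u))
  ... | divides c eq with prime-power-divisor u (*-cancelˡ-∣ e {{ℕ.≢-nonZero λ { refl → p∤e (p ∣0) }}}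
                            (subst (_∣ e * p ^ u) (trans eq (ℕP.*-comm c e)) (gcd[m,n]∣n l (e * p ^ u))))
  ... | s , refl = s , trans eq (ℕP.*-comm (p ^ s) e)

  -- Minimality makes d a function of e, and L = n / d. If e does not divide k, only 0 is fixed by
  -- the k-th power; otherwise k may be replaced by its gcd with a common period e p^u, and
  -- `fix-card` depends on d, L and s only.
  same-type : ∀ {n e} {T T′ : V n → V n} → IsLin T → IsLin T′ → InvertibleType T e → InvertibleType T′ e → T ≃ T′
  same-type {n} {e} {T} {T′} LT LT′ A B = PermConj.conjugate _≟v_ _≟v_ 0v 0v (order-inj (e * p ^ A.t) (1≤ep^ A.t) A.order) (order-inj (e * p ^ B.t) (1≤ep^ B.t) B.order)
      (q ^ n) (<-wellFounded _) _ _ (card-V n) (card-V n)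
      λ l 1≤l M C → card-⇔ (same l M (card-⇔ C (λ _ → proj₂) (λ _ f → tt , f))) (λ _ f → tt , f) (λ _ → proj₂)
    where
    module A = InvertibleType A
    module B = InvertibleType B
    1≤ep^ : ∀ t → 1 ≤ e * p ^ t
    1≤ep^ t = ℕP.*-mono-≤ A.1≤e (≤-trans (s≤s z≤n) (n<p^n t))
    -- Any common upper bound of the two exponents makes e p^u a period of both maps.
    u = A.t + B.t
    A-order : ∀ v → iter T (e * p ^ u) v ≡ v
    A-order v = iter-fix-∣ T (*-monoʳ-∣ e (subst (p ^ A.t ∣_) (sym (ℕP.^-distribˡ-+-* p A.t B.t)) (m∣m*n (p ^ B.t)))) (A.order v)
    B-order : ∀ v → iter T′ (e * p ^ u) v ≡ v
    B-order v = iter-fix-∣ T′ (*-monoʳ-∣ e (subst (p ^ B.t ∣_) (sym (ℕP.^-distribˡ-+-* p A.t B.t)) (n∣m*n (p ^ A.t)))) (B.order v)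
    d≡ : A.d ≡ B.d
    d≡ = ℕP.≤-antisym (A.minimal B.d B.1≤d B.e∣q^d-1) (B.minimal A.d A.1≤d A.e∣q^d-1)
    L≡ : A.L ≡ B.L
    L≡ = ℕP.*-cancelˡ-≡ A.L B.L A.d {{>-nonZero A.1≤d}} (trans (sym A.n≡d*L) (trans B.n≡d*L (cong (_* B.L) (sym d≡))))
    same : ∀ l M → Card (λ v → iter T l v ≡ v) M → Card (λ v → iter T′ l v ≡ v) M
    same l M C with e ∣? l
    ... | no e∤l = card-⇔ C (λ v f → trans (cong (iter T′ l) (A.fix-none l e∤l v f)) (trans (lin-0 (lin-iter LT′ l)) (sym (A.fix-none l e∤l v f))))
                            (λ v f → trans (cong (iter T l) (B.fix-none l e∤l v f)) (trans (lin-0 (lin-iter LT l)) (sym (B.fix-none l e∤l v f))))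
    ... | yes e∣l with gcd-∣-p^ u A.p∤e e∣l
    ... | s , g≡ = subst (Card _) (card-unique (A.fix-card s) C (λ v f → iter-fix-∣ T g∣l f)
                     (λ v f → subst (λ m → iter T m v ≡ v) g≡ (fix-gcd (order-inj (e * p ^ A.t) (1≤ep^ A.t) A.order) l (e * p ^ u) f (A-order v))))
                   (card-⇔ (subst (Card _) (cong₂ (λ d L → q ^ (d * (p ^ s ⊓ L))) (sym d≡) (sym L≡)) (B.fix-card s))
                     (λ v f → iter-fix-∣ T′ g∣l f)
                     (λ v f → subst (λ m → iter T′ m v ≡ v) g≡ (fix-gcd (order-inj (e * p ^ B.t) (1≤ep^ B.t) B.order) l (e * p ^ u) f (B-order v))))
      where
      g∣l : e * p ^ s ∣ l
      g∣l = subst (_∣ l) g≡ (gcd[m,n]∣m l (e * p ^ u))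

-- Counting the multisets behind the sums over `P n`.

private variable X Y : Set

module _ (s l : ℕ) where

  private
    Zero : List ℕ → Set
    Zero (zero ∷ xs) = List.length xs ≡ s × sum xs ≡ suc l
    Zero _           = ⊥

    Positive : List ℕ → Set
    Positive (suc x ∷ xs) = List.length xs ≡ s × x + sum xs ≡ l
    Positive _            = ⊥

    Multi : ℕ → ℕ → List ℕ → Set
    Multi s l xs = List.length xs ≡ s × sum xs ≡ l

    increment : List ℕ → List ℕ
    increment []       = []
    increment (x ∷ xs) = suc x ∷ xs

    decrement : List ℕ → List ℕ
    decrement []       = []
    decrement (x ∷ xs) = ℕ.pred x ∷ xs

    tail : List ℕ → List ℕ
    tail []       = []
    tail (_ ∷ xs) = xs

  card-multi-step : ∀ {a b} → Card (Multi s (suc l)) a → Card (Multi (suc s) l) b → Card (Multi (suc s) (suc l)) (a + b)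
  card-multi-step A B = card-⇔ (card-⊎ zeros positives λ { (zero ∷ xs) _ () ; (suc x ∷ xs) () _ }) join split
    where
    zeros : Card Zero _
    zeros = card-bij A (0 ∷_) tail (λ _ p → p) (λ { (zero ∷ xs) p → p }) (λ { (zero ∷ xs) _ → refl }) (λ { _ _ _ _ refl → refl })
    positives : Card Positive _
    positives = card-bij B increment decrement (λ { (x ∷ xs) (e , f) → ℕP.suc-injective e , f }) (λ { (suc x ∷ xs) (e , f) → cong suc e , f })
      (λ { (suc x ∷ xs) _ → refl }) (λ { (x ∷ xs) (y ∷ ys) _ _ refl → refl ; [] (_ ∷ _) (() , _) })
    join : ∀ xs → Zero xs ⊎ Positive xs → Multi (suc s) (suc l) xs
    join (zero ∷ xs)  (inj₁ (e , f)) = cong suc e , f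
    join (suc x ∷ xs) (inj₂ (e , f)) = cong suc e , cong suc f
    split : ∀ xs → Multi (suc s) (suc l) xs → Zero xs ⊎ Positive xs
    split (zero ∷ xs)  (e , f) = inj₁ (ℕP.suc-injective e , f)
    split (suc x ∷ xs) (e , f) = inj₂ (ℕP.suc-injective e , ℕP.suc-injective f)

-- Stars and bars: a list of s multiplicities with sum l is a multiset of size l over s kinds. A
-- zero or positive first entry corresponds to the two terms of Pascal's rule.
card-multi : ∀ s l → Card (λ xs → List.length xs ≡ s × sum xs ≡ l) ((s + l ∸ 1) choose l)
card-multi zero    zero    = card-single [] (refl , refl) λ { [] _ → refl }
card-multi zero    (suc l) = subst (Card _) (sym (k>n⇒nCk≡0 (ℕP.n<1+n l))) (card-empty λ { [] (_ , ()) })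
card-multi (suc s) zero    = card-bij (card-multi s zero) (0 ∷_) (List.drop 1) (λ { _ (e , f) → cong suc e , f })
  (λ { (zero ∷ xs) (e , f) → ℕP.suc-injective e , f }) (λ { (zero ∷ xs) _ → refl }) (λ { _ _ _ _ refl → refl })
card-multi (suc s) (suc l) = subst (Card _) pascal (card-multi-step s l (card-multi s (suc l)) (card-multi (suc s) l))
  where
  pascal : (s + suc l ∸ 1) choose suc l + (s + l) choose l ≡ (s + suc l) choose suc l
  pascal rewrite ℕP.+-suc s l = trans (ℕP.+-comm ((s + l) choose suc l) _) (nCk+nC[k+1]≡[n+1]C[k+1] (s + l) l)

card-fibres : {R : Y → Set} {h : Y → X} (f : X → ℕ) → (∀ x → Card (λ y → R y × h y ≡ x) (f x)) →
              ∀ xs → Unique xs → Card (λ y → R y × h y ∈ xs) (sum (List.map f xs))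
card-fibres f A []       _        = card-empty λ { _ (_ , ()) }
card-fibres f A (x ∷ xs) (x∉ ∷ u) = card-⇔ (card-⊎ (A x) (card-fibres f A xs u) (λ { y (_ , refl) (_ , i) → ListAll.lookup x∉ i refl }))
  (λ { y (inj₁ (r , e)) → r , here e ; y (inj₂ (r , i)) → r , there i })
  (λ { y (r , here e) → inj₁ (r , e) ; y (r , there i) → inj₂ (r , i) })

card-Vec-∀ : ∀ n {Q : Fin n → Y → Set} (c : Fin n → ℕ) → (∀ k → Card (Q k) (c k)) →
             Card (λ (M : Vec Y n) → ∀ k → Q k (Vec.lookup M k)) (product (List.tabulate c))
card-Vec-∀ zero    c A = card-single [] (λ ()) λ { [] _ → refl }
card-Vec-∀ (suc n) c A = card-bij (card-× (A zero) (card-Vec-∀ n (c ∘ suc) (A ∘ suc))) (uncurry _∷_) (λ { (x ∷ v) → x , v })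
  (λ { _ (p , r) zero → p ; _ (p , r) (suc k) → r k }) (λ { (x ∷ v) r → r zero , r ∘ suc })
  (λ { (x ∷ v) _ → refl }) λ { _ _ _ _ refl → refl }

allVecs-unique : ∀ n b → Unique (allVecs n b)
allVecs-unique zero    b = [] ∷ []
allVecs-unique (suc n) b = UniqueP.concat⁺ (ListAllP.map⁺ (ListAll.universal (λ x → UniqueP.map⁺ VecP.∷-injectiveʳ (allVecs-unique n b)) (List.upTo b)))
  (AllPairsP.map⁺ (AllPairs.map disjoint (UniqueP.upTo⁺ b)))
  where
  disjoint : ∀ {x y} → x ≢ y → ∀ {v} → ¬ (v ∈ List.map (x ∷_) (allVecs n b) × v ∈ List.map (y ∷_) (allVecs n b))
  disjoint x≢y (i , j) with ∈-map⁻ _ i | ∈-map⁻ _ j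
  ... | _ , _ , refl | _ , _ , e = x≢y (VecP.∷-injectiveˡ e)

∈-allVecs : ∀ {n b} (v : Vec ℕ n) → (∀ k → Vec.lookup v k < b) → v ∈ allVecs n b
∈-allVecs []      _ = here refl
∈-allVecs (x ∷ v) h = ∈-concat⁺′ (∈-map⁺ (x ∷_) (∈-allVecs v (h ∘ suc))) (∈-map⁺ _ (∈-upTo⁺ (h zero)))

term≤sum : ∀ {n} (f : Fin n → ℕ) k → f k ≤ sum (List.tabulate f)
term≤sum f zero    = ℕP.m≤m+n _ _
term≤sum f (suc k) = ≤-trans (term≤sum (f ∘ suc) k) (ℕP.m≤n+m _ (f zero))

weight-tabulate : ∀ {n} (v : Vec ℕ n) → weight v ≡ sum (List.tabulate λ k → Vec.lookup v k * suc (toℕ k))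
weight-tabulate v = cong sum (ListP.map-tabulate id (λ k → Vec.lookup v k * suc (toℕ k)))

-- Each entry is at most its own contribution to the weight, hence at most n, so the finite box of
-- `allVecs` misses nothing.
∈-P : ∀ {n} {v : Vec ℕ n} → InP n v → v ∈ P n
∈-P {n} {v} i = ∈-filter⁺ (InP? n) (∈-allVecs v λ k → s≤s (≤-trans (ℕP.m≤m*n (Vec.lookup v k) (suc (toℕ k)))
  (≤-trans (term≤sum (λ k → Vec.lookup v k * suc (toℕ k)) k) (subst (_≤ n) (weight-tabulate v) (proj₂ i))))) i

Family : (ℕ → ℕ) → ∀ n → Vec (List ℕ) n → Set
Family s n M = ∀ k → List.length (Vec.lookup M k) ≡ s (suc (toℕ k))

sums : ∀ {n} → Vec (List ℕ) n → Vec ℕ n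
sums = Vec.map sum

-- M assigns to each i a list of s i multiplicities, whose sum is λ_i.
card-families : ∀ s n → Card (λ M → Family s n M × InP n (sums M)) (sumP s n)
card-families s n = card-⇔ (card-fibres {R = Family s n} {h = sums}
    (λ v → product (List.map (binomials v) (List.allFin n)))
    (λ v → subst (Card _) (cong product (sym (ListP.map-tabulate id (binomials v))))
      (card-⇔ (card-Vec-∀ n (binomials v) (λ k → card-multi (s (suc (toℕ k))) (Vec.lookup v k)))
        (λ M h → (proj₁ ∘ h) , ext λ k → trans (VecP.lookup-map k sum M) (proj₂ (h k)))
        (λ { M (h , refl) k → h k , sym (VecP.lookup-map k sum M) })))
    (P n) (UniqueP.filter⁺ (InP? n) (allVecs-unique n (suc n))))
  (λ M (h , i) → h , proj₂ (∈-filter⁻ (InP? n) {xs = allVecs n (suc n)} i)) (λ M (h , i) → h , ∈-P i)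
  where
  binomials : Vec ℕ n → Fin n → ℕ
  binomials v k = (s (suc (toℕ k)) + Vec.lookup v k ∸ 1) choose Vec.lookup v k
  ext : ∀ {n} {u v : Vec ℕ n} → (∀ k → Vec.lookup u k ≡ Vec.lookup v k) → u ≡ v
  ext {u = u} {v} e = trans (sym (VecP.tabulate∘lookup u)) (trans (VecP.tabulate-cong e) (VecP.tabulate∘lookup v))

-- Divisor sums, their inversion, and the orders of the elements of ℤ/e.

when : {P : Set} → Dec P → ℕ → ℕ
when (yes _) w = w
when (no _)  _ = 0

when-yes : {P : Set} (d : Dec P) → P → ∀ w → when d w ≡ w
when-yes (yes _) _ w = refl
when-yes (no ¬p) p w = contradiction p ¬p

when-no : {P : Set} (d : Dec P) → ¬ P → ∀ w → when d w ≡ 0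
when-no (yes p) ¬p w = contradiction p ¬p
when-no (no _)  _  w = refl

when-0 : {P : Set} (d : Dec P) → when d 0 ≡ 0
when-0 (yes _) = refl
when-0 (no _)  = refl

when-+ : {P : Set} (d : Dec P) → ∀ a b → when d (a + b) ≡ when d a + when d b
when-+ (yes _) a b = refl
when-+ (no _)  a b = refl

sumTo : (ℕ → ℕ) → ℕ → ℕ
sumTo f zero    = 0
sumTo f (suc n) = f n + sumTo f n

sumTo-cong : ∀ {f g} n → (∀ j → j < n → f j ≡ g j) → sumTo f n ≡ sumTo g n
sumTo-cong zero    e = refl
sumTo-cong (suc n) e = cong₂ _+_ (e n (ℕP.n<1+n n)) (sumTo-cong n λ j j<n → e j (ℕP.m<n⇒m<1+n j<n))

+-interchange : ∀ a b c d → (a + b) + (c + d) ≡ (a + c) + (b + d)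
+-interchange = solve 4 (λ a b c d → (a :+ b) :+ (c :+ d) := (a :+ c) :+ (b :+ d)) refl
  where open +-*-Solver

sumTo-+ : ∀ f g n → sumTo (λ j → f j + g j) n ≡ sumTo f n + sumTo g n
sumTo-+ f g zero    = refl
sumTo-+ f g (suc n) = trans (cong (f n + g n +_) (sumTo-+ f g n)) (+-interchange (f n) (g n) _ _)

sumTo-0 : ∀ {f} n → (∀ j → j < n → f j ≡ 0) → sumTo f n ≡ 0
sumTo-0 zero    z = refl
sumTo-0 (suc n) z = cong₂ _+_ (z n (ℕP.n<1+n n)) (sumTo-0 n λ j j<n → z j (ℕP.m<n⇒m<1+n j<n))

sumTo-single : ∀ {f} e n → e < n → (∀ j → j ≢ e → f j ≡ 0) → sumTo f n ≡ f e
sumTo-single {f} e (suc n) e<n z with e ℕ.≟ n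
... | yes refl = trans (cong (f n +_) (sumTo-0 n λ j j<n → z j (ℕP.<⇒≢ j<n))) (ℕP.+-identityʳ _)
... | no e≢n   = trans (cong (_+ sumTo f n) (z n (e≢n ∘ sym))) (sumTo-single e n (ℕP.≤∧≢⇒< (ℕP.≤-pred e<n) e≢n) z)

divisor-sum : ℕ → List (ℕ × ℕ) → ℕ
divisor-sum l []             = 0
divisor-sum l ((e , w) ∷ es) = when (e ∣? l) w + divisor-sum l es

weight-at : ℕ → List (ℕ × ℕ) → ℕ
weight-at l []             = 0
weight-at l ((e , w) ∷ es) = when (e ℕ.≟ l) w + weight-at l es

divisor-sum-weights : ∀ {l} → 1 ≤ l → ∀ es → divisor-sum l es ≡ sumTo (λ j → when (j ∣? l) (weight-at j es)) (suc l)
divisor-sum-weights {l} 1≤l []             = sym (sumTo-0 (suc l) λ j _ → when-0 (j ∣? l))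
divisor-sum-weights {l} 1≤l ((e , w) ∷ es) = sym (trans (sumTo-cong (suc l) λ j _ → when-+ (j ∣? l) (when (e ℕ.≟ j) w) (weight-at j es))
  (trans (sumTo-+ (λ j → when (j ∣? l) (when (e ℕ.≟ j) w)) _ (suc l)) (cong₂ _+_ single (sym (divisor-sum-weights 1≤l es)))))
  where
  off : ∀ j → j ≢ e → when (j ∣? l) (when (e ℕ.≟ j) w) ≡ 0
  off j j≢e = trans (cong (when (j ∣? l)) (when-no (e ℕ.≟ j) (j≢e ∘ sym) w)) (when-0 (j ∣? l))
  single : sumTo (λ j → when (j ∣? l) (when (e ℕ.≟ j) w)) (suc l) ≡ when (e ∣? l) w
  single with e ∣? l
  ... | yes e∣l = trans (sumTo-single e (suc l) (s≤s (∣⇒≤ {{>-nonZero 1≤l}} e∣l)) off)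
                    (trans (when-yes (e ∣? l) e∣l _) (when-yes (e ℕ.≟ e) refl w))
  ... | no e∤l  = sumTo-0 (suc l) λ j _ → case j ℕ.≟ e of λ { (yes refl) → when-no (j ∣? l) e∤l _ ; (no j≢e) → off j j≢e }

-- Möbius inversion by strong induction: the weights at proper divisors of l are already known to
-- agree, and the remaining term is the weight at l. Taking E = 0 covers every l ≥ 1, since all
-- numbers divide 0.
weights-unique : ∀ E es fs → (∀ l → 1 ≤ l → l ∣ E → divisor-sum l es ≡ divisor-sum l fs) →
                 ∀ l → Acc _<_ l → 1 ≤ l → l ∣ E → weight-at l es ≡ weight-at l fs
weights-unique E es fs same l (acc rs) 1≤l l∣E = ℕP.+-cancelʳ-≡ (sumTo (λ j → when (j ∣? l) (weight-at j es)) l) _ _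
  (trans (cong (_+ sumTo (λ j → when (j ∣? l) (weight-at j es)) l) (sym (when-yes (l ∣? l) ∣-refl (weight-at l es))))
    (trans (sym (divisor-sum-weights 1≤l es)) (trans (same l 1≤l l∣E) (trans (divisor-sum-weights 1≤l fs)
      (cong₂ _+_ (when-yes (l ∣? l) ∣-refl (weight-at l fs)) (sumTo-cong l λ j j<l → sym (below j j<l)))))))
  where
  below : ∀ j → j < l → when (j ∣? l) (weight-at j es) ≡ when (j ∣? l) (weight-at j fs)
  below j j<l with j ∣? l
  ... | no _    = refl
  ... | yes j∣l = weights-unique E es fs same j (rs j<l)
                    (ℕP.n≢0⇒n>0 λ { refl → ℕP.>⇒≢ 1≤l (0∣⇒≡0 j∣l) }) (∣-trans j∣l l∣E)

module AdditiveOrders (e : ℕ) (1≤e : 1 ≤ e) where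

  private
    search-order = λ j → least (λ k → (1 ℕ.≤? k) ×-dec (e ∣? j * k)) e (1≤e , n∣m*n j)

  additive-order : ℕ → ℕ
  additive-order j = proj₁ (search-order j)

  order-∣⇔ : ∀ j l → (additive-order j ∣ l → e ∣ j * l) × (e ∣ j * l → additive-order j ∣ l)
  order-∣⇔ j l with search-order j
  ... | c , _ , (1≤c , e∣jc) , min = (λ c∣l → ∣-trans e∣jc (*-monoʳ-∣ j c∣l)) , divisor
    where
    instance _ = >-nonZero 1≤c
    divisor : e ∣ j * l → c ∣ l
    divisor e∣jl with l % c in eq | m%n<n l c
    ... | zero  | _   = m%n≡0⇒n∣m l c eq
    ... | suc r | r<c = contradiction (s≤s z≤n , e∣jr) (min (suc r) r<c)
      where
      l≡ : l ≡ l / c * c + suc r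
      l≡ = trans (m≡m%n+[m/n]*n l c) (trans (cong (_+ l / c * c) eq) (ℕP.+-comm (suc r) _))
      e∣jr : e ∣ j * suc r
      e∣jr = ∣m+n∣m⇒∣n (subst (e ∣_) (trans (cong (j *_) l≡) (ℕP.*-distribˡ-+ j _ _)) e∣jl)
               (∣-trans e∣jc (*-monoʳ-∣ j (n∣m*n (l / c))))

  orders : ℕ → List (ℕ × ℕ)
  orders zero    = []
  orders (suc J) = (additive-order (suc J) , 1) ∷ orders J

  card-orders : ∀ l J → Card (λ j → (1 ≤ j × j ≤ J) × e ∣ j * l) (divisor-sum l (orders J))
  card-orders l zero    = card-empty λ { (suc j) ((_ , ()) , _) }
  card-orders l (suc J) with additive-order (suc J) ∣? l
  ... | yes d = card-⇔ (card-⊎ (card-single {P = suc J ≡_} (suc J) refl (λ _ → id)) (card-orders l J) (λ { _ refl ((_ , le) , _) → ℕP.<⇒≱ le ≤-refl }))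
        (λ { _ (inj₁ refl) → (s≤s z≤n , ≤-refl) , proj₁ (order-∣⇔ (suc J) l) d ; j (inj₂ ((p , r) , s)) → (p , ℕP.m≤n⇒m≤1+n r) , s })
        λ { j ((p , r) , s) → case ℕP.m≤n⇒m<n∨m≡n r of λ { (inj₁ lt) → inj₂ ((p , ℕP.≤-pred lt) , s) ; (inj₂ eq) → inj₁ (sym eq) } }
  ... | no ¬d = card-⇔ (card-orders l J) (λ { j ((p , r) , s) → (p , ℕP.m≤n⇒m≤1+n r) , s })
        λ { j ((p , r) , s) → case ℕP.m≤n⇒m<n∨m≡n r of λ { (inj₁ lt) → (p , ℕP.≤-pred lt) , s ; (inj₂ refl) → contradiction (proj₂ (order-∣⇔ j l) s) ¬d } }

  -- The sum counts the j in 1, ..., e with e dividing j l, that is, with the order of j in ℤ/e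
  -- dividing l. These are the multiples of e / l, and there are l of them.
  divisor-sum-orders : ∀ l → 1 ≤ l → l ∣ e → divisor-sum l (orders e) ≡ l
  divisor-sum-orders l 1≤l (divides m e≡) = card-unique (card-orders l e) multiples (λ _ → id) (λ _ → id)
    where
    instance _ = >-nonZero 1≤l
    1≤m : 1 ≤ m
    1≤m = ℕP.n≢0⇒n>0 λ { refl → ℕP.>⇒≢ 1≤e e≡ }
    multiples : Card (λ j → (1 ≤ j × j ≤ e) × e ∣ j * l) l
    multiples = record
      { elem = λ i → suc (toℕ i) * m
      ; elem-∈ = λ i → (ℕP.*-mono-≤ (s≤s (z≤n {toℕ i})) 1≤m , subst (suc (toℕ i) * m ≤_) (trans (ℕP.*-comm l m) (sym e≡)) (ℕP.*-monoˡ-≤ m (FinP.toℕ<n i)))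
                       , divides (suc (toℕ i)) (trans (ℕP.*-assoc (suc (toℕ i)) m l) (cong (suc (toℕ i) *_) (sym e≡)))
      ; index = λ j p → fromℕ< (bound j p)
      ; elem-index = λ j p → trans (cong (λ t → suc t * m) (FinP.toℕ-fromℕ< (bound j p))) (sym (multiple j p))
      ; elem-inj = λ eq → FinP.toℕ-injective (ℕP.suc-injective (ℕP.*-cancelʳ-≡ _ _ m {{>-nonZero 1≤m}} eq)) }
      where
      quotient-of : ∀ j → (1 ≤ j × j ≤ e) × e ∣ j * l → ∃ λ t → j ≡ suc t * m
      quotient-of j ((1≤j , _) , e∣jl) with *-cancelʳ-∣ {m} {j} l (subst (_∣ j * l) e≡ e∣jl)
      ... | divides zero refl    = contradiction 1≤j λ ()
      ... | divides (suc t) refl = t , refl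
      multiple : ∀ j p → j ≡ suc (proj₁ (quotient-of j p)) * m
      multiple j p = proj₂ (quotient-of j p)
      bound : ∀ j p → proj₁ (quotient-of j p) < l
      bound j p = ℕP.*-cancelʳ-≤ (suc (proj₁ (quotient-of j p))) l m {{>-nonZero 1≤m}}
        (subst (_≤ l * m) (multiple j p) (subst (j ≤_) (trans e≡ (ℕP.*-comm m l)) (proj₂ (proj₁ p))))

  additive-order-1 : additive-order 1 ≡ e
  additive-order-1 = ∣-antisym (proj₂ (order-∣⇔ 1 e) (n∣m*n 1))
    (subst (e ∣_) (ℕP.*-identityˡ _) (proj₁ (order-∣⇔ 1 (additive-order 1)) ∣-refl))

  weight-orders : 1 ≤ weight-at e (orders e)
  weight-orders = go e 1≤e
    where
    go : ∀ J → 1 ≤ J → 1 ≤ weight-at e (orders J)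
    go 1             _ = ≤-trans (ℕP.≤-reflexive (sym (when-yes (additive-order 1 ℕ.≟ e) additive-order-1 1))) (ℕP.m≤m+n (when (additive-order 1 ℕ.≟ e) 1) 0)
    go (suc (suc J)) _ = ≤-trans (go (suc J) (s≤s z≤n)) (ℕP.m≤n+m _ (when (additive-order (suc (suc J)) ℕ.≟ e) 1))

-- Semisimple blocks and the cyclic rotation.

module SimpleBlocks {q : ℕ} (F : FiniteField q) {p k : ℕ} (pr : Prime p) (q≡p^k : q ≡ p ^ k) where
  open FiniteField F using (0F; 1F)
  open LinAlg F
  open Decomposition F
  open PrimeFacts pr
  open InvertibleTypes F {p} {k} pr q≡p^k

  record Simple (e : ℕ) {w} (T : V w → V w) : Set where
    field
      1≤e      : 1 ≤ e
      fix-all  : ∀ l → e ∣ l → ∀ v → iter T l v ≡ v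
      fix-none : ∀ l → ¬ e ∣ l → ∀ v → iter T l v ≡ v → v ≡ 0v

  -- The second index records order and dimension of the nonzero blocks. Zero maps leave no entry:
  -- each positive power fixes exactly one of their vectors, so they serve as padding.
  data Simples : List Block → List (ℕ × ℕ) → Set where
    []   : Simples [] []
    _∷_  : ∀ {e w T L bs es} → Simple e T → Simples bs es → Simples ((w , T , L) ∷ bs) ((e , w) ∷ es)
    zero : ∀ {w T L bs es} → (∀ v → T v ≡ 0v) → Simples bs es → Simples ((w , T , L) ∷ bs) es

  card-fix-⊗ : {Y : Set} {m a b : ℕ} {f : V m → V m} {g : Y → Y} → ∀ l → Card (λ v → iter f l v ≡ v) (q ^ a) → Card (λ y → iter g l y ≡ y) (q ^ b) →
               Card (λ x → iter (f ⊗ g) l x ≡ x) (q ^ (a + b))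
  card-fix-⊗ {a = a} {b} {f} {g} l A B = subst (Card _) (sym (ℕP.^-distribˡ-+-* q a b)) (card-⇔ (card-× A B)
    (λ x (e₁ , e₂) → trans (iter-⊗ f g l x) (cong₂ _,_ e₁ e₂))
    (λ x e → cong proj₁ (trans (sym (iter-⊗ f g l x)) e) , cong proj₂ (trans (sym (iter-⊗ f g l x)) e)))

  -- A block of order e and dimension w contributes q^w fixed points if e divides l and one
  -- otherwise. The condition 1 ≤ l excludes the identity, which would fix every vector of a zero
  -- block.
  card-fix-simples : ∀ {bs es} → Simples bs es → ∀ l → 1 ≤ l → Card (λ x → iter (step bs) l x ≡ x) (q ^ divisor-sum l es)
  card-fix-simples [] l 1≤l = card-single tt refl λ _ _ → refl
  card-fix-simples {es = (e , w) ∷ es} (_∷_ {T = T} {L = L} S Ss) l 1≤l = card-fix-⊗ {a = when (e ∣? l) w} l (block (e ∣? l)) (card-fix-simples Ss l 1≤l)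
    where
    block : (d : Dec (e ∣ l)) → Card (λ v → iter T l v ≡ v) (q ^ when d w)
    block (yes e∣l) = card-⇔ (card-V w) (λ v _ → Simple.fix-all S l e∣l v) _
    block (no e∤l)  = card-single 0v (lin-0 (lin-iter L l)) λ v e → sym (Simple.fix-none S l e∤l v e)
  card-fix-simples {es = es} (zero {T = T} {bs = bs} T0 Ss) l@(suc l′) 1≤l = card-fix-⊗ {a = 0} {b = divisor-sum l es} {f = T} {g = step bs} l
    (card-single 0v (T0 (iter T l′ 0v)) λ v e → trans (sym (T0 (iter T l′ v))) e) (card-fix-simples Ss l 1≤l)

  HasOrder : ℕ → ℕ → Set
  HasOrder e w = 1 ≤ w × e ∣ q ^ w ∸ 1 × (∀ d → 1 ≤ d → e ∣ q ^ d ∸ 1 → w ≤ d)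

  SimpleOf : ℕ → ℕ → Set
  SimpleOf e w = (Σ (V w → V w) λ T → IsLin T × Simple e T) × HasOrder e w

  -- The order e p^t divides the period `E`, which is prime to p, so t = 0 and T^e = 1. Comparing
  -- the whole space with the q^d fixed points of T^e, the case s = 0 of `fix-card`, gives n = d.
  type⇒simple : ∀ {n e E} {T : V n → V n} → IsLin T → InvertibleType T e → (∀ v → iter T E v ≡ v) → ¬ p ∣ E → Simple e T × HasOrder e n
  type⇒simple {n} {e} {E} {T} L A T^E p∤E =
      record { 1≤e = A.1≤e ; fix-all = λ l e∣l v → iter-fix-∣ T e∣l (T^e v) ; fix-none = A.fix-none } ,
      subst (1 ≤_) (sym n≡d) A.1≤d , subst (λ d → e ∣ q ^ d ∸ 1) (sym n≡d) A.e∣q^d-1 , λ d 1≤d e∣ → subst (_≤ d) (sym n≡d) (A.minimal d 1≤d e∣)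
    where
    module A = InvertibleType A
    T^e : ∀ v → iter T e v ≡ v
    T^e v with A.t | A.order | A.order-∣ E T^E
    ... | zero  | ord | _ = subst (λ m → iter T m v ≡ v) (ℕP.*-identityʳ e) (ord v)
    ... | suc t | _   | d = contradiction (∣-trans (∣-trans (m∣m*n (p ^ t)) (n∣m*n e)) d) p∤E
    n≡d : n ≡ A.d
    n≡d = q^-inj (trans (card-unique (card-V n) (A.fix-card 0) (λ v _ → subst (λ m → iter T m v ≡ v) (sym (ℕP.*-identityʳ e)) (T^e v)) _)
      (cong (q ^_) (trans (cong (A.d *_) (ℕP.m≤n⇒m⊓n≡m A.1≤L)) (ℕP.*-identityʳ A.d))))

  zero-product : ∀ bs → Product bs
  zero-product []       = tt
  zero-product (b ∷ bs) = 0v , zero-product bs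

  periodic⇒simples : ∀ {E} → 1 ≤ E → ¬ p ∣ E → ∀ {bs} → Indecomposables bs → (∀ x → iter (step bs) E x ≡ x) →
                     ∃ λ es → Simples bs es × ListAll.All (λ ew → SimpleOf (proj₁ ew) (proj₂ ew)) es
  periodic⇒simples 1≤E p∤E [] _ = [] , [] , []
  periodic⇒simples {E} 1≤E p∤E (_∷_ {n} {T} {L} {bs} (1≤n , ind) inds) per =
        case Invertible.invertible-type L (order-inj E 1≤E T^E) ind 1≤n of λ where
          (e , A) → case type⇒simple L A T^E p∤E of λ where
            (S , ord) → case periodic⇒simples 1≤E p∤E inds rest of λ where
              (es , Ss , Gs) → (e , n) ∷ es , S ∷ Ss , ((T , L , S) , ord) ∷ Gs
    where
    T^E : ∀ v → iter T E v ≡ v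
    T^E v = cong proj₁ (trans (sym (iter-⊗ T (step bs) E (v , zero-product bs))) (per _))
    rest : ∀ x → iter (step bs) E x ≡ x
    rest x = cong proj₂ (trans (sym (iter-⊗ T (step bs) E (0v , x))) (per _))

  module Rotation (e : ℕ) (1≤e : 1 ≤ e) where
    private instance
      e≢0 : NonZero e
      e≢0 = >-nonZero 1≤e

    at : ∀ {l} {{_ : NonZero l}} → V l → ℕ → Fin q
    at {l} v m = Vec.lookup v (fromℕ< (m%n<n m l))

    at-mod : ∀ {l} {{_ : NonZero l}} (v : V l) m m′ → m % l ≡ m′ % l → at v m ≡ at v m′
    at-mod {l} v m m′ eq = cong (Vec.lookup v) (FinP.fromℕ<-cong (m % l) (m′ % l) eq (m%n<n m l) (m%n<n m′ l))

    at-tabulate : ∀ {l} {{_ : NonZero l}} (f : ℕ → Fin q) m → at {l} (Vec.tabulate (f ∘ toℕ)) m ≡ f (m % l)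
    at-tabulate {l} f m = trans (VecP.lookup∘tabulate (f ∘ toℕ) _) (cong f (FinP.toℕ-fromℕ< (m%n<n m l)))

    at-ext : ∀ {l} {{_ : NonZero l}} {u v : V l} → (∀ m → at u m ≡ at v m) → u ≡ v
    at-ext {l} {u} {v} eq = trans (sym (VecP.tabulate∘lookup u)) (trans (VecP.tabulate-cong (λ i →
        trans (sym (cong (Vec.lookup u) (index i))) (trans (eq (toℕ i)) (cong (Vec.lookup v) (index i))))) (VecP.tabulate∘lookup v))
      where
      index : ∀ i → fromℕ< (m%n<n (toℕ i) l) ≡ i
      index i = FinP.toℕ-injective (trans (FinP.toℕ-fromℕ< _) (m<n⇒m%n≡m (FinP.toℕ<n i)))

    rotate : V e → V e
    rotate v = Vec.tabulate (λ j → at v (suc (toℕ j)))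

    at-rotate : ∀ v m → at (rotate v) m ≡ at v (suc m)
    at-rotate v m = trans (at-tabulate (at v ∘ suc) m) (at-mod v _ _ (trans (%-distribˡ-+ 1 (m % e) e)
      (trans (cong (λ r → (1 % e + r) % e) (m%n%n≡m%n m e)) (sym (%-distribˡ-+ 1 m e)))))

    at-iter : ∀ k v m → at (iter rotate k v) m ≡ at v (k + m)
    at-iter zero    v m = refl
    at-iter (suc k) v m = trans (at-rotate (iter rotate k v) m) (trans (at-iter k v (suc m)) (cong (at v) (ℕP.+-suc k m)))

    rotate-lin : IsLin rotate
    rotate-lin = (λ u v → at-ext λ m → trans (at-rotate (u ⊞ v) m) (trans (VecP.lookup-zipWith _ (fromℕ< _) u v)
                   (sym (trans (VecP.lookup-zipWith _ (fromℕ< (m%n<n m e)) (rotate u) (rotate v)) (cong₂ (FiniteField._+F_ F) (at-rotate u m) (at-rotate v m))))))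
               , (λ c v → at-ext λ m → trans (at-rotate (c ∙ v) m) (trans (VecP.lookup-map (fromℕ< _) _ v)
                   (sym (trans (VecP.lookup-map (fromℕ< (m%n<n m e)) _ (rotate v)) (cong (FiniteField._*F_ F c) (at-rotate v m))))))

    rotate^e : ∀ v → iter rotate e v ≡ v
    rotate^e v = at-ext λ m → trans (at-iter e v m) (at-mod v (e + m) m
      (trans (cong (_% e) (trans (ℕP.+-comm e m) (cong (m +_) (sym (ℕP.*-identityˡ e))))) ([m+kn]%n≡m%n m 1 e)))

    -- Vectors are read as e-periodic sequences. Those fixed by the l-th rotation are l-periodic and
    -- are given freely by their first l entries.
    card-fix-rotate : ∀ l → 1 ≤ l → l ∣ e → Card (λ v → iter rotate l v ≡ v) (q ^ l)
    card-fix-rotate l 1≤l l∣e = card-bij (card-V l) unfold fold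
        (λ u _ → at-ext λ m → trans (at-iter l (unfold u) m) (trans (at-unfold u (l + m)) (trans (shift-l u m) (sym (at-unfold u m)))))
        _ (λ v fix → at-ext λ m → trans (at-unfold (fold v) m) (trans (at-fold v m) (sym (reduce v fix m))))
        (λ u u′ _ _ eq → at-ext λ m → trans (sym (at-unfold u m)) (trans (cong (λ w → at w m) eq) (at-unfold u′ m)))
      where
      instance l≢0 = >-nonZero 1≤l
      unfold : V l → V e
      unfold u = Vec.tabulate (λ j → at u (toℕ j))
      fold : V e → V l
      fold v = Vec.tabulate (λ j → at v (toℕ j))
      at-unfold : ∀ u m → at (unfold u) m ≡ at u m
      at-unfold u m = trans (at-tabulate (at u) m) (at-mod u (m % e) m (m∣n⇒o%n%m≡o%m l e m l∣e))
      at-fold : ∀ v m → at (fold v) m ≡ at v (m % l)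
      at-fold v m = at-tabulate (at v) m
      shift-l : ∀ u m → at u (l + m) ≡ at u m
      shift-l u m = at-mod u (l + m) m (trans (cong (_% l) (trans (ℕP.+-comm l m) (cong (m +_) (sym (ℕP.*-identityˡ l))))) ([m+kn]%n≡m%n m 1 l))
      reduce : ∀ v → iter rotate l v ≡ v → ∀ m → at v m ≡ at v (m % l)
      reduce v fix m = trans (cong (at v) (trans (m≡m%n+[m/n]*n m l) (ℕP.+-comm (m % l) _))) (drop (m / l))
        where
        drop : ∀ c → at v (c * l + m % l) ≡ at v (m % l)
        drop zero    = refl
        drop (suc c) = trans (cong (at v) (ℕP.+-assoc l (c * l) _)) (trans (sym (at-iter l v _)) (trans (cong (λ w → at w (c * l + m % l)) fix) (drop c)))

    -- For l dividing e, the l-th rotation fixes q^l vectors, so the block dimensions have divisor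
    -- sum l at l, as the list of orders in ℤ/e does. Inversion at l = e gives positive weight
    -- there, because 1 has order e in ℤ/e; some block therefore has order e.
    simple-exists : ¬ p ∣ e → ∃ (SimpleOf e)
    simple-exists p∤e = case decompose e (<-wellFounded e) rotate-lin of λ where
          (bs , inds , _ , iso) → case periodic⇒simples 1≤e p∤e inds (λ x → period iso x) of λ where
            (es , Ss , Gs) → find es Gs (subst (1 ≤_) (sym (weights-unique e es (orders e)
               (λ l 1≤l l∣e → trans (q^-inj (card-unique (card-fix-simples Ss l 1≤l) (≃-card-fix (≃-iter iso l) (card-fix-rotate l 1≤l l∣e)) (λ _ → id) (λ _ → id)))
                                (sym (divisor-sum-orders l 1≤l l∣e)))
               e (<-wellFounded e) 1≤e ∣-refl)) weight-orders)
      where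
      open AdditiveOrders e 1≤e
      period : ∀ {bs} → rotate ≃ step bs → ∀ x → iter (step bs) e x ≡ x
      period iso x = trans (cong (iter (step _) e) (sym (I.to-from x tt))) (trans (sym (J.comm (I.from x) tt))
                       (trans (cong I.to (rotate^e (I.from x))) (I.to-from x tt)))
        where
        module I = Conjugate iso
        module J = Conjugate (≃-iter iso e)
      find : ∀ es → ListAll.All (λ ew → SimpleOf (proj₁ ew) (proj₂ ew)) es → 1 ≤ weight-at e es → ∃ (SimpleOf e)
      find ((e′ , w) ∷ es) (G ∷ Gs) pos with e′ ℕ.≟ e
      ... | yes refl = w , G
      ... | no _     = find es Gs pos

-- The lower bound.

take-++ : ∀ {A : Set} {m n} (u : Vec A m) (v : Vec A n) → Vec.take m (u Vec.++ v) ≡ u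
take-++ []      v = refl
take-++ (x ∷ u) v = cong (x ∷_) (take-++ u v)

drop-++ : ∀ {A : Set} {m n} (u : Vec A m) (v : Vec A n) → Vec.drop m (u Vec.++ v) ≡ v
drop-++ []      v = refl
drop-++ (x ∷ u) v = drop-++ u v

≡1-mod⇒∣ : ∀ m e .{{_ : NonZero e}} → 1 ≤ m → m % e ≡ 1 % e → e ∣ m ∸ 1
≡1-mod⇒∣ m e 1≤m eq = divides (m / e ∸ 1 / e) (begin
  m ∸ 1                                                ≡⟨ cong₂ _∸_ (m≡m%n+[m/n]*n m e) (m≡m%n+[m/n]*n 1 e) ⟩
  (m % e + m / e * e) ∸ (1 % e + 1 / e * e)            ≡⟨ cong (λ r → (r + m / e * e) ∸ (1 % e + 1 / e * e)) eq ⟩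
  (1 % e + m / e * e) ∸ (1 % e + 1 / e * e)            ≡⟨ ℕP.[m+n]∸[m+o]≡n∸o (1 % e) _ _ ⟩
  m / e * e ∸ 1 / e * e                                ≡⟨ sym (ℕP.*-distribʳ-∸ e (m / e) (1 / e)) ⟩
  (m / e ∸ 1 / e) * e                                  ∎)
  where open ≡-Reasoning

∣⇒≡1-mod : ∀ m e .{{_ : NonZero e}} → 1 ≤ m → e ∣ m ∸ 1 → m % e ≡ 1 % e
∣⇒≡1-mod m e 1≤m (divides c eq) = trans (cong (_% e) (trans (sym (ℕP.m+[n∸m]≡n 1≤m)) (cong (1 +_) eq))) ([m+kn]%n≡m%n 1 c e)

OrdIs-unique : ∀ {q e i j} → OrdIs q e i → OrdIs q e j → i ≡ j
OrdIs-unique {i = i} {j} (1≤i , ci , mi) (1≤j , cj , mj) with <-cmp i j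
... | tri< i<j _ _ = contradiction ci (ListAll.lookup mj (∈-upTo⁺ i<j) 1≤i)
... | tri≈ _ e _   = e
... | tri> _ _ j<i = contradiction cj (ListAll.lookup mi (∈-upTo⁺ j<i) 1≤j)

Indices : Set
Indices = List (ℕ × ℕ)

dimensions : Indices → List ℕ → ℕ
dimensions ((e , i) ∷ idx) (m ∷ ms) = m * i + dimensions idx ms
dimensions _               _        = 0

-- The exponent is raised by one because `OrdIs q e i` speaks about the modulus e + 1.
spec : Indices → List ℕ → List (ℕ × ℕ)
spec ((e , i) ∷ idx) (m ∷ ms) = List.replicate m (suc e , i) ++ spec idx ms
spec _               _        = []

weight-at-replicate : ∀ l m e i es → weight-at l (List.replicate m (e , i) ++ es) ≡ when (e ℕ.≟ l) (m * i) + weight-at l es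
weight-at-replicate l zero    e i es = cong (_+ weight-at l es) (sym (when-0 (e ℕ.≟ l)))
weight-at-replicate l (suc m) e i es = trans (cong (when (e ℕ.≟ l) i +_) (weight-at-replicate l m e i es))
  (trans (sym (ℕP.+-assoc (when (e ℕ.≟ l) i) _ _)) (cong (_+ weight-at l es) (sym (when-+ (e ℕ.≟ l) i (m * i)))))

weight-at-other : ∀ {e} idx ms → ListAll.All (λ a → e ≢ proj₁ a) idx → weight-at (suc e) (spec idx ms) ≡ 0
weight-at-other []              ms       _          = refl
weight-at-other (_ ∷ _)         []       _          = refl
weight-at-other {e} ((e′ , i) ∷ idx) (m ∷ ms) (e≢ ∷ es) = trans (weight-at-replicate (suc e) m (suc e′) i (spec idx ms))
  (cong₂ _+_ (when-no (suc e′ ℕ.≟ suc e) (λ eq → e≢ (sym (ℕP.suc-injective eq))) (m * i)) (weight-at-other idx ms es))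

-- The exponents in `idx` are distinct, so the weight at e + 1 is exactly m i, which determines m
-- because i is positive.
spec-injective : ∀ idx ms ms′ → AllPairs (λ a b → proj₁ a ≢ proj₁ b) idx → ListAll.All (λ a → 1 ≤ proj₂ a) idx →
                 List.length ms ≡ List.length idx → List.length ms′ ≡ List.length idx →
                 (∀ l → 1 ≤ l → weight-at l (spec idx ms) ≡ weight-at l (spec idx ms′)) → ms ≡ ms′
spec-injective []              []       []         _        _            _ _ _ = refl
spec-injective ((e , i) ∷ idx) (m ∷ ms) (m′ ∷ ms′) (e∉ ∷ d) (1≤i ∷ pos) p p′ same =
  cong₂ _∷_ m≡m′ (spec-injective idx ms ms′ d pos (ℕP.suc-injective p) (ℕP.suc-injective p′) λ l 1≤l →
    ℕP.+-cancelˡ-≡ (when (suc e ℕ.≟ l) (m * i)) _ _ (trans (sym (weight-at-replicate l m (suc e) i (spec idx ms))) (trans (same l 1≤l)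
      (trans (weight-at-replicate l m′ (suc e) i (spec idx ms′)) (cong (λ m → when (suc e ℕ.≟ l) (m * i) + weight-at l (spec idx ms′)) (sym m≡m′))))))
  where
  at-e : ∀ m ms → weight-at (suc e) (List.replicate m (suc e , i) ++ spec idx ms) ≡ m * i
  at-e m ms = trans (weight-at-replicate (suc e) m (suc e) i (spec idx ms))
    (trans (cong₂ _+_ (when-yes (suc e ℕ.≟ suc e) refl (m * i)) (weight-at-other idx ms e∉)) (ℕP.+-identityʳ _))
  m≡m′ : m ≡ m′
  m≡m′ = ℕP.*-cancelʳ-≡ m m′ i {{>-nonZero 1≤i}} (trans (sym (at-e m ms)) (trans (same (suc e) (s≤s z≤n)) (at-e m′ ms′)))

flat : ∀ {n} → Vec (List ℕ) n → List ℕ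
flat []       = []
flat (xs ∷ M) = xs ++ flat M

++-injective-length : ∀ {A : Set} (xs ys : List A) {us vs} → List.length xs ≡ List.length ys → xs ++ us ≡ ys ++ vs → xs ≡ ys × us ≡ vs
++-injective-length []       []       _ e = refl , e
++-injective-length (x ∷ xs) (y ∷ ys) p e with ListP.∷-injective e
... | refl , e′ with ++-injective-length xs ys (ℕP.suc-injective p) e′
... | refl , e″ = refl , e″

flat-injective : ∀ {n} (M M′ : Vec (List ℕ) n) → (∀ k → List.length (Vec.lookup M k) ≡ List.length (Vec.lookup M′ k)) → flat M ≡ flat M′ → M ≡ M′
flat-injective []       []         _ _ = refl
flat-injective (xs ∷ M) (ys ∷ M′) p e with ++-injective-length xs ys (p zero) e
... | refl , e′ = cong (xs ∷_) (flat-injective M M′ (p ∘ suc) e′)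

module Exponents (q : ℕ) where

  exponents : ℕ → List ℕ
  exponents i = List.filter (OrdIs? q i) (List.upTo (q ^ i))

  indices : ∀ n → (Fin n → ℕ) → Indices
  indices zero    g = []
  indices (suc n) g = List.map (_, g zero) (exponents (g zero)) ++ indices n (g ∘ suc)

  Ord : ℕ × ℕ → Set
  Ord (e , i) = OrdIs q e i

  indices-Ord : ∀ n g → ListAll.All Ord (indices n g)
  indices-Ord zero    g = []
  indices-Ord (suc n) g = ListAllP.++⁺ (ListAllP.map⁺ (ListAllP.all-filter (OrdIs? q (g zero)) (List.upTo (q ^ g zero)))) (indices-Ord n (g ∘ suc))

  indices-range : ∀ n g → ListAll.All (λ a → ∃ λ k → proj₂ a ≡ g k) (indices n g)
  indices-range zero    g = []
  indices-range (suc n) g = ListAllP.++⁺ (ListAllP.map⁺ (ListAll.universal (λ _ → zero , refl) (exponents (g zero))))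
    (ListAll.map (λ { (k , e) → suc k , e }) (indices-range n (g ∘ suc)))

  -- An exponent determines the order of q modulo it, so the lists belonging to different orders are
  -- disjoint.
  indices-distinct : ∀ n g → Injective g → AllPairs (λ a b → proj₁ a ≢ proj₁ b) (indices n g)
  indices-distinct zero    g inj = []
  indices-distinct (suc n) g inj = AllPairsP.++⁺ (AllPairsP.map⁺ (UniqueP.filter⁺ (OrdIs? q (g zero)) (UniqueP.upTo⁺ (q ^ g zero))))
    (indices-distinct n (g ∘ suc) (FinP.suc-injective ∘ inj))
    (ListAllP.map⁺ (ListAll.map (λ o → ListAll.zipWith (λ { {_ , i} (o′ , k , refl) refl → case inj (OrdIs-unique o o′) of λ () })
      (indices-Ord n (g ∘ suc) , indices-range n (g ∘ suc))) (ListAllP.all-filter (OrdIs? q (g zero)) (List.upTo (q ^ g zero)))))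

  length-flat : ∀ n g (M : Vec (List ℕ) n) → (∀ k → List.length (Vec.lookup M k) ≡ List.length (exponents (g k))) →
                List.length (flat M) ≡ List.length (indices n g)
  length-flat zero    g []       _ = refl
  length-flat (suc n) g (xs ∷ M) p = trans (ListP.length-++ xs) (trans (cong₂ _+_
    (trans (p zero) (sym (ListP.length-map (_, g zero) (exponents (g zero))))) (length-flat n (g ∘ suc) M (p ∘ suc)))
    (sym (ListP.length-++ (List.map (_, g zero) (exponents (g zero))))))

  dimensions-flat : ∀ n g (M : Vec (List ℕ) n) → (∀ k → List.length (Vec.lookup M k) ≡ List.length (exponents (g k))) →
                    dimensions (indices n g) (flat M) ≡ sum (List.tabulate λ k → Vec.lookup (sums M) k * g k)
  dimensions-flat zero    g []       _ = refl
  dimensions-flat (suc n) g (xs ∷ M) p = trans (prefix (exponents (g zero)) xs (p zero)) (cong (sum xs * g zero +_) (dimensions-flat n (g ∘ suc) M (p ∘ suc)))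
    where
    prefix : ∀ es xs → List.length xs ≡ List.length es →
             dimensions (List.map (_, g zero) es ++ indices n (g ∘ suc)) (xs ++ flat M) ≡ sum xs * g zero + dimensions (indices n (g ∘ suc)) (flat M)
    prefix []       []       _ = refl
    prefix (e ∷ es) (x ∷ xs) p = trans (cong (x * g zero +_) (prefix es xs (ℕP.suc-injective p)))
      (trans (sym (ℕP.+-assoc (x * g zero) _ _)) (cong (_+ dimensions (indices n (g ∘ suc)) (flat M)) (sym (ℕP.*-distribʳ-+ (g zero) x (sum xs)))))

module LowerBound {q : ℕ} (F : FiniteField q) {p k : ℕ} (pr : Prime p) (1≤k : 1 ≤ k) (q≡p^k : q ≡ p ^ k) where
  open LinAlg F
  open Decomposition F
  open PrimeFacts pr
  open InvertibleTypes F {p} {k} pr q≡p^k using (1≤q^)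
  open SimpleBlocks F {p} {k} pr q≡p^k
  open Exponents q

  fg⇒≃ : ∀ {n} {T S : V n → V n} → FGIso F T S → T ≃ S
  fg⇒≃ (φ , edges) = mk≃ (Inverse.to φ) (Inverse.from φ) (Inverse.strictlyInverseʳ φ) (Inverse.strictlyInverseˡ φ)
    λ v → sym (Equivalence.to (edges v _) refl)

  ≃⇒fg : ∀ {n} {T S : V n → V n} → T ≃ S → FGIso F T S
  ≃⇒fg {T = T} {S} c = mk↔ₛ′ C.to C.from (λ y → C.to-from y tt) (λ x → C.from-to x tt) ,
    λ u v → mk⇔ (λ e → trans (sym (C.comm u tt)) (cong C.to e)) (λ e → ≃-to-inj c (trans (C.comm u tt) e))
    where module C = Conjugate c

  realize : ∀ bs → Σ (V (total-dim bs) → V (total-dim bs)) λ T → IsLin T × T ≃ step bs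
  realize [] = id , ((λ _ _ → refl) , (λ _ _ → refl)) , mk≃ _ (λ _ → []) (λ { [] → refl }) (λ _ → refl) (λ _ → refl)
  realize ((a , T , L) ∷ bs) with realize bs
  ... | S , LS , iso = R , ((λ u v → trans (cong₂ Vec._++_ (trans (cong T (VecP.take-zipWith _ u v)) (proj₁ L _ _)) (trans (cong S (VecP.drop-zipWith _ u v)) (proj₁ LS _ _)))
                             (sym (VecP.zipWith-++ _ (T (Vec.take a u)) (S (Vec.drop a u)) (T (Vec.take a v)) (S (Vec.drop a v)))))
                         , (λ c v → trans (cong₂ Vec._++_ (trans (cong T (VecP.take-map _ a v)) (proj₂ L c _)) (trans (cong S (VecP.drop-map _ a v)) (proj₂ LS c _)))
                             (sym (VecP.map-++ _ (T (Vec.take a v)) (S (Vec.drop a v)))))) ,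
      ≃-trans (mk≃ (λ v → Vec.take a v , Vec.drop a v) (uncurry Vec._++_) (VecP.take++drop≡id a)
        (λ { (u , w) → cong₂ _,_ (take-++ u w) (drop-++ u w) })
        (λ v → cong₂ _,_ (take-++ (T (Vec.take a v)) _) (drop-++ (T (Vec.take a v)) _)))
      (≃-⊗ ≃-refl iso)
    where
    R : V (a + total-dim bs) → V (a + total-dim bs)
    R v = T (Vec.take a v) Vec.++ S (Vec.drop a v)

  OrdIs⇒HasOrder : ∀ {e i w} → OrdIs q e i → HasOrder (suc e) w → w ≡ i
  OrdIs⇒HasOrder {e} {i} {w} (1≤i , c , m) (1≤w , e∣ , min) = ℕP.≤-antisym (min i 1≤i (≡1-mod⇒∣ (q ^ i) (suc e) (1≤q^ i) c))
    (ℕP.≮⇒≥ λ w<i → ListAll.lookup m (∈-upTo⁺ w<i) 1≤w (∣⇒≡1-mod (q ^ w) (suc e) (1≤q^ w) e∣))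

  -- The modulus e + 1 divides q^i - 1. A prime p dividing it, and dividing q^i too, would divide 1.
  OrdIs⇒p∤ : ∀ {e i} → OrdIs q e i → ¬ p ∣ suc e
  OrdIs⇒p∤ {e} {suc i} (_ , c , _) p∣e = ℕP.<⇒≱ 2≤p (∣⇒≤ (∣m+n∣m⇒∣n
      (subst (p ∣_) (sym (trans (ℕP.+-comm _ 1) (ℕP.m+[n∸m]≡n (1≤q^ (suc i))))) p∣q^)
      (∣-trans p∣e (≡1-mod⇒∣ (q ^ suc i) (suc e) (1≤q^ (suc i)) c))))
    where
    p∣q : p ∣ q
    p∣q = subst (p ∣_) (trans (cong (p ^_) (ℕP.m+[n∸m]≡n 1≤k)) (sym q≡p^k)) (m∣m*n (p ^ (k ∸ 1)))
    p∣q^ : p ∣ q ^ suc i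
    p∣q^ = ∣-trans p∣q (m∣m*n (q ^ i))

  abstract
    simple-of-order : ∀ {e i} → OrdIs q e i → Σ (V i → V i) λ T → IsLin T × Simple (suc e) T
    simple-of-order {e} {i} o = resize (Rotation.simple-exists (suc e) (s≤s z≤n) (OrdIs⇒p∤ o))
      where
      resize : ∃ (SimpleOf (suc e)) → Σ (V i → V i) λ T → IsLin T × Simple (suc e) T
      resize (w , T , ord) = subst (λ w → Σ (V w → V w) λ T → IsLin T × Simple (suc e) T) (OrdIs⇒HasOrder o ord) T

  blocks : ∀ {idx} → ListAll.All Ord idx → List ℕ → List Block
  blocks {(e , i) ∷ _} (o ∷ os) (m ∷ ms) = List.replicate m (i , proj₁ (simple-of-order o) , proj₁ (proj₂ (simple-of-order o))) ++ blocks os ms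
  blocks               _        _        = []

  blocks-simple : ∀ {idx} (os : ListAll.All Ord idx) ms → Simples (blocks os ms) (spec idx ms)
  blocks-simple []       ms       = []
  blocks-simple (o ∷ os) []       = []
  blocks-simple {(e , i) ∷ idx} (o ∷ os) (m ∷ ms) = replicated m
    where
    replicated : ∀ m → Simples (List.replicate m _ ++ blocks os ms) (List.replicate m (suc e , i) ++ spec idx ms)
    replicated zero    = blocks-simple os ms
    replicated (suc m) = proj₂ (proj₂ (simple-of-order o)) ∷ replicated m

  blocks-dim : ∀ {idx} (os : ListAll.All Ord idx) ms → total-dim (blocks os ms) ≡ dimensions idx ms
  blocks-dim []       ms       = refl
  blocks-dim (o ∷ os) []       = refl
  blocks-dim {(e , i) ∷ idx} (o ∷ os) (m ∷ ms) = replicated m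
    where
    replicated : ∀ m → total-dim (List.replicate m _ ++ blocks os ms) ≡ m * i + dimensions idx ms
    replicated zero    = blocks-dim os ms
    replicated (suc m) = trans (cong (i +_) (replicated m)) (sym (ℕP.+-assoc i (m * i) _))

  module _ (n : ℕ) where

    idx : Indices
    idx = indices n (suc ∘ toℕ)

    idx-Ord : ListAll.All Ord idx
    idx-Ord = indices-Ord n (suc ∘ toℕ)

    -- The simple blocks prescribed by M, padded with a zero map.
    system : ∀ M → Family (σ* q) n M × InP n (sums M) →
             Σ (LinearMap F n) λ T → ∃ λ bs → Simples bs (spec idx (flat M)) × (proj₁ T ≃ step bs)
    system M (fam , inP) = subst (λ n → Σ (LinearMap F n) λ T → ∃ λ bs → Simples bs (spec idx (flat M)) × (proj₁ T ≃ step bs)) total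
        ((T , L) , bs , zero (λ _ → refl) (blocks-simple idx-Ord (flat M)) , iso)
      where
      -- The prescribed blocks need not fill dimension n; a zero map takes up the rest without
      -- changing the fixed-point counts.
      r = n ∸ weight (sums M)
      bs = (r , (λ _ → 0v) , (λ _ _ → sym (⊞-identityˡ 0v)) , λ c _ → sym (∙0 c)) ∷ blocks idx-Ord (flat M)
      T = proj₁ (realize bs)
      L = proj₁ (proj₂ (realize bs))
      iso = proj₂ (proj₂ (realize bs))
      total : total-dim bs ≡ n
      total = trans (cong (r +_) (trans (blocks-dim idx-Ord (flat M)) (trans (dimensions-flat n (suc ∘ toℕ) M fam) (sym (weight-tabulate (sums M))))))
        (ℕP.m∸n+n≡m (proj₂ inP))

    -- Isomorphic graphs have equal fixed-point counts for all powers, hence equal divisor sums,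
    -- hence equal weights, and these give back every multiplicity.
    system-injective : ∀ {M M′ bs bs′} → Family (σ* q) n M → Family (σ* q) n M′ →
      Simples bs (spec idx (flat M)) → Simples bs′ (spec idx (flat M′)) → step bs ≃ step bs′ → M ≡ M′
    system-injective {M} {M′} fam fam′ S S′ iso = flat-injective M M′ (λ k → trans (fam k) (sym (fam′ k)))
      (spec-injective idx (flat M) (flat M′) (indices-distinct n (suc ∘ toℕ) (FinP.toℕ-injective ∘ ℕP.suc-injective))
        (ListAll.map (λ { (k , refl) → s≤s z≤n }) (indices-range n (suc ∘ toℕ)))
        (length-flat n (suc ∘ toℕ) M fam) (length-flat n (suc ∘ toℕ) M′ fam′)
        λ l 1≤l → weights-unique 0 (spec idx (flat M)) (spec idx (flat M′)) (λ l 1≤l _ →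
            q^-inj (card-unique (≃-card-fix (≃-iter iso l) (card-fix-simples S l 1≤l)) (card-fix-simples S′ l 1≤l) (λ _ → id) (λ _ → id)))
          l (<-wellFounded l) 1≤l (l ∣0))

    lower-bound : ∀ A → NumFGClasses F n A → sumP (σ* q) n ≤ A
    lower-bound A (rep , distinct , complete) = FinP.injective⇒≤ {f = class} λ {i} {j} → class-inj i j
      where
      module C = Card (card-families (σ* q) n)
      sys = λ i → system (C.elem i) (C.elem-∈ i)
      class : Fin (sumP (σ* q) n) → Fin A
      class i = proj₁ (complete (proj₁ (sys i)))
      class-iso : ∀ i → proj₁ (proj₁ (sys i)) ≃ proj₁ (rep (class i))
      class-iso i = fg⇒≃ (proj₂ (complete (proj₁ (sys i))))
      class-inj : ∀ i j → class i ≡ class j → i ≡ j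
      class-inj i j e = C.elem-inj (system-injective (proj₁ (C.elem-∈ i)) (proj₁ (C.elem-∈ j))
        (proj₁ (proj₂ (proj₂ (sys i)))) (proj₁ (proj₂ (proj₂ (sys j))))
        (≃-trans (≃-sym (proj₂ (proj₂ (proj₂ (sys i))))) (≃-trans (class-iso i)
          (≃-trans (subst (λ c → proj₁ (rep (class i)) ≃ proj₁ (rep c)) e ≃-refl) (≃-trans (≃-sym (class-iso j)) (proj₂ (proj₂ (proj₂ (sys j)))))))))

-- The bound on partition numbers.

sub : (ℕ → ℕ) → ℕ → ℕ → ℕ
sub f m t = when (t ℕ.≤? m) (f (m ∸ t))

sub-≤ : ∀ f {m t} → t ≤ m → sub f m t ≡ f (m ∸ t)
sub-≤ f {m} {t} t≤m = when-yes (t ℕ.≤? m) t≤m _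

sub-> : ∀ f {m t} → m < t → sub f m t ≡ 0
sub-> f {m} {t} m<t = when-no (t ℕ.≤? m) (ℕP.<⇒≱ m<t) _

sub-shift : ∀ f {m a} t → a ≤ m → sub f m (a + t) ≡ sub f (m ∸ a) t
sub-shift f {m} {a} t a≤m with t ℕ.≤? m ∸ a
... | yes t≤ = trans (sub-≤ f (subst (a + t ≤_) (ℕP.m+[n∸m]≡n a≤m) (ℕP.+-monoʳ-≤ a t≤))) (cong f (sym (ℕP.∸-+-assoc m a t)))
... | no t≰  = sub-> f (subst (_< a + t) (ℕP.m+[n∸m]≡n a≤m) (ℕP.+-monoʳ-< a (ℕP.≰⇒> t≰)))

sumTo-first : ∀ f n → sumTo f (suc n) ≡ f 0 + sumTo (f ∘ suc) n
sumTo-first f zero    = refl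
sumTo-first f (suc n) = trans (cong (f (suc n) +_) (sumTo-first f n)) (+-swap (f (suc n)) (f 0) _)
  where
  +-swap : ∀ a b c → a + (b + c) ≡ b + (a + c)
  +-swap = solve 3 (λ a b c → a :+ (b :+ c) := b :+ (a :+ c)) refl
    where open +-*-Solver

sumTo-mono : ∀ {f g} n → (∀ j → f j ≤ g j) → sumTo f n ≤ sumTo g n
sumTo-mono zero    h = z≤n
sumTo-mono (suc n) h = ℕP.+-mono-≤ (h n) (sumTo-mono n h)

sumTo-* : ∀ f n c → sumTo f n * c ≡ sumTo (λ j → f j * c) n
sumTo-* f zero    c = refl
sumTo-* f (suc n) c = trans (ℕP.*-distribʳ-+ c (f n) _) (cong (f n * c +_) (sumTo-* f n c))

sumTo-swap : ∀ (f : ℕ → ℕ → ℕ) m n → sumTo (λ i → sumTo (f i) n) m ≡ sumTo (λ j → sumTo (λ i → f i j) m) n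
sumTo-swap f zero    n = sym (sumTo-0 n λ _ _ → refl)
sumTo-swap f (suc m) n = trans (cong (sumTo (f m) n +_) (sumTo-swap f m n)) (sym (sumTo-+ (f m) _ n))

-- The head of a vector of length k is the multiplicity of the part k.
partition-size : ∀ {k} → Vec ℕ k → ℕ
partition-size []              = 0
partition-size {suc k} (x ∷ μ) = x * suc k + partition-size μ

module _ {k m : ℕ} where

  private
    Zero : Vec ℕ (suc k) → Set
    Zero (zero ∷ μ)  = partition-size μ ≡ m
    Zero (suc _ ∷ _) = ⊥

    Positive : Vec ℕ (suc k) → Set
    Positive (zero ∷ μ)  = ⊥
    Positive (suc x ∷ μ) = suc k + (x * suc k + partition-size μ) ≡ m

  card-partitions-step : ∀ {a b} → Card (λ (μ : Vec ℕ k) → partition-size μ ≡ m) a →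
    (suc k ≤ m → Card (λ (μ : Vec ℕ (suc k)) → partition-size μ ≡ m ∸ suc k) b) →
    Card (λ (μ : Vec ℕ (suc k)) → partition-size μ ≡ m) (a + when (suc k ℕ.≤? m) b)
  card-partitions-step {a} {b} A B = card-⇔ (card-⊎ zeros (positives (suc k ℕ.≤? m)) λ { (zero ∷ μ) _ () ; (suc x ∷ μ) () _ }) join split
    where
    zeros : Card Zero a
    zeros = card-bij A (0 ∷_) Vec.tail (λ _ e → e) (λ { (zero ∷ μ) e → e }) (λ { (zero ∷ μ) _ → refl }) (λ { _ _ _ _ refl → refl })
    positives : (d : Dec (suc k ≤ m)) → Card Positive (when d b)
    positives (no k≰m)  = card-empty λ { (suc x ∷ μ) e → k≰m (subst (suc k ≤_) e (ℕP.m≤m+n (suc k) _)) }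
    positives (yes k≤m) = card-bij (B k≤m) (λ { (x ∷ μ) → suc x ∷ μ }) (λ { (x ∷ μ) → ℕ.pred x ∷ μ })
      (λ { (x ∷ μ) e → trans (cong (suc k +_) e) (ℕP.m+[n∸m]≡n k≤m) })
      (λ { (suc x ∷ μ) e → trans (sym (ℕP.m+n∸m≡n (suc k) _)) (cong (_∸ suc k) e) })
      (λ { (suc x ∷ μ) _ → refl }) (λ { (_ ∷ _) (_ ∷ _) _ _ refl → refl })
    join : ∀ μ → Zero μ ⊎ Positive μ → partition-size μ ≡ m
    join (zero ∷ μ)  (inj₁ e) = e
    join (suc x ∷ μ) (inj₂ e) = trans (ℕP.+-assoc (suc k) (x * suc k) _) e
    split : ∀ μ → partition-size μ ≡ m → Zero μ ⊎ Positive μ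
    split (zero ∷ μ)  e = inj₁ e
    split (suc x ∷ μ) e = inj₂ (trans (sym (ℕP.+-assoc (suc k) (x * suc k) _)) e)

count-partitions : ∀ k m → Acc _<_ m → ∃ (Card λ (μ : Vec ℕ k) → partition-size μ ≡ m)
count-partitions zero    zero    _ = 1 , card-single [] refl λ { [] _ → refl }
count-partitions zero    (suc m) _ = 0 , card-empty λ { [] () }
count-partitions (suc k) m (acc rs) with suc k ℕ.≤? m
... | yes k≤m = _ , card-partitions-step (proj₂ (count-partitions k m (acc rs)))
      (λ _ → proj₂ (count-partitions (suc k) (m ∸ suc k) (rs (ℕP.∸-monoʳ-< (s≤s z≤n) k≤m))))
... | no k≰m  = _ , card-partitions-step {b = 0} (proj₂ (count-partitions k m (acc rs))) (λ k≤m → contradiction k≤m k≰m)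

abstract

  -- The number of partitions of m into parts of size at most k.
  p# : ℕ → ℕ → ℕ
  p# k m = proj₁ (count-partitions k m (<-wellFounded m))

  card-p# : ∀ k m → Card (λ (μ : Vec ℕ k) → partition-size μ ≡ m) (p# k m)
  card-p# k m = proj₂ (count-partitions k m (<-wellFounded m))

  -- The start of the induction: p(i) (14/10)^(24-i) for i ≤ 15, whose maximum, about 4791, occurs
  -- at i = 8. For such i, parts up to 15 are all parts.
  p#-table : (i : Fin 16) → p# 15 (toℕ i) * 14 ^ (24 ∸ toℕ i) ≤ 4900 * 10 ^ (24 ∸ toℕ i)
  p#-table = from-yes (FinP.all? {n = 16} λ i → p# 15 (toℕ i) * 14 ^ (24 ∸ toℕ i) ℕ.≤? 4900 * 10 ^ (24 ∸ toℕ i))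

  -- The cases ⌊√n⌋ = 3, 2, 1, in which the bound is 16³, 16² and 16.
  p#-small : (i : Fin 16) → 2 * p# 15 (toℕ i) ≤ 4096 × (toℕ i ≤ 8 → 2 * p# 15 (toℕ i) ≤ 256) × (toℕ i ≤ 3 → 2 * p# 15 (toℕ i) ≤ 16)
  p#-small = from-yes (FinP.all? {n = 16} λ i → (2 * p# 15 (toℕ i) ℕ.≤? 4096) ×-dec
    ((toℕ i ℕ.≤? 8) →-dec (2 * p# 15 (toℕ i) ℕ.≤? 256)) ×-dec ((toℕ i ℕ.≤? 3) →-dec (2 * p# 15 (toℕ i) ℕ.≤? 16)))

p#-zero : ∀ m → p# 0 (suc m) ≡ 0
p#-zero m = card-unique (card-p# 0 (suc m)) (card-empty {P = λ _ → ⊥} λ _ ()) (λ { [] () }) λ _ ()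

p#-suc : ∀ k m → p# (suc k) m ≡ p# k m + sub (p# (suc k)) m (suc k)
p#-suc k m = card-unique (card-p# (suc k) m) (card-partitions-step (card-p# k m) (λ _ → card-p# (suc k) (m ∸ suc k))) (λ _ → id) (λ _ → id)

p#-stable : ∀ {k m} → m ≤ k → p# (suc k) m ≡ p# k m
p#-stable {k} {m} m≤k = trans (p#-suc k m) (trans (cong (p# k m +_) (sub-> (p# (suc k)) (s≤s m≤k))) (ℕP.+-identityʳ _))

p#-≤ : ∀ k {l m} → m ≤ l → p# k m ≤ p# l m
p#-≤ k {l} {m} m≤l with ℕP.≤-total k l
... | inj₁ k≤l = subst (λ j → p# k m ≤ p# j m) (ℕP.m∸n+n≡m k≤l) (up (l ∸ k))
  where
  up : ∀ d → p# k m ≤ p# (d + k) m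
  up zero    = ≤-refl
  up (suc d) = ≤-trans (up d) (≤-trans (ℕP.m≤m+n _ _) (ℕP.≤-reflexive (sym (p#-suc (d + k) m))))
... | inj₂ l≤k = subst (λ j → p# j m ≤ p# l m) (ℕP.m∸n+n≡m l≤k) (ℕP.≤-reflexive (down (k ∸ l)))
  where
  down : ∀ d → p# (d + l) m ≡ p# l m
  down zero    = refl
  down (suc d) = trans (p#-stable (≤-trans m≤l (ℕP.m≤n+m l d))) (down d)

-- Erdős: m p(m) = Σ_{v, j ≥ 1} v p(m - v j).
erdős : ∀ k m → Acc _<_ m → ∀ N → m ≤ N →
        m * p# k m ≤ sumTo (λ v → suc v * sumTo (λ j → sub (p# k) m (suc v * suc j)) N) k
erdős zero    zero    _ N _ = z≤n
erdős zero    (suc m) _ N _ = ℕP.≤-reflexive (trans (cong (suc m *_) (p#-zero m)) (ℕP.*-zeroʳ (suc m)))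
erdős (suc k) m (acc rs) N m≤N with suc k ℕ.≤? m
... | no k≰m = begin
    m * p# (suc k) m                              ≡⟨ cong (m *_) (p#-stable m≤k) ⟩
    m * p# k m                                    ≤⟨ erdős k m (acc rs) N m≤N ⟩
    sumTo (λ v → suc v * sumTo (λ j → sub (p# k) m (suc v * suc j)) N) k
      ≡⟨ sumTo-cong k (λ v _ → cong (suc v *_) (sumTo-cong N λ j _ → same (suc v * suc j))) ⟩
    sumTo (λ v → suc v * sumTo (λ j → sub (p# (suc k)) m (suc v * suc j)) N) k  ≤⟨ ℕP.m≤n+m _ _ ⟩
    _                                             ∎
  where
  open ℕP.≤-Reasoning
  m≤k : m ≤ k
  m≤k = ℕP.≤-pred (ℕP.≰⇒> k≰m)
  same : ∀ t → sub (p# k) m t ≡ sub (p# (suc k)) m t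
  same t = cong (when (t ℕ.≤? m)) (sym (p#-stable (≤-trans (ℕP.m∸n≤m m t) m≤k)))
... | yes k≤m with N | m≤N
... | zero   | z≤n  = contradiction k≤m λ ()
-- The recursion on the largest part is multiplied by m = k₁ + m′. The share k₁ p(m′) is the term j
-- = 0 for the new part k₁; the induction at m′ supplies the later terms, shifted by one, and so
-- stops at `N′`.
... | suc N′ | m≤sN = begin
    m * p# k₁ m                                              ≡⟨ cong (m *_) (trans (p#-suc k m) (cong (p# k m +_) (sub-≤ (p# k₁) k≤m))) ⟩
    m * (p# k m + p# k₁ m′)                                  ≡⟨ ℕP.*-distribˡ-+ m (p# k m) _ ⟩
    m * p# k m + m * p# k₁ m′                                ≡⟨ cong (λ a → m * p# k m + a * p# k₁ m′) (sym (ℕP.m+[n∸m]≡n k≤m)) ⟩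
    m * p# k m + (k₁ + m′) * p# k₁ m′                        ≡⟨ cong (m * p# k m +_) (ℕP.*-distribʳ-+ (p# k₁ m′) k₁ m′) ⟩
    m * p# k m + (k₁ * p# k₁ m′ + m′ * p# k₁ m′)
      ≤⟨ ℕP.+-mono-≤ (erdős k m (acc rs) (suc N′) m≤sN) (ℕP.+-monoʳ-≤ (k₁ * p# k₁ m′) (erdős k₁ m′ (rs (ℕP.∸-monoʳ-< (s≤s z≤n) k≤m)) N′ m′≤N′)) ⟩
    sumTo (λ v → suc v * sumTo (a v) (suc N′)) k + (k₁ * p# k₁ m′ + (k₁ * sumTo (b k) N′ + sumTo (λ v → suc v * sumTo (b v) N′) k))
      ≡⟨ regroup (sumTo (λ v → suc v * sumTo (a v) (suc N′)) k) k₁ (p# k₁ m′) (sumTo (b k) N′) _ ⟩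
    k₁ * (p# k₁ m′ + sumTo (b k) N′) + (sumTo (λ v → suc v * sumTo (a v) (suc N′)) k + sumTo (λ v → suc v * sumTo (b v) N′) k)
      ≡⟨ cong₂ _+_ (cong (k₁ *_) (sym first)) (sym (sumTo-+ (λ v → suc v * sumTo (a v) (suc N′)) (λ v → suc v * sumTo (b v) N′) k)) ⟩
    k₁ * sumTo (c k) (suc N′) + sumTo (λ v → suc v * sumTo (a v) (suc N′) + suc v * sumTo (b v) N′) k
      ≤⟨ ℕP.+-monoʳ-≤ (k₁ * sumTo (c k) (suc N′)) (sumTo-mono k merge) ⟩
    k₁ * sumTo (c k) (suc N′) + sumTo (λ v → suc v * sumTo (c v) (suc N′)) k   ∎
  where
  open ℕP.≤-Reasoning
  k₁ = suc k
  m′ = m ∸ k₁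
  a b c : ℕ → ℕ → ℕ
  a v j = sub (p# k) m (suc v * suc j)
  b v j = sub (p# k₁) m′ (suc v * suc j)
  c v j = sub (p# k₁) m (suc v * suc j)
  m′≤N′ : m′ ≤ N′
  m′≤N′ = ℕP.∸-mono m≤sN (s≤s (z≤n {k}))
  regroup : ∀ x k p y z → x + (k * p + (k * y + z)) ≡ k * (p + y) + (x + z)
  regroup = solve 5 (λ x k p y z → x :+ (k :* p :+ (k :* y :+ z)) := k :* (p :+ y) :+ (x :+ z)) refl
    where open +-*-Solver
  first : sumTo (c k) (suc N′) ≡ p# k₁ m′ + sumTo (b k) N′
  first = trans (sumTo-first (c k) N′) (cong₂ _+_
    (trans (cong (sub (p# k₁) m) (ℕP.*-identityʳ k₁)) (sub-≤ (p# k₁) k≤m))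
    (sumTo-cong N′ λ j _ → trans (cong (sub (p# k₁) m) (ℕP.*-suc k₁ (suc j))) (sub-shift (p# k₁) (k₁ * suc j) k≤m)))
  pointwise : ∀ t → sub (p# k) m t + sub (p# k₁) m′ t ≡ sub (p# k₁) m t
  pointwise t with t ℕ.≤? m
  ... | yes t≤m = sym (trans (p#-suc k (m ∸ t)) (cong (p# k (m ∸ t) +_)
        (trans (sym (sub-shift (p# k₁) k₁ t≤m)) (trans (cong (sub (p# k₁) m) (ℕP.+-comm t k₁)) (sub-shift (p# k₁) t k≤m)))))
  ... | no t≰m  = sub-> (p# k₁) (ℕP.≤-<-trans (ℕP.m∸n≤m m k₁) (ℕP.≰⇒> t≰m))
  merge : ∀ v → suc v * sumTo (a v) (suc N′) + suc v * sumTo (b v) N′ ≤ suc v * sumTo (c v) (suc N′)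
  merge v = ≤-trans (ℕP.≤-reflexive (sym (ℕP.*-distribˡ-+ (suc v) (sumTo (a v) (suc N′)) (sumTo (b v) N′)))) (ℕP.*-monoʳ-≤ (suc v) (≤-trans
    (ℕP.+-monoʳ-≤ (sumTo (a v) (suc N′)) (ℕP.m≤n+m (sumTo (b v) N′) (b v N′)))
    (ℕP.≤-reflexive (trans (sym (sumTo-+ (a v) (b v) (suc N′))) (sumTo-cong (suc N′) λ j _ → pointwise (suc v * suc j))))))

-- Σ 1/k² ≤ 7/4.
sum-squares : ∀ (E : ℕ → ℕ) Y → (∀ k → E (suc k) * (suc k * suc k) ≤ Y) → ∀ N → 4 * sumTo (E ∘ suc) N ≤ 7 * Y
sum-squares E Y h zero    = z≤n
sum-squares E Y h 1       = ≤-trans (ℕP.≤-reflexive (cong (4 *_) (trans (ℕP.+-identityʳ _) (sym (ℕP.*-identityʳ (E 1))))))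
                              (ℕP.*-mono-≤ {4} {7} (ℕP.m≤m+n 4 3) (h 0))
sum-squares E Y h (suc (suc N)) = ℕP.*-cancelˡ-≤ (suc (suc N)) (≤-trans (ℕP.m≤m+n _ (4 * Y)) (claim N))
  where
  open ℕP.≤-Reasoning
  open +-*-Solver
  Σ′ = λ K → sumTo (E ∘ suc) K
  -- Strengthened to Σ_(k ≤ K) 1/k² ≤ 7/4 - 1/K for K ≥ 2, which is an equality at K = 2 and is
  -- preserved because 1/(K+1)² ≤ 1/K - 1/(K+1).
  claim : ∀ N → suc (suc N) * (4 * Σ′ (suc (suc N))) + 4 * Y ≤ suc (suc N) * (7 * Y)
  claim zero = begin
    2 * (4 * (E 2 + (E 1 + 0))) + 4 * Y   ≡⟨ solve 3 (λ a b y → con 2 :* (con 4 :* (a :+ (b :+ con 0))) :+ con 4 :* y := con 2 :* (a :* (con 2 :* con 2)) :+ (con 8 :* (b :* (con 1 :* con 1)) :+ con 4 :* y)) refl (E 2) (E 1) Y ⟩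
    2 * (E 2 * (2 * 2)) + (8 * (E 1 * (1 * 1)) + 4 * Y)   ≤⟨ ℕP.+-mono-≤ (ℕP.*-monoʳ-≤ 2 (h 1)) (ℕP.+-monoˡ-≤ (4 * Y) (ℕP.*-monoʳ-≤ 8 (h 0))) ⟩
    2 * Y + (8 * Y + 4 * Y)               ≡⟨ solve 1 (λ y → con 2 :* y :+ (con 8 :* y :+ con 4 :* y) := con 2 :* (con 7 :* y)) refl Y ⟩
    2 * (7 * Y)                           ∎
  claim (suc N) = ℕP.*-cancelˡ-≤ (suc (suc N)) (begin
    K * (suc K * (4 * (e + Σ′ K)) + 4 * Y)
      ≡⟨ solve 4 (λ K e s y → K :* ((con 1 :+ K) :* (con 4 :* (e :+ s)) :+ con 4 :* y) := (con 4 :* (K :* ((con 1 :+ K) :* e))) :+ ((con 1 :+ K) :* (K :* (con 4 :* s)) :+ K :* (con 4 :* y))) refl K e (Σ′ K) Y ⟩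
    4 * (K * (suc K * e)) + (suc K * (K * (4 * Σ′ K)) + K * (4 * Y))
      ≤⟨ ℕP.+-monoˡ-≤ _ (ℕP.*-monoʳ-≤ 4 (≤-trans (ℕP.*-monoˡ-≤ (suc K * e) (ℕP.n≤1+n K)) (≤-trans (ℕP.≤-reflexive (solve 2 (λ K e → K :* (K :* e) := e :* (K :* K)) refl (suc K) e)) (h K)))) ⟩
    4 * Y + (suc K * (K * (4 * Σ′ K)) + K * (4 * Y))
      ≡⟨ solve 3 (λ K t y → con 4 :* y :+ ((con 1 :+ K) :* t :+ K :* (con 4 :* y)) := (con 1 :+ K) :* (t :+ con 4 :* y)) refl K (K * (4 * Σ′ K)) Y ⟩
    suc K * (K * (4 * Σ′ K) + 4 * Y)      ≤⟨ ℕP.*-monoʳ-≤ (suc K) (claim N) ⟩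
    suc K * (K * (7 * Y))                 ≡⟨ solve 2 (λ K t → (con 1 :+ K) :* (K :* t) := K :* ((con 1 :+ K) :* t)) refl K (7 * Y) ⟩
    K * (suc K * (7 * Y))                 ∎)
    where
    K = suc (suc N)
    e = E (suc K)

square-cancel-≤ : ∀ a b → a * a ≤ b * b → a ≤ b
square-cancel-≤ a b le = ℕP.≮⇒≥ λ b<a → ℕP.<⇒≱ (ℕP.*-mono-< b<a b<a) le

*-^ : ∀ a b k → (a * b) ^ k ≡ a ^ k * b ^ k
*-^ a b zero    = refl
*-^ a b (suc k) = trans (cong (a * b *_) (*-^ a b k))
  (solve 4 (λ a b x y → a :* b :* (x :* y) := a :* x :* (b :* y)) refl a b (a ^ k) (b ^ k))
  where open +-*-Solver

-- For f growing with ratio w/u and x = (u/w)^k, these are the estimates Σ_v x^v ≤ x/(1-x) and Σ_v v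
-- x^v ≤ x/(1-x)², cleared of denominators. They hold only up to `n₁`, where the progression is
-- used.
module Geometric (f : ℕ → ℕ) (n₁ u δ : ℕ) (1≤u : 1 ≤ u) (ratio : ∀ m → m < n₁ → f m * (u + δ) ≡ f (suc m) * u) where
  open ℕP.≤-Reasoning
  open +-*-Solver

  w : ℕ
  w = u + δ

  f-shift : ∀ k m → k ≤ m → m ≤ n₁ → f (m ∸ k) * w ^ k ≡ f m * u ^ k
  f-shift zero    m _   _    = refl
  f-shift (suc k) m k<m m≤n₁ = begin-equality
    f (m ∸ suc k) * (w * w ^ k)       ≡⟨ sym (ℕP.*-assoc (f (m ∸ suc k)) w _) ⟩
    f (m ∸ suc k) * w * w ^ k         ≡⟨ cong (_* w ^ k) (ratio (m ∸ suc k) (≤-trans (ℕP.∸-monoʳ-< (s≤s z≤n) k<m) m≤n₁)) ⟩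
    f (suc (m ∸ suc k)) * u * w ^ k   ≡⟨ cong (λ j → f j * u * w ^ k) (sym (ℕP.+-∸-assoc 1 k<m)) ⟩
    f (m ∸ k) * u * w ^ k             ≡⟨ solve 3 (λ a b c → a :* b :* c := a :* c :* b) refl (f (m ∸ k)) u (w ^ k) ⟩
    f (m ∸ k) * w ^ k * u             ≡⟨ cong (_* u) (f-shift k m (ℕP.<⇒≤ k<m) m≤n₁) ⟩
    f m * u ^ k * u                   ≡⟨ trans (ℕP.*-assoc (f m) _ u) (cong (f m *_) (ℕP.*-comm (u ^ k) u)) ⟩
    f m * (u * u ^ k)                 ∎

  -- h k = (w^k - u^k) / (w - u).
  h : ℕ → ℕ
  h zero    = 0
  h (suc k) = w ^ k + u * h k

  w^-u^ : ∀ k → w ^ k ≡ u ^ k + δ * h k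
  w^-u^ zero    = cong suc (sym (ℕP.*-zeroʳ δ))
  w^-u^ (suc k) = begin-equality
    (u + δ) * w ^ k                        ≡⟨ ℕP.*-distribʳ-+ (w ^ k) u δ ⟩
    u * w ^ k + δ * w ^ k                  ≡⟨ cong (λ a → u * a + δ * w ^ k) (w^-u^ k) ⟩
    u * (u ^ k + δ * h k) + δ * w ^ k      ≡⟨ solve 5 (λ u a d h b → u :* (a :+ d :* h) :+ d :* b := u :* a :+ d :* (b :+ u :* h)) refl u (u ^ k) δ (h k) (w ^ k) ⟩
    u * u ^ k + δ * (w ^ k + u * h k)      ∎

  h-sym : ∀ k → h (suc k) ≡ u ^ k + w * h k
  h-sym k = begin-equality
    w ^ k + u * h k                   ≡⟨ cong (_+ u * h k) (w^-u^ k) ⟩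
    u ^ k + δ * h k + u * h k         ≡⟨ solve 4 (λ a d h u → a :+ d :* h :+ u :* h := a :+ (u :+ d) :* h) refl (u ^ k) δ (h k) u ⟩
    u ^ k + (u + δ) * h k             ∎

  c : ℕ
  c = u * w

  1≤c : 1 ≤ c
  1≤c = ℕP.*-mono-≤ 1≤u (≤-trans 1≤u (ℕP.m≤m+n u δ))

  c^ : ∀ k → c ^ k ≡ u ^ k * w ^ k
  c^ k = *-^ u w k

  4ab≤[a+b]² : ∀ a b → 4 * (a * b) ≤ (a + b) * (a + b)
  4ab≤[a+b]² a b with ℕP.≤-total a b
  ... | inj₁ le = subst (λ b → 4 * (a * b) ≤ (a + b) * (a + b)) (ℕP.m+[n∸m]≡n le) (ordered a (b ∸ a))
    where
    ordered : ∀ a d → 4 * (a * (a + d)) ≤ (a + (a + d)) * (a + (a + d))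
    ordered a d = ≤-trans (ℕP.m≤m+n _ (d * d)) (ℕP.≤-reflexive (solve 2 (λ a d → con 4 :* (a :* (a :+ d)) :+ d :* d := (a :+ (a :+ d)) :* (a :+ (a :+ d))) refl a d))
  ... | inj₂ ge = subst (λ a → 4 * (a * b) ≤ (a + b) * (a + b)) (ℕP.m+[n∸m]≡n ge) (ordered b (a ∸ b))
    where
    ordered : ∀ b d → 4 * ((b + d) * b) ≤ ((b + d) + b) * ((b + d) + b)
    ordered b d = ≤-trans (ℕP.m≤m+n _ (d * d)) (ℕP.≤-reflexive (solve 2 (λ b d → con 4 :* ((b :+ d) :* b) :+ d :* d := ((b :+ d) :+ b) :* ((b :+ d) :+ b)) refl b d))

  -- AM-GM on the k terms w^i u^(k-1-i) of h k.
  am-gm : ∀ k → (k * k) * c ^ k ≤ h k * h k * c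
  am-gm zero          = z≤n
  am-gm 1             = ℕP.≤-reflexive (solve 2 (λ u c → (con 1 :* con 1) :* (c :* con 1) := (con 1 :+ u :* con 0) :* (con 1 :+ u :* con 0) :* c) refl u c)
  -- Two steps at once: h (k+2) = w^(k+1) + u^(k+1) + u w h k, where the two outer terms have a
  -- product that is a power of c.
  am-gm (suc (suc k)) = begin
    (suc (suc k) * suc (suc k)) * (c * (c * c ^ k))
      ≡⟨ solve 3 (λ k c g → ((con 2 :+ k) :* (con 2 :+ k)) :* (c :* (c :* g)) := c :* (con 4 :* (c :* g)) :+ (con 2 :* (c :* c) :* (con 2 :* k :* g)) :+ (c :* c) :* ((k :* k) :* g)) refl k c (c ^ k) ⟩
    c * (4 * (c * c ^ k)) + 2 * (c * c) * (2 * k * c ^ k) + (c * c) * ((k * k) * c ^ k)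
      ≤⟨ ℕP.+-mono-≤ (ℕP.+-mono-≤ (ℕP.*-monoʳ-≤ c A²) (ℕP.*-monoʳ-≤ (2 * (c * c)) Ah)) (ℕP.*-monoʳ-≤ (c * c) (am-gm k)) ⟩
    c * (A * A) + 2 * (c * c) * (A * h k) + (c * c) * (h k * h k * c)
      ≡⟨ solve 3 (λ c A h → c :* (A :* A) :+ con 2 :* (c :* c) :* (A :* h) :+ (c :* c) :* (h :* h :* c) := (A :+ c :* h) :* (A :+ c :* h) :* c) refl c A (h k) ⟩
    (A + c * h k) * (A + c * h k) * c     ≡⟨ cong (λ x → x * x * c) (sym h-step) ⟩
    h (suc (suc k)) * h (suc (suc k)) * c ∎
    where
    A = w ^ suc k + u ^ suc k
    h-step : h (suc (suc k)) ≡ A + c * h k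
    h-step = trans (cong (λ x → w ^ suc k + u * x) (h-sym k)) (solve 5 (λ W u a w h → W :+ u :* (a :+ w :* h) := W :+ u :* a :+ u :* w :* h) refl (w ^ suc k) u (u ^ k) w (h k))
    A² : 4 * (c * c ^ k) ≤ A * A
    A² = ≤-trans (ℕP.≤-reflexive (cong (4 *_) (trans (c^ (suc k)) (ℕP.*-comm (u ^ suc k) _)))) (4ab≤[a+b]² (w ^ suc k) (u ^ suc k))
    Ah : 2 * k * c ^ k ≤ A * h k
    Ah = square-cancel-≤ _ _ (ℕP.*-cancelʳ-≤ _ _ c {{>-nonZero 1≤c}} (begin
      2 * k * c ^ k * (2 * k * c ^ k) * c          ≡⟨ solve 3 (λ k g c → con 2 :* k :* g :* (con 2 :* k :* g) :* c := (con 4 :* (c :* g)) :* ((k :* k) :* g)) refl k (c ^ k) c ⟩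
      (4 * (c * c ^ k)) * ((k * k) * c ^ k)        ≤⟨ ℕP.*-mono-≤ A² (am-gm k) ⟩
      (A * A) * (h k * h k * c)                    ≡⟨ solve 3 (λ A h c → (A :* A) :* (h :* h :* c) := A :* h :* (A :* h) :* c) refl A (h k) c ⟩
      A * h k * (A * h k) * c                      ∎))

  module _ (k₀ : ℕ) where
    private
      k = suc k₀
      U = u ^ k
      W = w ^ k
      D = δ * h k

    S E : ℕ → ℕ → ℕ
    S V m = sumTo (λ v → sub f m (k * suc v)) V
    E V m = sumTo (λ v → suc v * sub f m (k * suc v)) V

    private
      terms : ∀ m v → k ≤ m → sub f m (k * suc (suc v)) ≡ sub f (m ∸ k) (k * suc v)
      terms m v k≤m = trans (cong (sub f m) (ℕP.*-suc k (suc v))) (sub-shift f (k * suc v) k≤m)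
      term-0 : ∀ m → k ≤ m → sub f m (k * 1) ≡ f (m ∸ k)
      term-0 m k≤m = trans (cong (sub f m) (ℕP.*-identityʳ k)) (sub-≤ f k≤m)
      none : ∀ {m} v → ¬ k ≤ m → sub f m (k * suc v) ≡ 0
      none {m} v k≰m = sub-> f (≤-trans (ℕP.≰⇒> k≰m) (ℕP.m≤m*n k (suc v)))

    S-step : ∀ V m → k ≤ m → S (suc V) m ≡ f (m ∸ k) + S V (m ∸ k)
    S-step V m k≤m = trans (sumTo-first _ V) (cong₂ _+_ (term-0 m k≤m) (sumTo-cong V λ v _ → terms m v k≤m))

    E-step : ∀ V m → k ≤ m → E (suc V) m ≡ (f (m ∸ k) + S V (m ∸ k)) + E V (m ∸ k)
    E-step V m k≤m = begin-equality
      E (suc V) m                                                              ≡⟨ sumTo-first _ V ⟩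
      1 * sub f m (k * 1) + sumTo (λ v → suc (suc v) * sub f m (k * suc (suc v))) V
        ≡⟨ cong₂ _+_ (trans (ℕP.*-identityˡ _) (term-0 m k≤m)) (trans (sumTo-cong V λ v _ → cong (suc (suc v) *_) (terms m v k≤m)) (sumTo-+ _ _ V)) ⟩
      f (m ∸ k) + (S V (m ∸ k) + E V (m ∸ k))                                  ≡⟨ sym (ℕP.+-assoc (f (m ∸ k)) _ _) ⟩
      (f (m ∸ k) + S V (m ∸ k)) + E V (m ∸ k)                                  ∎

    S-bound : ∀ V m → m ≤ n₁ → S V m * D ≤ f m * U
    S-bound zero    m _    = z≤n
    S-bound (suc V) m m≤n₁ = case k ℕ.≤? m of λ where
      (no k≰m)  → subst (λ s → s * D ≤ f m * U) (sym (sumTo-0 (suc V) λ v _ → none v k≰m)) z≤n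
      (yes k≤m) → begin
        S (suc V) m * D                           ≡⟨ cong (_* D) (S-step V m k≤m) ⟩
        (f (m ∸ k) + S V (m ∸ k)) * D             ≡⟨ ℕP.*-distribʳ-+ D (f (m ∸ k)) _ ⟩
        f (m ∸ k) * D + S V (m ∸ k) * D           ≤⟨ ℕP.+-monoʳ-≤ _ (S-bound V (m ∸ k) (≤-trans (ℕP.m∸n≤m m k) m≤n₁)) ⟩
        f (m ∸ k) * D + f (m ∸ k) * U             ≡⟨ solve 3 (λ a d u → a :* d :+ a :* u := a :* (u :+ d)) refl (f (m ∸ k)) D U ⟩
        f (m ∸ k) * (U + D)                       ≡⟨ cong (f (m ∸ k) *_) (sym (w^-u^ k)) ⟩
        f (m ∸ k) * W                             ≡⟨ f-shift k m k≤m m≤n₁ ⟩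
        f m * U                                   ∎

    -- By `E-step`, lowering every multiplicity by one turns the sum at m into a plain geometric sum
    -- plus the same weighted sum at m - k. The bound is UW/(W-U)², which is x/(1-x)² for x = U/W.
    E-bound : ∀ V m → m ≤ n₁ → E V m * (D * D) ≤ f m * (U * W)
    E-bound zero    m _    = z≤n
    E-bound (suc V) m m≤n₁ = case k ℕ.≤? m of λ where
      (no k≰m)  → subst (λ s → s * (D * D) ≤ f m * (U * W)) (sym (sumTo-0 (suc V) λ v _ → trans (cong (suc v *_) (none v k≰m)) (ℕP.*-zeroʳ (suc v)))) z≤n
      (yes k≤m) → begin
        E (suc V) m * (D * D)                                                  ≡⟨ cong (_* (D * D)) (E-step V m k≤m) ⟩
        ((f (m ∸ k) + S V (m ∸ k)) + E V (m ∸ k)) * (D * D)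
          ≡⟨ solve 4 (λ a s e d → ((a :+ s) :+ e) :* (d :* d) := (a :* d :+ s :* d) :* d :+ e :* (d :* d)) refl (f (m ∸ k)) (S V (m ∸ k)) (E V (m ∸ k)) D ⟩
        (f (m ∸ k) * D + S V (m ∸ k) * D) * D + E V (m ∸ k) * (D * D)
          ≤⟨ ℕP.+-mono-≤ (ℕP.*-monoˡ-≤ D (ℕP.+-monoʳ-≤ (f (m ∸ k) * D) (S-bound V (m ∸ k) (≤-trans (ℕP.m∸n≤m m k) m≤n₁)))) (E-bound V (m ∸ k) (≤-trans (ℕP.m∸n≤m m k) m≤n₁)) ⟩
        (f (m ∸ k) * D + f (m ∸ k) * U) * D + f (m ∸ k) * (U * W)
          ≡⟨ cong (λ x → (f (m ∸ k) * D + f (m ∸ k) * U) * D + f (m ∸ k) * (U * x)) (w^-u^ k) ⟩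
        (f (m ∸ k) * D + f (m ∸ k) * U) * D + f (m ∸ k) * (U * (U + D))
          ≡⟨ solve 3 (λ a d u → (a :* d :+ a :* u) :* d :+ a :* (u :* (u :+ d)) := a :* (u :+ d) :* (u :+ d)) refl (f (m ∸ k)) D U ⟩
        f (m ∸ k) * (U + D) * (U + D)             ≡⟨ cong (λ x → f (m ∸ k) * x * x) (sym (w^-u^ k)) ⟩
        f (m ∸ k) * W * W                         ≡⟨ cong (_* W) (f-shift k m k≤m m≤n₁) ⟩
        f m * U * W                               ≡⟨ ℕP.*-assoc (f m) U W ⟩
        f m * (U * W)                             ∎

    -- Combines UW = c^k with (W-U)² ≥ δ² k² c^(k-1) from `am-gm`. The resulting 1/k² is what makes
    -- the sum over k converge.
    E-square : ∀ V m → m ≤ n₁ → δ * δ * E V m * (k * k) ≤ f m * c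
    E-square V m m≤n₁ = ℕP.*-cancelʳ-≤ _ _ (c ^ k) {{ℕP.m^n≢0 c k {{>-nonZero 1≤c}}}} (begin
      δ * δ * E V m * (k * k) * c ^ k       ≡⟨ ℕP.*-assoc (δ * δ * E V m) _ _ ⟩
      δ * δ * E V m * ((k * k) * c ^ k)     ≤⟨ ℕP.*-monoʳ-≤ (δ * δ * E V m) (am-gm k) ⟩
      δ * δ * E V m * (h k * h k * c)       ≡⟨ solve 4 (λ d e h c → d :* d :* e :* (h :* h :* c) := e :* ((d :* h) :* (d :* h)) :* c) refl δ (E V m) (h k) c ⟩
      E V m * (D * D) * c                   ≤⟨ ℕP.*-monoˡ-≤ c (E-bound V m m≤n₁) ⟩
      f m * (U * W) * c                     ≡⟨ cong (λ x → f m * x * c) (sym (c^ k)) ⟩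
      f m * c ^ k * c                       ≡⟨ solve 3 (λ a g c → a :* g :* c := a :* c :* g) refl (f m) (c ^ k) c ⟩
      f m * c * c ^ k                       ∎)

-- The block with index s consists of the m with (s+1)² ≤ m < (s+2)²; on it partition numbers are compared
-- with a geometric progression of ratio width s / base s, chosen so that the Erdős identity closes the induction.
base width last exponent : ℕ → ℕ
base s     = 3 * s + 1
width s    = base s + 4
last s     = s * s + 4 * s + 3
exponent s = 2 * s + 3

1≤base : ∀ s → 1 ≤ base s
1≤base s = ℕP.m≤n+m 1 (3 * s)

Bounded : ℕ → ℕ → Set
Bounded s C₀ = ∀ K m → m ≤ last s → p# K m * width s ^ (last s ∸ m) ≤ C₀ * base s ^ (last s ∸ m)

module Block (s C₀ K : ℕ)
             (initially : ∀ m → m ≤ s * s + 2 * s → p# K m * width s ^ (last s ∸ m) ≤ C₀ * base s ^ (last s ∸ m)) where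
  open ℕP.≤-Reasoning
  open +-*-Solver

  private
    u = base s
    w = width s
    n₁ = last s

  f : ℕ → ℕ
  f m = C₀ * (u ^ (n₁ ∸ m) * w ^ m)

  ratio : ∀ m → m < n₁ → f m * w ≡ f (suc m) * u
  ratio m m<n₁ = trans (cong (λ j → C₀ * (u ^ j * w ^ m) * w) (ℕP.+-∸-assoc 1 m<n₁))
    (solve 5 (λ c u w a b → c :* (u :* a :* b) :* w := c :* (a :* (w :* b)) :* u) refl C₀ u w (u ^ (n₁ ∸ suc m)) (w ^ m))

  open Geometric f n₁ u 4 (1≤base s) ratio hiding (w)

  1≤w : 1 ≤ w
  1≤w = ≤-trans (1≤base s) (ℕP.m≤m+n u 4)

  split-power : ∀ a m → m ≤ n₁ → a * w ^ n₁ ≡ a * w ^ (n₁ ∸ m) * w ^ m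
  split-power a m m≤n₁ = trans (cong (λ j → a * w ^ j) (sym (ℕP.m∸n+n≡m m≤n₁)))
    (trans (cong (a *_) (ℕP.^-distribˡ-+-* w (n₁ ∸ m) m)) (sym (ℕP.*-assoc a _ _)))

  -- Here c = 9 (s+1)² - 4 and m ≥ (s+1)². With δ = 4 and Σ 1/k² ≤ 7/4 the induction needs 7 c ≤ 64
  -- m, and 63 < 64: this is the reason for the coefficients 3 and 4 in `base` and `width`.
  coefficient : ∀ m → suc (s * s + 2 * s) ≤ m → 7 * c ≤ 64 * m
  coefficient m le = ≤-trans (≤-trans (ℕP.m≤m+n (7 * c) (s * s + 2 * s + 29)) (ℕP.≤-reflexive
    (solve 1 (λ s → con 7 :* ((con 3 :* s :+ con 1) :* (con 3 :* s :+ con 1 :+ con 4)) :+ (s :* s :+ con 2 :* s :+ con 29)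
      := con 64 :* (con 1 :+ (s :* s :+ con 2 :* s))) refl s))) (ℕP.*-monoʳ-≤ 64 le)

  total : ∀ m → m ≤ n₁ → suc (s * s + 2 * s) ≤ m → sumTo (λ j → E j K m) m ≤ m * f m
  total m m≤n₁ le = ℕP.*-cancelˡ-≤ 64 (begin
    64 * sumTo (λ j → E j K m) m                 ≡⟨ trans (ℕP.*-assoc 4 16 (sumTo (λ j → E j K m) m)) (cong (4 *_) (trans (ℕP.*-comm 16 (sumTo (λ j → E j K m) m)) (trans (sumTo-* (λ j → E j K m) m 16) (sumTo-cong m λ j _ → ℕP.*-comm (E j K m) 16)))) ⟩
    4 * sumTo (E′ ∘ suc) m                       ≤⟨ sum-squares E′ (f m * c) (λ j → E-square j K m m≤n₁) m ⟩
    7 * (f m * c)                                ≡⟨ solve 2 (λ f c → con 7 :* (f :* c) := con 7 :* c :* f) refl (f m) c ⟩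
    7 * c * f m                                  ≤⟨ ℕP.*-monoˡ-≤ (f m) (coefficient m le) ⟩
    64 * m * f m                                 ≡⟨ ℕP.*-assoc 64 m (f m) ⟩
    64 * (m * f m)                               ∎)
    where
    E′ : ℕ → ℕ
    E′ zero    = 0
    E′ (suc j) = 4 * 4 * E j K m

  bounded : ∀ m → Acc _<_ m → m ≤ n₁ → p# K m * w ^ n₁ ≤ f m
  bounded m (acc rs) m≤n₁ = case m ℕ.≤? s * s + 2 * s of λ where
      (yes m≤n₀) → ≤-trans (ℕP.≤-reflexive (split-power (p# K m) m m≤n₁))
        (≤-trans (ℕP.*-monoˡ-≤ (w ^ m) (initially m m≤n₀)) (ℕP.≤-reflexive (ℕP.*-assoc C₀ _ _)))
      (no m≰n₀) → ℕP.*-cancelˡ-≤ m {{>-nonZero (≤-trans (s≤s z≤n) (ℕP.≰⇒> m≰n₀))}} (begin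
        m * (p# K m * w ^ n₁)           ≡⟨ sym (ℕP.*-assoc m _ _) ⟩
        m * p# K m * w ^ n₁             ≤⟨ ℕP.*-monoˡ-≤ (w ^ n₁) (erdős K m (<-wellFounded m) m ≤-refl) ⟩
        sumTo (λ v → suc v * sumTo (λ j → sub (p# K) m (suc v * suc j)) m) K * w ^ n₁
          ≡⟨ trans (sumTo-* (λ v → suc v * sumTo (λ j → sub (p# K) m (suc v * suc j)) m) K (w ^ n₁)) (sumTo-cong K λ v _ → trans (ℕP.*-assoc (suc v) (sumTo (λ j → sub (p# K) m (suc v * suc j)) m) (w ^ n₁)) (cong (suc v *_) (sumTo-* (λ j → sub (p# K) m (suc v * suc j)) m (w ^ n₁)))) ⟩
        sumTo (λ v → suc v * sumTo (λ j → sub (p# K) m (suc v * suc j) * w ^ n₁) m) K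
          ≤⟨ sumTo-mono K (λ v → ℕP.*-monoʳ-≤ (suc v) (sumTo-mono m λ j → term (suc v * suc j) (s≤s z≤n))) ⟩
        sumTo (λ v → suc v * sumTo (λ j → sub f m (suc v * suc j)) m) K
          ≡⟨ sumTo-cong K (λ v _ → trans (ℕP.*-comm (suc v) (sumTo (λ j → sub f m (suc v * suc j)) m)) (trans (sumTo-* (λ j → sub f m (suc v * suc j)) m (suc v))
               (sumTo-cong m λ j _ → trans (ℕP.*-comm (sub f m (suc v * suc j)) (suc v)) (cong (λ t → suc v * sub f m t) (ℕP.*-comm (suc v) (suc j)))))) ⟩
        sumTo (λ v → sumTo (λ j → suc v * sub f m (suc j * suc v)) m) K
          ≡⟨ sumTo-swap (λ v j → suc v * sub f m (suc j * suc v)) K m ⟩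
        sumTo (λ j → E j K m) m         ≤⟨ total m m≤n₁ (ℕP.≰⇒> m≰n₀) ⟩
        m * f m                         ∎)
    where
    term : ∀ t → 1 ≤ t → sub (p# K) m t * w ^ n₁ ≤ sub f m t
    term t 1≤t with t ℕ.≤? m
    ... | yes t≤m = bounded (m ∸ t) (rs (ℕP.∸-monoʳ-< 1≤t t≤m)) (≤-trans (ℕP.m∸n≤m m t) m≤n₁)
    ... | no _    = z≤n

  conclusion : ∀ m → m ≤ n₁ → p# K m * w ^ (n₁ ∸ m) ≤ C₀ * u ^ (n₁ ∸ m)
  conclusion m m≤n₁ = ℕP.*-cancelʳ-≤ _ _ (w ^ m) {{ℕP.m^n≢0 w m {{>-nonZero 1≤w}}}}
    (≤-trans (ℕP.≤-reflexive (sym (split-power (p# K m) m m≤n₁))) (≤-trans (bounded m (<-wellFounded m) m≤n₁)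
      (ℕP.≤-reflexive (sym (ℕP.*-assoc C₀ _ _)))))

ratio-mono : ∀ {a C₀ u w u′ w′} j → 1 ≤ w → u * w′ ≤ u′ * w → a * w ^ j ≤ C₀ * u ^ j → a * w′ ^ j ≤ C₀ * u′ ^ j
ratio-mono {a} {C₀} {u} {w} {u′} {w′} j 1≤w ratio le = ℕP.*-cancelʳ-≤ _ _ (w ^ j) {{ℕP.m^n≢0 w j {{>-nonZero 1≤w}}}} (begin
  a * w′ ^ j * w ^ j         ≡⟨ solve 3 (λ a b c → a :* b :* c := a :* c :* b) refl a (w′ ^ j) (w ^ j) ⟩
  a * w ^ j * w′ ^ j         ≤⟨ ℕP.*-monoˡ-≤ (w′ ^ j) le ⟩
  C₀ * u ^ j * w′ ^ j        ≡⟨ trans (ℕP.*-assoc C₀ _ _) (cong (C₀ *_) (sym (*-^ u w′ j))) ⟩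
  C₀ * (u * w′) ^ j          ≤⟨ ℕP.*-monoʳ-≤ C₀ (ℕP.^-monoˡ-≤ j ratio) ⟩
  C₀ * (u′ * w) ^ j          ≡⟨ trans (cong (C₀ *_) (*-^ u′ w j)) (sym (ℕP.*-assoc C₀ _ _)) ⟩
  C₀ * u′ ^ j * w ^ j        ∎)
  where
  open ℕP.≤-Reasoning
  open +-*-Solver

Growth : ℕ → ℕ → Set
Growth g s = width s ^ exponent s ≤ g * base s ^ exponent s

-- The ratio decreases from block to block, so the old bound survives with the new ratio; extending
-- it over the additional `exponent (suc s)` places costs at most the factor g. It then initializes
-- the new block, since the range of `initially` there ends at `last s`.
next-block : ∀ s C₀ g → Growth g (suc s) → Bounded s C₀ → Bounded (suc s) (C₀ * g)
next-block s C₀ g growth bounded K = Block.conclusion s′ (C₀ * g) K initially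
  where
  open ℕP.≤-Reasoning
  open +-*-Solver
  s′ = suc s
  n₀≡ : s′ * s′ + 2 * s′ ≡ last s
  n₀≡ = solve 1 (λ s → (con 1 :+ s) :* (con 1 :+ s) :+ con 2 :* (con 1 :+ s) := s :* s :+ con 4 :* s :+ con 3) refl s
  last≡ : last s′ ≡ exponent s′ + last s
  last≡ = solve 1 (λ s → (con 1 :+ s) :* (con 1 :+ s) :+ con 4 :* (con 1 :+ s) :+ con 3
                      := con 2 :* (con 1 :+ s) :+ con 3 :+ (s :* s :+ con 4 :* s :+ con 3)) refl s
  ratio : base s * width s′ ≤ base s′ * width s
  ratio = ≤-trans (ℕP.m≤m+n _ 12) (ℕP.≤-reflexive (solve 1 (λ s → (con 3 :* s :+ con 1) :* (con 3 :* (con 1 :+ s) :+ con 1 :+ con 4) :+ con 12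
    := (con 3 :* (con 1 :+ s) :+ con 1) :* (con 3 :* s :+ con 1 :+ con 4)) refl s))
  initially : ∀ m → m ≤ s′ * s′ + 2 * s′ → p# K m * width s′ ^ (last s′ ∸ m) ≤ C₀ * g * base s′ ^ (last s′ ∸ m)
  initially m m≤n₀ = subst (λ j → p# K m * width s′ ^ j ≤ C₀ * g * base s′ ^ j) (sym exponent≡) (begin
    p# K m * width s′ ^ (N + j)              ≡⟨ trans (cong (p# K m *_) (trans (cong (width s′ ^_) (ℕP.+-comm N j)) (ℕP.^-distribˡ-+-* (width s′) j N))) (sym (ℕP.*-assoc (p# K m) _ _)) ⟩
    p# K m * width s′ ^ j * width s′ ^ N     ≤⟨ ℕP.*-mono-≤ (ratio-mono {p# K m} {C₀} {base s} {width s} j (≤-trans (1≤base s) (ℕP.m≤m+n (base s) 4)) ratio (bounded K m m≤)) growth ⟩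
    C₀ * base s′ ^ j * (g * base s′ ^ N)     ≡⟨ solve 4 (λ c a g b → c :* a :* (g :* b) := c :* g :* (b :* a)) refl C₀ (base s′ ^ j) g (base s′ ^ N) ⟩
    C₀ * g * (base s′ ^ N * base s′ ^ j)     ≡⟨ cong (C₀ * g *_) (sym (ℕP.^-distribˡ-+-* (base s′) N j)) ⟩
    C₀ * g * base s′ ^ (N + j)               ∎)
    where
    m≤ : m ≤ last s
    m≤ = subst (m ≤_) n₀≡ m≤n₀
    N = exponent s′
    j = last s ∸ m
    exponent≡ : last s′ ∸ m ≡ N + j
    exponent≡ = trans (cong (_∸ m) last≡) (ℕP.+-∸-assoc N m≤)

triangle : ℕ → ℕ
triangle zero    = 0
triangle (suc n) = triangle n + 2 * n

triangle-suc : ∀ n → triangle (suc n) ≡ suc n * n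
triangle-suc zero    = refl
triangle-suc (suc n) = trans (cong (_+ 2 * suc n) (triangle-suc n))
  (solve 1 (λ n → (con 1 :+ n) :* n :+ con 2 :* (con 1 :+ n) := (con 2 :+ n) :* (con 1 :+ n)) refl n)
  where open +-*-Solver

-- The binomial expansion of (1 + c/β)^N cut after the quadratic term, `triangle N` being N (N-1).
-- The quadratic term matters: in `growth-suc` the linear terms of the two sides agree to leading
-- order.
bernoulli₂ : ∀ β c N → β ^ N * (2 * (β * β) + 2 * (N * c * β) + triangle N * (c * c)) ≤ 2 * (β * β) * (β + c) ^ N
bernoulli₂ β c zero    = ℕP.≤-reflexive (solve 1 (λ b → con 1 :* (con 2 :* (b :* b) :+ con 0 :+ con 0) := con 2 :* (b :* b) :* con 1) refl β)
  where open +-*-Solver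
bernoulli₂ β c (suc N) = begin
  β * β ^ N * (2 * (β * β) + 2 * ((c + N * c) * β) + (triangle N + 2 * N) * (c * c))
    ≤⟨ ℕP.m≤m+n _ (β ^ N * (triangle N * (c * c) * c)) ⟩
  β * β ^ N * (2 * (β * β) + 2 * ((c + N * c) * β) + (triangle N + 2 * N) * (c * c)) + β ^ N * (triangle N * (c * c) * c)
    ≡⟨ solve 5 (λ b c n t g → b :* g :* (con 2 :* (b :* b) :+ con 2 :* ((c :+ n :* c) :* b) :+ (t :+ con 2 :* n) :* (c :* c)) :+ g :* (t :* (c :* c) :* c)
         := g :* (con 2 :* (b :* b) :+ con 2 :* (n :* c :* b) :+ t :* (c :* c)) :* (b :+ c)) refl β c N (triangle N) (β ^ N) ⟩
  β ^ N * (2 * (β * β) + 2 * (N * c * β) + triangle N * (c * c)) * (β + c)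
    ≤⟨ ℕP.*-monoˡ-≤ (β + c) (bernoulli₂ β c N) ⟩
  2 * (β * β) * (β + c) ^ N * (β + c)
    ≡⟨ trans (ℕP.*-assoc (2 * (β * β)) _ _) (cong (2 * (β * β) *_) (ℕP.*-comm ((β + c) ^ N) (β + c))) ⟩
  2 * (β * β) * ((β + c) * (β + c) ^ N)  ∎
  where
  open ℕP.≤-Reasoning
  open +-*-Solver

-- The gain (w/u)^N of a block decreases with s. As w u′ - u w′ = 12, the claim (w′/u′)^(N+2) ≤
-- (w/u)^N reads (w′/u′)² ≤ (1 + 12/β)^N with β = u w′.
growth-suc : ∀ g s → Growth g s → Growth g (suc s)
growth-suc g s growth = ℕP.*-cancelʳ-≤ _ _ (u ^ N) {{ℕP.m^n≢0 u N {{>-nonZero (1≤base s)}}}} (begin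
  w′ ^ exponent (suc s) * u ^ N      ≡⟨ cong (λ n → w′ ^ n * u ^ N) exponent≡ ⟩
  w′ ^ (2 + N) * u ^ N               ≡⟨ solve 3 (λ w g v → w :* (w :* g) :* v := v :* g :* (w :* w)) refl w′ (w′ ^ N) (u ^ N) ⟩
  u ^ N * w′ ^ N * (w′ * w′)         ≡⟨ cong (_* (w′ * w′)) (sym (*-^ u w′ N)) ⟩
  β ^ N * (w′ * w′)                  ≤⟨ compare ⟩
  (β + 12) ^ N * (u′ * u′)           ≡⟨ cong (λ x → x ^ N * (u′ * u′)) α≡ ⟩
  (w * u′) ^ N * (u′ * u′)           ≡⟨ cong (_* (u′ * u′)) (*-^ w u′ N) ⟩
  w ^ N * u′ ^ N * (u′ * u′)         ≤⟨ ℕP.*-monoˡ-≤ (u′ * u′) (ℕP.*-monoˡ-≤ (u′ ^ N) growth) ⟩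
  g * u ^ N * u′ ^ N * (u′ * u′)     ≡⟨ solve 4 (λ g v x u → g :* v :* x :* (u :* u) := g :* (u :* (u :* x)) :* v) refl g (u ^ N) (u′ ^ N) u′ ⟩
  g * u′ ^ (2 + N) * u ^ N           ≡⟨ cong (λ n → g * u′ ^ n * u ^ N) (sym exponent≡) ⟩
  g * u′ ^ exponent (suc s) * u ^ N  ∎)
  where
  open ℕP.≤-Reasoning
  open +-*-Solver
  u = base s
  w = width s
  u′ = base (suc s)
  w′ = width (suc s)
  N = exponent s
  β = u * w′
  1≤β : 1 ≤ β
  1≤β = ℕP.*-mono-≤ (1≤base s) (≤-trans (1≤base (suc s)) (ℕP.m≤m+n u′ 4))
  exponent≡ : exponent (suc s) ≡ 2 + N
  exponent≡ = solve 1 (λ s → con 2 :* (con 1 :+ s) :+ con 3 := con 2 :+ (con 2 :* s :+ con 3)) refl s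
  α≡ : β + 12 ≡ w * u′
  α≡ = solve 1 (λ s → (con 3 :* s :+ con 1) :* (con 3 :* (con 1 :+ s) :+ con 1 :+ con 4) :+ con 12
    := (con 3 :* s :+ con 1 :+ con 4) :* (con 3 :* (con 1 :+ s) :+ con 1)) refl s
  triangle≡ : triangle N ≡ (2 * s + 3) * (2 * s + 2)
  triangle≡ = trans (cong triangle (ℕP.+-suc (2 * s) 2)) (trans (triangle-suc (2 * s + 2)) (cong (_* (2 * s + 2)) (sym (ℕP.+-suc (2 * s) 2))))
  polynomial : 2 * (β * β) * (w′ * w′) ≤ (2 * (β * β) + 2 * (N * 12 * β) + triangle N * (12 * 12)) * (u′ * u′)
  polynomial = ≤-trans (ℕP.m≤m+n _ (1944 * (s * s * (s * s)) + 12744 * (s * s * s) + 39168 * (s * s) + 50304 * s + 16896)) (ℕP.≤-reflexive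
    (trans (solve 1 (λ s → let u = con 3 :* s :+ con 1; u′ = con 3 :* (con 1 :+ s) :+ con 1; w′ = u′ :+ con 4; b = u :* w′; n = con 2 :* s :+ con 3 in
        con 2 :* (b :* b) :* (w′ :* w′) :+ (con 1944 :* (s :* s :* (s :* s)) :+ con 12744 :* (s :* s :* s) :+ con 39168 :* (s :* s) :+ con 50304 :* s :+ con 16896)
        := (con 2 :* (b :* b) :+ con 2 :* (n :* con 12 :* b) :+ n :* (con 2 :* s :+ con 2) :* (con 12 :* con 12)) :* (u′ :* u′)) refl s)
      (cong (λ t → (2 * (β * β) + 2 * (N * 12 * β) + t * (12 * 12)) * (u′ * u′)) (sym triangle≡))))
  compare : β ^ N * (w′ * w′) ≤ (β + 12) ^ N * (u′ * u′)
  compare = ℕP.*-cancelˡ-≤ (2 * (β * β)) {{>-nonZero (ℕP.*-mono-≤ {1} {2} (s≤s z≤n) (ℕP.*-mono-≤ 1≤β 1≤β))}} (begin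
    2 * (β * β) * (β ^ N * (w′ * w′))       ≡⟨ solve 3 (λ a b c → a :* (b :* c) := b :* (a :* c)) refl (2 * (β * β)) (β ^ N) (w′ * w′) ⟩
    β ^ N * (2 * (β * β) * (w′ * w′))       ≤⟨ ℕP.*-monoʳ-≤ (β ^ N) polynomial ⟩
    β ^ N * ((2 * (β * β) + 2 * (N * 12 * β) + triangle N * (12 * 12)) * (u′ * u′))   ≡⟨ sym (ℕP.*-assoc (β ^ N) _ (u′ * u′)) ⟩
    β ^ N * (2 * (β * β) + 2 * (N * 12 * β) + triangle N * (12 * 12)) * (u′ * u′)     ≤⟨ ℕP.*-monoˡ-≤ (u′ * u′) (bernoulli₂ β 12 N) ⟩
    2 * (β * β) * (β + 12) ^ N * (u′ * u′)  ≡⟨ ℕP.*-assoc (2 * (β * β)) _ _ ⟩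
    2 * (β * β) * ((β + 12) ^ N * (u′ * u′))  ∎)

growth-early : (i : Fin 8) → Growth 20 (4 + toℕ i)
growth-early = from-yes (FinP.all? {n = 8} λ i → width (4 + toℕ i) ^ exponent (4 + toℕ i) ℕ.≤? 20 * base (4 + toℕ i) ^ exponent (4 + toℕ i))

-- (41/37)^27 is about 15.98. Block 12 is the first whose gain is at most 16; blocks 4 to 11 are
-- granted 20 instead.
growth-12 : Growth 16 12
growth-12 = from-yes (width 12 ^ exponent 12 ℕ.≤? 16 * base 12 ^ exponent 12)

growth-late : ∀ g → Growth g 12 → ∀ t → Growth g (12 + t)
growth-late g G zero    = G
growth-late g G (suc t) = subst (Growth g) (sym (ℕP.+-suc 12 t)) (growth-suc g (12 + t) (growth-late g G t))

bounded-start : ∀ c → c ≡ 4900 → Bounded 3 c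
bounded-start c refl K = Block.conclusion 3 4900 K λ m m≤15 →
  ≤-trans (ℕP.*-monoˡ-≤ (14 ^ (24 ∸ m)) (p#-≤ K m≤15))
    (subst (λ m → p# 15 m * 14 ^ (24 ∸ m) ≤ 4900 * 10 ^ (24 ∸ m)) (FinP.toℕ-fromℕ< (s≤s m≤15)) (p#-table (fromℕ< (s≤s m≤15))))

bounded-blocks : ∀ s c g → Bounded s c → ∀ J → (∀ j → j < J → Growth g (suc (j + s))) → Bounded (J + s) (c * g ^ J)
bounded-blocks s c g B zero    G = subst (Bounded s) (sym (ℕP.*-identityʳ c)) B
bounded-blocks s c g B (suc J) G = subst (Bounded (suc J + s)) (trans (ℕP.*-assoc c (g ^ J) g) (cong (c *_) (ℕP.*-comm (g ^ J) g)))
  (next-block (J + s) (c * g ^ J) g (G J (ℕP.n<1+n J)) (bounded-blocks s c g B J λ j j<J → G j (ℕP.m<n⇒m<1+n j<J)))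

bounded⇒≤ : ∀ {s C₀} → Bounded s C₀ → ∀ K m → m ≤ last s → p# K m ≤ C₀
bounded⇒≤ {s} {C₀} bounded K m m≤ = ℕP.*-cancelʳ-≤ (p# K m) C₀ (width s ^ (last s ∸ m))
  {{ℕP.m^n≢0 (width s) (last s ∸ m) {{>-nonZero (≤-trans (1≤base s) (ℕP.m≤m+n (base s) 4))}}}}
  (≤-trans (bounded K m m≤) (ℕP.*-monoʳ-≤ C₀ (ℕP.^-monoˡ-≤ (last s ∸ m) (ℕP.m≤m+n (base s) 4))))

-- The initial slack of 16⁴ over 2 · 4900 pays for the eight factors 20/16, barely: at i = 8 about
-- 2.51 · 10^14 is compared with 2.81 · 10^14.
constants : (i : Fin 9) → 2 * (4900 * 20 ^ toℕ i) ≤ 16 ^ (toℕ i + 4)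
constants = from-yes (FinP.all? {n = 9} λ i → 2 * (4900 * 20 ^ toℕ i) ℕ.≤? 16 ^ (toℕ i + 4))

-- The numerals 16, 4900 and 20 enter as variables, because their powers would be unfolded.
module Constants (b c g : ℕ) (b≡16 : b ≡ 16) (c≡4900 : c ≡ 4900) (g≡20 : g ≡ 20) where

  early-constants : ∀ j → j < 9 → 2 * (c * g ^ j) ≤ b ^ (j + 4)
  early-constants j j<9 = go b≡16 c≡4900 g≡20
    where
    go : b ≡ 16 → c ≡ 4900 → g ≡ 20 → 2 * (c * g ^ j) ≤ b ^ (j + 4)
    go refl refl refl = subst (λ j → 2 * (4900 * 20 ^ j) ≤ 16 ^ (j + 4)) (FinP.toℕ-fromℕ< j<9) (constants (fromℕ< j<9))

  early : ∀ j → j < 9 → Bounded (j + 3) (c * g ^ j)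
  early j j<9 = bounded-blocks 3 c g (bounded-start c c≡4900) j λ i i<j → growth i (≤-trans i<j (ℕP.≤-pred j<9)) g≡20
    where
    growth : ∀ i → i < 8 → g ≡ 20 → Growth g (suc (i + 3))
    growth i i<8 refl = subst (Growth 20) (trans (cong (4 +_) (FinP.toℕ-fromℕ< i<8)) (trans (ℕP.+-comm 4 i) (ℕP.+-suc i 3)))
      (growth-early (fromℕ< i<8))

  late : ∀ t → Bounded (t + 11) (c * g ^ 8 * b ^ t)
  late t = bounded-blocks 11 (c * g ^ 8) b (early 8 ≤-refl) t λ j _ → subst (Growth b) (trans (ℕP.+-comm 12 j) (ℕP.+-suc j 11))
    (growth-late b (subst (λ b → Growth b 12) (sym b≡16) growth-12) j)

  late-constants : ∀ t → 2 * (c * g ^ 8 * b ^ t) ≤ b ^ (t + 12)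
  late-constants t = begin
    2 * (c * g ^ 8 * b ^ t)     ≡⟨ sym (ℕP.*-assoc 2 (c * g ^ 8) (b ^ t)) ⟩
    2 * (c * g ^ 8) * b ^ t     ≤⟨ ℕP.*-monoˡ-≤ (b ^ t) (early-constants 8 ≤-refl) ⟩
    b ^ 12 * b ^ t              ≡⟨ sym (ℕP.^-distribˡ-+-* b 12 t) ⟩
    b ^ (12 + t)                ≡⟨ cong (b ^_) (ℕP.+-comm 12 t) ⟩
    b ^ (t + 12)                ∎
    where open ℕP.≤-Reasoning

  small : ∀ K n B → n ≤ 15 → 2 * p# 15 n ≤ B → 2 * p# K n ≤ B
  small K n B n≤15 = ≤-trans (ℕP.*-monoʳ-≤ 2 (p#-≤ K n≤15))

  table : ∀ n (n<16 : n < 16) → 2 * p# 15 n ≤ 4096 × (n ≤ 8 → 2 * p# 15 n ≤ 256) × (n ≤ 3 → 2 * p# 15 n ≤ 16)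
  table n n<16 = subst (λ n → 2 * p# 15 n ≤ 4096 × (n ≤ 8 → 2 * p# 15 n ≤ 256) × (n ≤ 3 → 2 * p# 15 n ≤ 16))
    (FinP.toℕ-fromℕ< n<16) (p#-small (fromℕ< n<16))

  -- For r = j + 4 the relevant block is s = j + 3, because `last s` = (s+2)² - 1 = (r+1)² - 1.
  -- Blocks up to 11 use the constants with 20, later ones multiply by 16 each.
  large : ∀ j K n → n < (j + 5) * (j + 5) → 2 * p# K n ≤ b ^ (j + 4)
  large j K n n< = case j ℕ.<? 9 of λ where
      (yes j<9) → ≤-trans (ℕP.*-monoʳ-≤ 2 (bounded⇒≤ {j + 3} {c * g ^ j} (early j j<9) K n (n≤ j 3 (solve 1 (λ j → (j :+ con 5) :* (j :+ con 5)
        := con 1 :+ ((j :+ con 3) :* (j :+ con 3) :+ con 4 :* (j :+ con 3) :+ con 3)) refl j) n<))) (early-constants j j<9)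
      (no j≮9)  → beyond (j ∸ 8) (ℕP.m∸n+n≡m (≤-trans (ℕP.n≤1+n 8) (ℕP.≮⇒≥ j≮9)))
    where
    open +-*-Solver
    n≤ : ∀ i a → (j + 5) * (j + 5) ≡ suc (last (i + a)) → n < (j + 5) * (j + 5) → n ≤ last (i + a)
    n≤ i a e n< = ℕP.≤-pred (subst (n <_) e n<)
    beyond : ∀ t → t + 8 ≡ j → 2 * p# K n ≤ b ^ (j + 4)
    beyond t refl = ≤-trans (ℕP.*-monoʳ-≤ 2 (bounded⇒≤ {t + 11} {c * g ^ 8 * b ^ t} (late t) K n (n≤ t 11 (solve 1 (λ t → (t :+ con 8 :+ con 5) :* (t :+ con 8 :+ con 5)
        := con 1 :+ ((t :+ con 11) :* (t :+ con 11) :+ con 4 :* (t :+ con 11) :+ con 3)) refl t) n<)))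
      (≤-trans (late-constants t) (ℕP.≤-reflexive (cong (b ^_) (sym (ℕP.+-assoc t 8 4)))))

  bound : ∀ r K n → 1 ≤ r → n < suc r * suc r → 2 * p# K n ≤ b ^ r
  bound 1 K n _ n<4  = small K n (b ^ 1) n≤15 (subst (λ b → 2 * p# 15 n ≤ b ^ 1) (sym b≡16) (proj₂ (proj₂ (table n (s≤s n≤15))) (ℕP.≤-pred n<4)))
    where n≤15 = ≤-trans (ℕP.≤-pred n<4) (ℕP.m≤m+n 3 12)
  bound 2 K n _ n<9  = small K n (b ^ 2) n≤15 (subst (λ b → 2 * p# 15 n ≤ b ^ 2) (sym b≡16) (proj₁ (proj₂ (table n (s≤s n≤15))) (ℕP.≤-pred n<9)))
    where n≤15 = ≤-trans (ℕP.≤-pred n<9) (ℕP.m≤m+n 8 7)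
  bound 3 K n _ n<16 = small K n (b ^ 3) (ℕP.≤-pred n<16) (subst (λ b → 2 * p# 15 n ≤ b ^ 3) (sym b≡16) (proj₁ (table n n<16)))
  bound (suc (suc (suc (suc j)))) K n _ n< = subst (λ r → 2 * p# K n ≤ b ^ r) (ℕP.+-comm j 4)
    (large j K n (subst (λ r → n < r * r) (ℕP.+-comm 5 j) n<))

partition-bound : ∀ r K n → 1 ≤ r → n < suc r * suc r → 2 * p# K n ≤ 16 ^ r
partition-bound = Constants.bound 16 4900 20 refl refl refl

-- Codes for multisets of types and for partitions.

module Counting {X : Set} (_≟_ : (x y : X) → Dec (x ≡ y)) where

  count : X → List X → ℕ
  count x []       = 0
  count x (y ∷ ys) = when (y ≟ x) 1 + count x ys

  count-++ : ∀ x xs ys → count x (xs ++ ys) ≡ count x xs + count x ys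
  count-++ x []       ys = refl
  count-++ x (y ∷ xs) ys = trans (cong (when (y ≟ x) 1 +_) (count-++ x xs ys)) (sym (ℕP.+-assoc (when (y ≟ x) 1) _ _))

  count-absent : ∀ {x} {xs} → ListAll.All (_≢ x) xs → count x xs ≡ 0
  count-absent []                    = refl
  count-absent {x} {y ∷ _} (y≢x ∷ r) = cong₂ _+_ (when-no (y ≟ x) y≢x 1) (count-absent r)

  count-split : ∀ x ys → 1 ≤ count x ys → ∃₂ λ as bs → ys ≡ as ++ x ∷ bs
  count-split x (y ∷ ys) pos with y ≟ x
  ... | yes refl = [] , ys , refl
  ... | no _ with count-split x ys pos
  ... | as , bs , refl = y ∷ as , bs , refl

  -- The head of the first list occurs in the second by its count; it is cut out there and the
  -- counts of the remainders still agree.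
  same-count⇒↭ : ∀ xs ys → (∀ x → count x xs ≡ count x ys) → xs ↭ ys
  same-count⇒↭ []       []       _ = Perm.refl
  same-count⇒↭ []       (y ∷ ys) e = contradiction (trans (e y) (cong (_+ count y ys) (when-yes (y ≟ y) refl 1))) λ ()
  same-count⇒↭ (x ∷ xs) ys       e with count-split x ys (subst (1 ≤_) (trans (cong (_+ count x xs) (sym (when-yes (x ≟ x) refl 1))) (e x)) (s≤s z≤n))
  ... | as , bs , refl = Perm.trans (Perm.prep x (same-count⇒↭ xs (as ++ bs) rest)) (Perm.↭-sym (PermP.shift x as bs))
    where
    rest : ∀ y → count y xs ≡ count y (as ++ bs)
    rest y = ℕP.+-cancelˡ-≡ (when (x ≟ y) 1) _ _ (trans (e y) (trans (count-++ y as (x ∷ bs))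
      (trans (ℕP.+-comm (count y as) _) (trans (ℕP.+-assoc (when (x ≟ y) 1) (count y bs) _)
        (cong (when (x ≟ y) 1 +_) (trans (ℕP.+-comm (count y bs) _) (sym (count-++ y as bs))))))))

sum-map-+ : ∀ (f g : X → ℕ) xs → sum (List.map (λ x → f x + g x) xs) ≡ sum (List.map f xs) + sum (List.map g xs)
sum-map-+ f g []       = refl
sum-map-+ f g (x ∷ xs) = trans (cong (f x + g x +_) (sum-map-+ f g xs)) (+-interchange (f x) (g x) _ _)

sum-map-0 : ∀ {f : X → ℕ} xs → ListAll.All (λ x → f x ≡ 0) xs → sum (List.map f xs) ≡ 0
sum-map-0 []       _       = refl
sum-map-0 (x ∷ xs) (z ∷ r) = cong₂ _+_ z (sum-map-0 xs r)

sum-map-single : ∀ {f : X → ℕ} {x} xs → Unique xs → x ∈ xs → (∀ y → y ≢ x → f y ≡ 0) → sum (List.map f xs) ≡ f x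
sum-map-single (x ∷ xs) (x∉ ∷ _) (here refl) z = trans (cong (_ +_) (sum-map-0 xs (ListAll.map (λ x≢y → z _ (x≢y ∘ sym)) x∉))) (ℕP.+-identityʳ _)
sum-map-single {f = f} (y ∷ xs) (y∉ ∷ u) (there i) z = trans (cong (_+ sum (List.map f xs)) (z y (ListAll.lookup y∉ i))) (sum-map-single xs u i z)

sum-tabulate-+ : ∀ {n} (f g : Fin n → ℕ) → sum (List.tabulate (λ k → f k + g k)) ≡ sum (List.tabulate f) + sum (List.tabulate g)
sum-tabulate-+ {zero}  f g = refl
sum-tabulate-+ {suc n} f g = trans (cong (f zero + g zero +_) (sum-tabulate-+ (f ∘ suc) (g ∘ suc))) (+-interchange (f zero) (g zero) _ _)

sum-tabulate-cong : ∀ {n} {f g : Fin n → ℕ} → (∀ k → f k ≡ g k) → sum (List.tabulate f) ≡ sum (List.tabulate g)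
sum-tabulate-cong e = cong sum (ListP.tabulate-cong e)

sum-tabulate-0 : ∀ {n} {f : Fin n → ℕ} → (∀ k → f k ≡ 0) → sum (List.tabulate f) ≡ 0
sum-tabulate-0 {zero}  z = refl
sum-tabulate-0 {suc n} z = cong₂ _+_ (z zero) (sum-tabulate-0 (z ∘ suc))

sum-tabulate-single : ∀ {n} {f : Fin n → ℕ} k → (∀ j → j ≢ k → f j ≡ 0) → sum (List.tabulate f) ≡ f k
sum-tabulate-single {f = f} zero    z = trans (cong (f zero +_) (sum-tabulate-0 λ j → z (suc j) λ ())) (ℕP.+-identityʳ _)
sum-tabulate-single {f = f} (suc k) z = trans (cong (_+ sum (List.tabulate (f ∘ suc))) (z zero λ ()))
  (sum-tabulate-single k λ j j≢k → z (suc j) (j≢k ∘ FinP.suc-injective))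

module NatCount = Counting ℕ._≟_

multiplicities : ∀ k → (ℕ → ℕ) → Vec ℕ k
multiplicities zero    f = []
multiplicities (suc k) f = f (suc k) ∷ multiplicities k f

multiplicities-injective : ∀ k {f g} → multiplicities k f ≡ multiplicities k g → ∀ j → 1 ≤ j → j ≤ k → f j ≡ g j
multiplicities-injective zero    e (suc j) _ ()
multiplicities-injective (suc k) e j 1≤j j≤k with ℕP.m≤n⇒m<n∨m≡n j≤k
... | inj₁ j<k  = multiplicities-injective k (VecP.∷-injectiveʳ e) j 1≤j (ℕP.≤-pred j<k)
... | inj₂ refl = VecP.∷-injectiveˡ e

size-multiplicities-+ : ∀ k f g → partition-size (multiplicities k (λ j → f j + g j)) ≡ partition-size (multiplicities k f) + partition-size (multiplicities k g)
size-multiplicities-+ zero    f g = refl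
size-multiplicities-+ (suc k) f g = trans (cong₂ _+_ (ℕP.*-distribʳ-+ (suc k) (f (suc k)) (g (suc k))) (size-multiplicities-+ k f g))
  (+-interchange (f (suc k) * suc k) (g (suc k) * suc k) _ _)

size-multiplicities-0 : ∀ k {f} → (∀ j → j ≤ k → f j ≡ 0) → partition-size (multiplicities k f) ≡ 0
size-multiplicities-0 zero    z = refl
size-multiplicities-0 (suc k) z = cong₂ _+_ (cong (_* suc k) (z (suc k) ≤-refl)) (size-multiplicities-0 k λ j j≤k → z j (ℕP.m≤n⇒m≤1+n j≤k))

size-multiplicities-single : ∀ k x → 1 ≤ x → x ≤ k → partition-size (multiplicities k (λ j → when (x ℕ.≟ j) 1)) ≡ x
size-multiplicities-single zero    (suc x) _ ()
size-multiplicities-single (suc k) x 1≤x x≤k with ℕP.m≤n⇒m<n∨m≡n x≤k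
... | inj₁ x<k  = trans (cong (λ a → a * suc k + partition-size (multiplicities k (λ j → when (x ℕ.≟ j) 1))) (when-no (x ℕ.≟ suc k) (ℕP.<⇒≢ x<k) 1))
                    (size-multiplicities-single k x 1≤x (ℕP.≤-pred x<k))
... | inj₂ refl = trans (cong₂ _+_ (trans (cong (_* suc k) (when-yes (suc k ℕ.≟ suc k) refl 1)) (ℕP.*-identityˡ (suc k)))
                    (size-multiplicities-0 k λ j j≤k → when-no (suc k ℕ.≟ j) (λ e → ℕP.<⇒≢ (s≤s j≤k) (sym e)) 1)) (ℕP.+-identityʳ (suc k))

size-counts : ∀ n xs → ListAll.All (λ x → 1 ≤ x × x ≤ n) xs → partition-size (multiplicities n (λ j → NatCount.count j xs)) ≡ sum xs
size-counts n []       []                = size-multiplicities-0 n λ _ _ → refl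
size-counts n (x ∷ xs) ((1≤x , x≤n) ∷ r) = trans (size-multiplicities-+ n (λ j → when (x ℕ.≟ j) 1) (λ j → NatCount.count j xs))
  (cong₂ _+_ (size-multiplicities-single n x 1≤x x≤n) (size-counts n xs r))

All-≤-sum : ∀ xs → ListAll.All (_≤ sum xs) xs
All-≤-sum []       = []
All-≤-sum (x ∷ xs) = ℕP.m≤m+n x (sum xs) ∷ ListAll.map (λ le → ≤-trans le (ℕP.m≤n+m (sum xs) x)) (All-≤-sum xs)

padded : ℕ → List ℕ → List ℕ
padded r xs = xs ++ List.replicate r 1

sum-padded : ∀ r xs → sum (padded r xs) ≡ sum xs + r
sum-padded r xs = trans (sum-++ xs (List.replicate r 1)) (cong (sum xs +_) (ones r))
  where
  ones : ∀ r → sum (List.replicate r 1) ≡ r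
  ones zero    = refl
  ones (suc r) = cong suc (ones r)

-- Padding with parts 1 to the fixed total n loses nothing, since the number of added parts is known.
padded-counts : ∀ n {r xs ys} → ListAll.All (λ x → 1 ≤ x × x ≤ n) xs → ListAll.All (λ x → 1 ≤ x × x ≤ n) ys →
  multiplicities n (λ j → NatCount.count j (padded r xs)) ≡ multiplicities n (λ j → NatCount.count j (padded r ys)) → xs ↭ ys
padded-counts n {r} {xs} {ys} vx vy e = NatCount.same-count⇒↭ xs ys same
  where
  absent : ∀ {j zs} → ¬ (1 ≤ j × j ≤ n) → ListAll.All (λ x → 1 ≤ x × x ≤ n) zs → NatCount.count j zs ≡ 0
  absent out v = NatCount.count-absent (ListAll.map (λ { b refl → out b }) v)
  same : ∀ j → NatCount.count j xs ≡ NatCount.count j ys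
  same j with (1 ℕ.≤? j) ×-dec (j ℕ.≤? n)
  ... | no out          = trans (absent out vx) (sym (absent out vy))
  ... | yes (1≤j , j≤n) = ℕP.+-cancelʳ-≡ (NatCount.count j (List.replicate r 1)) _ _
        (trans (sym (NatCount.count-++ j xs (List.replicate r 1))) (trans (multiplicities-injective n e j 1≤j j≤n) (NatCount.count-++ j ys (List.replicate r 1))))

pair-≟ : (x y : ℕ × ℕ) → Dec (x ≡ y)
pair-≟ (a , b) (c , d) = map′ (uncurry (cong₂ _,_)) (λ e → cong proj₁ e , cong proj₂ e) ((a ℕ.≟ c) ×-dec (b ℕ.≟ d))

module PairCount = Counting pair-≟

module TypeCodes (n : ℕ) (divisors : ℕ → List ℕ) (divisors-unique : ∀ i → Unique (divisors i)) where
  open PairCount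

  Valid : ℕ × ℕ → Set
  Valid (i , e) = (∃ λ (k : Fin n) → i ≡ suc (toℕ k)) × e ∈ divisors i

  counts-at : List (ℕ × ℕ) → Fin n → List ℕ
  counts-at ts k = List.map (λ d → count (suc (toℕ k) , d) ts) (divisors (suc (toℕ k)))

  code : List (ℕ × ℕ) → Vec (List ℕ) n
  code ts = Vec.tabulate (counts-at ts)

  code-Family : ∀ ts → Family (λ i → List.length (divisors i)) n (code ts)
  code-Family ts k = trans (cong List.length (VecP.lookup∘tabulate (counts-at ts) k)) (ListP.length-map _ (divisors (suc (toℕ k))))

  -- A valid pair (i, e) is counted once, in row i at the position of e, and contributes i. The
  -- weight is thus the total dimension of the invertible part.
  code-weight : ∀ ts → ListAll.All Valid ts → weight (sums (code ts)) ≡ sum (List.map proj₁ ts)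
  code-weight ts valid = trans (weight-tabulate (sums (code ts))) (trans (sum-tabulate-cong λ k → cong (_* suc (toℕ k))
      (trans (VecP.lookup-map k sum (code ts)) (cong sum (VecP.lookup∘tabulate (counts-at ts) k)))) (total ts valid))
    where
    W : List (ℕ × ℕ) → ℕ
    W ts = sum (List.tabulate λ k → sum (counts-at ts k) * suc (toℕ k))
    total : ∀ ts → ListAll.All Valid ts → W ts ≡ sum (List.map proj₁ ts)
    total []             _ = sum-tabulate-0 {n} {λ k → sum (counts-at [] k) * suc (toℕ k)} λ k → cong (_* suc (toℕ k)) (sum-map-0 (divisors (suc (toℕ k))) (ListAll.universal (λ _ → refl) _))
    total ((i , e) ∷ ts) (((k₀ , refl) , e∈) ∷ valid) = trans (sum-tabulate-cong λ k →
        trans (cong (_* suc (toℕ k)) (sum-map-+ (λ d → when (pair-≟ (i , e) (suc (toℕ k) , d)) 1) (λ d → count (suc (toℕ k) , d) ts) (divisors (suc (toℕ k)))))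
          (ℕP.*-distribʳ-+ (suc (toℕ k)) (hits k) _))
      (trans (sum-tabulate-+ (λ k → hits k * suc (toℕ k)) (λ k → sum (counts-at ts k) * suc (toℕ k))) (cong₂ _+_ one (total ts valid)))
      where
      hits : Fin n → ℕ
      hits k = sum (List.map (λ d → when (pair-≟ (i , e) (suc (toℕ k) , d)) 1) (divisors (suc (toℕ k))))
      one : sum (List.tabulate λ k → hits k * suc (toℕ k)) ≡ i
      one = trans (sum-tabulate-single k₀ λ j j≢k₀ → cong (_* suc (toℕ j)) (sum-map-0 (divisors (suc (toℕ j)))
              (ListAll.universal (λ d → when-no (pair-≟ (i , e) (suc (toℕ j) , d)) (λ eq → j≢k₀ (FinP.toℕ-injective (sym (ℕP.suc-injective (cong proj₁ eq))))) 1) _)))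
            (trans (cong (_* i) (trans (sum-map-single (divisors i) (divisors-unique i) e∈ λ d d≢e → when-no (pair-≟ (i , e) (i , d)) (λ eq → d≢e (sym (cong proj₂ eq))) 1)
              (when-yes (pair-≟ (i , e) (i , e)) refl 1))) (ℕP.*-identityˡ i))

  -- The code stores the multiplicity of every valid pair, and invalid pairs occur in neither list.
  code-injective : ∀ {ts us} → ListAll.All Valid ts → ListAll.All Valid us → code ts ≡ code us → ts ↭ us
  code-injective {ts} {us} vt vu e = same-count⇒↭ ts us same
    where
    at-k : ∀ k → counts-at ts k ≡ counts-at us k
    at-k k = trans (sym (VecP.lookup∘tabulate (counts-at ts) k)) (trans (cong (λ M → Vec.lookup M k) e) (VecP.lookup∘tabulate (counts-at us) k))
    map-injective-∈ : ∀ {f g : ℕ → ℕ} xs → List.map f xs ≡ List.map g xs → ∀ {x} → x ∈ xs → f x ≡ g x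
    map-injective-∈ (x ∷ xs) eq (here refl) = ListP.∷-injectiveˡ eq
    map-injective-∈ (x ∷ xs) eq (there i)   = map-injective-∈ xs (ListP.∷-injectiveʳ eq) i
    valid? : ∀ t → Dec (Valid t)
    valid? (i , d) = FinP.any? (λ k → i ℕ.≟ suc (toℕ k)) ×-dec Any.any? (d ℕ.≟_) (divisors i)
    same : ∀ t → count t ts ≡ count t us
    same t@(i , d) with valid? t
    ... | yes ((k , refl) , d∈) = map-injective-∈ (divisors i) (at-k k) d∈
    ... | no ¬v = trans (count-absent (ListAll.map (λ { v refl → ¬v v }) vt)) (sym (count-absent (ListAll.map (λ { v refl → ¬v v }) vu)))

-- The upper bound.

module UpperBound {q : ℕ} (F : FiniteField q) {p k : ℕ} (pr : Prime p) (1≤k : 1 ≤ k) (q≡p^k : q ≡ p ^ k) where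
  open LinAlg F
  open Decomposition F
  open BlockTypes F using (shift)
  open InvertibleTypes F {p} {k} pr q≡p^k
  open LowerBound F {p} {k} pr 1≤k q≡p^k using (fg⇒≃; ≃⇒fg)

  Shifts : List ℕ → Set
  Shifts []       = ⊤
  Shifts (n ∷ ns) = V n × Shifts ns

  shifts : ∀ ns → Shifts ns → Shifts ns
  shifts []       = id
  shifts (n ∷ ns) = shift {n} ⊗ shifts ns

  data Typed : List Block → List (ℕ × ℕ) → Set where
    []  : Typed [] []
    _∷_ : ∀ {n e T L bs ts} → InvertibleType {n} T e → Typed bs ts → Typed ((n , T , L) ∷ bs) ((n , e) ∷ ts)

  shifts-↭ : ∀ {ns ms} → ns ↭ ms → shifts ns ≃ shifts ms
  shifts-↭ Perm.refl         = ≃-refl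
  shifts-↭ (Perm.prep n r)   = ≃-⊗ ≃-refl (shifts-↭ r)
  shifts-↭ (Perm.swap n m r) = ≃-trans ≃-swap (≃-⊗ ≃-refl (≃-⊗ ≃-refl (shifts-↭ r)))
  shifts-↭ (Perm.trans r s)  = ≃-trans (shifts-↭ r) (shifts-↭ s)

  typed-↭ : ∀ {ts us bs} → ts ↭ us → Typed bs ts → ∃ λ cs → Typed cs us × (step bs ≃ step cs)
  typed-↭ Perm.refl         A       = _ , A , ≃-refl
  typed-↭ (Perm.prep t r)   (_∷_ {n} {L = L} A As) with typed-↭ r As
  ... | cs , Bs , iso = (n , _ , L) ∷ cs , A ∷ Bs , ≃-⊗ ≃-refl iso
  typed-↭ (Perm.swap t u r) (_∷_ {n} {L = L} A (_∷_ {m} {L = L′} A′ As)) with typed-↭ r As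
  ... | cs , Bs , iso = (m , _ , L′) ∷ (n , _ , L) ∷ cs , A′ ∷ A ∷ Bs , ≃-trans ≃-swap (≃-⊗ ≃-refl (≃-⊗ ≃-refl iso))
  typed-↭ (Perm.trans r s)  As with typed-↭ r As
  ... | cs , Bs , iso with typed-↭ s Bs
  ... | ds , Cs , iso′ = ds , Cs , ≃-trans iso iso′

  typed-unique : ∀ {ts bs cs} → Typed bs ts → Typed cs ts → step bs ≃ step cs
  typed-unique []                 []                   = ≃-refl
  typed-unique (_∷_ {L = L} A As) (_∷_ {L = L′} B Bs) = ≃-⊗ (same-type L L′ A B) (typed-unique As Bs)

  -- A nilpotent block is reduced to its size, whereas invertible blocks are kept as actual maps
  -- with type (dimension, e); `same-type` shows that the type determines them up to isomorphism.
  record Classified {X : Set} (f : X → X) (d : ℕ) : Set where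
    field
      {sizes}   : List ℕ
      {types}   : List (ℕ × ℕ)
      {blocks}  : List Block
      typed     : Typed blocks types
      iso       : f ≃ (shifts sizes ⊗ step blocks)
      dimension : sum sizes + sum (List.map proj₁ types) ≡ d
      positive  : ListAll.All (1 ≤_) sizes
      positive′ : ListAll.All (λ t → 1 ≤ proj₁ t) types

  classify : ∀ {bs} → Indecomposables bs → Classified (step bs) (total-dim bs)
  classify [] = record { typed = [] ; iso = mk≃ (λ x → x , tt) proj₁ (λ _ → refl) (λ _ → refl) (λ _ → refl)
                       ; dimension = refl ; positive = [] ; positive′ = [] }
  classify (_∷_ {n} {T} {L} (1≤n , ind) inds) = add (indecomposable-type L 1≤n ind) (classify inds)
    where
    add : ∀ {bs} → (T ≃ shift {n}) ⊎ ∃ (InvertibleType T) → Classified (step bs) (total-dim bs) →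
          Classified (step ((n , T , L) ∷ bs)) (n + total-dim bs)
    add (inj₁ shift-iso) C = record
      { typed = C.typed ; iso = ≃-trans (≃-⊗ shift-iso C.iso) (≃-sym ≃-assoc)
      ; dimension = trans (ℕP.+-assoc n _ _) (cong (n +_) C.dimension) ; positive = 1≤n ∷ C.positive ; positive′ = C.positive′ }
      where module C = Classified C
    add (inj₂ (e , A)) C = record
      { typed = _∷_ {L = L} A C.typed ; iso = ≃-trans (≃-⊗ {f = T} ≃-refl C.iso) ≃-swap
      ; dimension = trans (sym (ℕP.+-assoc (sum C.sizes) n _)) (trans (cong (_+ sum (List.map proj₁ C.types)) (ℕP.+-comm (sum C.sizes) n))
          (trans (ℕP.+-assoc n _ _) (cong (n +_) C.dimension)))
      ; positive = C.positive ; positive′ = 1≤n ∷ C.positive′ }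
      where module C = Classified C

  abstract
    classify-map : ∀ {n} {T : V n → V n} → IsLin T → Classified T n
    classify-map {n} {T} L = case decompose n (<-wellFounded n) L of λ where
        (bs , inds , dim-bs , iso) → transport iso dim-bs (classify inds)
      where
      transport : ∀ {bs} → T ≃ step bs → total-dim bs ≡ n → Classified (step bs) (total-dim bs) → Classified T n
      transport iso refl C = record
        { typed = C.typed ; iso = ≃-trans iso C.iso ; dimension = C.dimension ; positive = C.positive ; positive′ = C.positive′ }
        where module C = Classified C

  classified-≃ : ∀ {n} {T S : V n → V n} (A : Classified T n) (B : Classified S n) →
                 Classified.sizes A ↭ Classified.sizes B → Classified.types A ↭ Classified.types B → T ≃ S
  classified-≃ A B sizes types with typed-↭ types (Classified.typed A)
  ... | cs , Cs , iso = ≃-trans (Classified.iso A) (≃-trans (≃-⊗ (shifts-↭ sizes) (≃-trans iso (typed-unique Cs (Classified.typed B)))) (≃-sym (Classified.iso B)))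

  divisors : ℕ → List ℕ
  divisors i = List.filter (λ d → d ∣? (q ^ i ∸ 1)) (range1 (q ^ i ∸ 1))

  divisors-unique : ∀ i → Unique (divisors i)
  divisors-unique i = UniqueP.filter⁺ (λ d → d ∣? (q ^ i ∸ 1)) (UniqueP.map⁺ ℕP.suc-injective (UniqueP.upTo⁺ (q ^ i ∸ 1)))

  1≤q^-1 : ∀ {i} → 1 ≤ i → 1 ≤ q ^ i ∸ 1
  1≤q^-1 {i} 1≤i = ℕP.∸-monoˡ-≤ 1 (≤-trans 1<q (subst (_≤ q ^ i) (ℕP.^-identityʳ q) (ℕP.^-monoʳ-≤ q {{>-nonZero (ℕP.<⇒≤ 1<q)}} 1≤i)))

  ∈-divisors : ∀ {i e} → 1 ≤ i → e ∣ q ^ i ∸ 1 → e ∈ divisors i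
  ∈-divisors {i} {zero}  1≤i e∣ = contradiction (0∣⇒≡0 e∣) (ℕP.>⇒≢ (1≤q^-1 1≤i))
  ∈-divisors {i} {suc e} 1≤i e∣ = ∈-filter⁺ (λ d → d ∣? (q ^ i ∸ 1)) (∈-map⁺ suc (∈-upTo⁺ (∣⇒≤ {{>-nonZero (1≤q^-1 1≤i)}} e∣))) e∣

  -- A type provides e dividing q^d - 1 with d the residue degree; since the dimension is d L, this
  -- makes e a divisor of q^n - 1, as counted by `σ`.
  ∣-power-1 : ∀ {e a} → 1 ≤ a → e ∣ a ∸ 1 → ∀ L → e ∣ a ^ L ∸ 1
  ∣-power-1 1≤a e∣ zero    = _ ∣0
  ∣-power-1 {e} {a} 1≤a e∣ (suc L) = subst (e ∣_) expand (∣m∣n⇒∣m+n (∣-trans (∣-power-1 1≤a e∣ L) (n∣m*n a)) e∣)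
    where
    expand : a * (a ^ L ∸ 1) + (a ∸ 1) ≡ a * a ^ L ∸ 1
    expand = trans (sym (ℕP.+-∸-assoc (a * (a ^ L ∸ 1)) 1≤a)) (cong (_∸ 1) (trans (ℕP.+-comm _ a) (trans (sym (ℕP.*-suc a _))
      (cong (a *_) (ℕP.m+[n∸m]≡n (ℕP.m^n>0 a {{>-nonZero 1≤a}} L))))))

  typed-divides : ∀ {bs ts} → Typed bs ts → ListAll.All (λ t → proj₂ t ∣ q ^ proj₁ t ∸ 1) ts
  typed-divides []                 = []
  typed-divides (_∷_ {e = e} A As) = subst (λ n → e ∣ q ^ n ∸ 1) (sym A.n≡d*L)
      (subst (λ x → e ∣ x ∸ 1) (ℕP.^-*-assoc q A.d A.L) (∣-power-1 (1≤q^ A.d) A.e∣q^d-1 A.L)) ∷ typed-divides As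
    where module A = InvertibleType A

  module _ (n : ℕ) where
    open TypeCodes n divisors divisors-unique

    types-valid : ∀ {T : V n → V n} (C : Classified T n) → ListAll.All Valid (Classified.types C)
    types-valid C = ListAll.zipWith valid (C.positive′ , ListAll.zip (small , typed-divides C.typed))
      where
      module C = Classified C
      small : ListAll.All (λ t → proj₁ t ≤ n) C.types
      small = ListAll.map (λ le → ≤-trans le (≤-trans (ℕP.m≤n+m _ (sum C.sizes)) (ℕP.≤-reflexive C.dimension))) (ListAllP.map⁻ (All-≤-sum (List.map proj₁ C.types)))
      valid : ∀ {t} → 1 ≤ proj₁ t × proj₁ t ≤ n × proj₂ t ∣ q ^ proj₁ t ∸ 1 → Valid t
      valid {suc i , e} (1≤i , i≤n , e∣) = (fromℕ< i≤n , cong suc (sym (FinP.toℕ-fromℕ< i≤n))) , ∈-divisors 1≤i e∣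

    sizes-valid : ∀ {T : V n → V n} (C : Classified T n) → ListAll.All (λ x → 1 ≤ x × x ≤ n) (Classified.sizes C)
    sizes-valid C = ListAll.zip (C.positive , ListAll.map (λ le → ≤-trans le (≤-trans (ℕP.m≤m+n (sum C.sizes) _) (ℕP.≤-reflexive C.dimension))) (All-≤-sum C.sizes))
      where module C = Classified C

    Code : Set
    Code = Vec (List ℕ) n × Vec ℕ n

    ValidCode : Code → Set
    ValidCode (M , μ) = (Family (σ q) n M × weight (sums M) ≤ n) × partition-size μ ≡ n

    encode : ∀ {T : V n → V n} → Classified T n → Code
    encode C = code C.types , multiplicities n (λ j → NatCount.count j (padded (sum (List.map proj₁ C.types)) C.sizes))
      where module C = Classified C

    encode-valid : 1 ≤ n → ∀ {T : V n → V n} (C : Classified T n) → ValidCode (encode C)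
    encode-valid 1≤n C = (code-Family C.types , subst (_≤ n) (sym (code-weight C.types (types-valid C))) (≤-trans (ℕP.m≤n+m _ (sum C.sizes)) (ℕP.≤-reflexive C.dimension)))
        , trans (size-counts n (padded r C.sizes) (ListAllP.++⁺ (sizes-valid C) (ListAllP.replicate⁺ r (≤-refl , 1≤n)))) (trans (sum-padded r C.sizes) C.dimension)
      where
      module C = Classified C
      r = sum (List.map proj₁ C.types)

    -- The number of parts 1 padded to the partition equals the dimension of the invertible part,
    -- which is read off from the first component, so the true block sizes are recovered.
    encode-injective : ∀ {T S : V n → V n} (A : Classified T n) (B : Classified S n) → encode A ≡ encode B → T ≃ S
    encode-injective A B e = classified-≃ A B
        (padded-counts n {r} (sizes-valid A) (sizes-valid B) (trans (cong proj₂ e) (cong (λ r → multiplicities n (λ j → NatCount.count j (padded r B.sizes))) (sym r≡))))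
        (code-injective (types-valid A) (types-valid B) (cong proj₁ e))
      where
      module A = Classified A
      module B = Classified B
      r = sum (List.map proj₁ A.types)
      r≡ : r ≡ sum (List.map proj₁ B.types)
      r≡ = trans (sym (code-weight A.types (types-valid A))) (trans (cong (weight ∘ sums) (cong proj₁ e)) (code-weight B.types (types-valid B)))

    zeros : Vec (List ℕ) n
    zeros = Vec.tabulate (λ k → List.replicate (σ q (suc (toℕ k))) 0)

    lookup-zeros : ∀ k → Vec.lookup zeros k ≡ List.replicate (σ q (suc (toℕ k))) 0
    lookup-zeros = VecP.lookup∘tabulate _

    sum-zeros : ∀ m → sum (List.replicate m 0) ≡ 0
    sum-zeros zero    = refl
    sum-zeros (suc m) = sum-zeros m

    sums-zeros : sums zeros ≡ Vec.replicate n 0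
    sums-zeros = trans (sym (VecP.tabulate∘lookup _)) (trans (VecP.tabulate-cong λ k →
      trans (VecP.lookup-map k sum zeros) (trans (cong sum (lookup-zeros k)) (trans (sum-zeros (σ q (suc (toℕ k)))) (sym (VecP.lookup-replicate k 0))))) (VecP.tabulate∘lookup _))

    sum≡0⇒zeros : ∀ xs → sum xs ≡ 0 → xs ≡ List.replicate (List.length xs) 0
    sum≡0⇒zeros []          _ = refl
    sum≡0⇒zeros (zero ∷ xs) e = cong (0 ∷_) (sum≡0⇒zeros xs e)

    weight-zero : weight (Vec.replicate n 0) ≤ n
    weight-zero = subst (_≤ n) (sym (trans (weight-tabulate (Vec.replicate n 0)) (sum-tabulate-0 {n} {λ k → Vec.lookup (Vec.replicate n 0) k * suc (toℕ k)} λ k → cong (_* suc (toℕ k)) (VecP.lookup-replicate k 0)))) z≤n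

    -- The zero vector, excluded from `P n`, belongs to a single family, the one with all
    -- multiplicities zero: the case of a nilpotent map.
    card-valid-families : Card (λ M → Family (σ q) n M × weight (sums M) ≤ n) (sumP (σ q) n + 1)
    card-valid-families = card-⇔ (card-⊎ (card-families (σ q) n)
        (card-single {P = zeros ≡_} zeros refl (λ _ → id)) (λ { M (_ , ne , _) refl → ne sums-zeros }))
      (λ { M (inj₁ (fam , _ , le)) → fam , le
         ; M (inj₂ refl) → (λ k → trans (cong List.length (lookup-zeros k)) (ListP.length-replicate (σ q (suc (toℕ k))))) , subst (λ v → weight v ≤ n) (sym sums-zeros) weight-zero })
      (λ M (fam , le) → case VecP.≡-dec ℕ._≟_ (sums M) (Vec.replicate n 0) of λ
         { (no ne) → inj₁ (fam , ne , le) ; (yes e) → inj₂ (sym (all-zero M fam e)) })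
      where
      all-zero : ∀ M → Family (σ q) n M → sums M ≡ Vec.replicate n 0 → M ≡ zeros
      all-zero M fam e = trans (sym (VecP.tabulate∘lookup M)) (VecP.tabulate-cong λ k →
        trans (sum≡0⇒zeros (Vec.lookup M k) (trans (sym (VecP.lookup-map k sum M)) (trans (cong (λ v → Vec.lookup v k) e) (VecP.lookup-replicate k 0))))
              (cong (λ m → List.replicate m 0) (fam k)))

    classes-≤ : 1 ≤ n → ∀ A → NumFGClasses F n A → A ≤ (sumP (σ q) n + 1) * p# n n
    classes-≤ 1≤n A (rep , distinct , _) = card-≤ {Q = ValidCode} (card-Fin A) (card-× card-valid-families (card-p# n n))
      (λ i → encode (C i)) (λ i _ → encode-valid 1≤n (C i))
      λ i j _ _ e → distinct i j (≃⇒fg (encode-injective (C i) (C j) e))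
      where
      C : ∀ i → Classified (proj₁ (rep i)) n
      C i = classify-map (proj₂ (rep i))

  -- One block of dimension 1 already gives a family, since q - 1 has a divisor. Hence S + 1 ≤ 2 S
  -- for the sum S.
  1≤sumP : ∀ n → 1 ≤ n → 1 ≤ sumP (σ q) n
  1≤sumP n@(suc n′) 1≤n = card-≤ (card-single {P = tt ≡_} tt refl (λ _ → id)) (card-families (σ q) n) (λ _ → M) (λ _ _ → fam , nonzero , le) (λ _ _ _ _ _ → refl)
    where
    one : ∀ m → List ℕ
    one zero    = []
    one (suc m) = 1 ∷ List.replicate m 0
    length-one : ∀ m → List.length (one m) ≡ m
    length-one zero    = refl
    length-one (suc m) = cong suc (ListP.length-replicate m)
    sum-one : ∀ {m} → 1 ≤ m → sum (one m) ≡ 1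
    sum-one {suc m} _ = cong suc (sum-zeros n m)
    1≤σ : 1 ≤ σ q 1
    1≤σ = nonempty (∈-divisors {1} {1} ≤-refl (1∣ (q ^ 1 ∸ 1)))
      where
      nonempty : ∀ {x} {xs : List ℕ} → x ∈ xs → 1 ≤ List.length xs
      nonempty (here _)  = s≤s z≤n
      nonempty (there _) = s≤s z≤n
    M : Vec (List ℕ) n
    M = one (σ q 1) ∷ Vec.tail (zeros n)
    fam : Family (σ q) n M
    fam zero    = length-one (σ q 1)
    fam (suc k) = trans (cong List.length (lookup-zeros n (suc k))) (ListP.length-replicate (σ q (suc (suc (toℕ k)))))
    tail-zero : sums (Vec.tail (zeros n)) ≡ Vec.replicate n′ 0
    tail-zero = cong Vec.tail (sums-zeros n)
    nonzero : sums M ≢ Vec.replicate n 0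
    nonzero e = case trans (sym (sum-one 1≤σ)) (VecP.∷-injectiveˡ e) of λ ()
    le : weight (sums M) ≤ n
    le = subst (_≤ n) (sym (trans (weight-tabulate (sums M)) (cong₂ _+_ (trans (cong (_* 1) (sum-one 1≤σ)) refl)
      (sum-tabulate-0 λ k → cong (_* suc (suc (toℕ k))) (trans (cong (λ v → Vec.lookup v k) tail-zero) (VecP.lookup-replicate k 0)))))) (s≤s z≤n)

-- Integer square roots and the final estimate.

floor-sqrt : ∀ n → ∃ λ r → r * r ≤ n × n < suc r * suc r
floor-sqrt zero    = 0 , z≤n , s≤s z≤n
floor-sqrt (suc n) with floor-sqrt n
... | r , lo , hi with suc r * suc r ℕ.≤? suc n
... | yes le = suc r , le , ≤-trans (s≤s hi) (ℕP.*-mono-< (ℕP.n<1+n (suc r)) (ℕP.n<1+n (suc r)))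
... | no ¬le = r , ℕP.m≤n⇒m≤1+n lo , ℕP.≰⇒> ¬le

-- The real bound 2^(4√n) is expressed by all rationals m/t above 4√n, that is, with 16 n t² < m².
-- From r ≤ √n follows 4 r t ≤ m, and 16^r = 2^(4r).
power-estimate : ∀ {A S n r m t} → A ≤ S * 16 ^ r → r * r ≤ n → 16 * n * (t ^ 2) < m ^ 2 → A ^ t ≤ 2 ^ m * S ^ t
power-estimate {A} {S} {n} {r} {m} {t} A≤ r² m² = begin
  A ^ t                       ≤⟨ ℕP.^-monoˡ-≤ t A≤ ⟩
  (S * 16 ^ r) ^ t            ≡⟨ *-^ S (16 ^ r) t ⟩
  S ^ t * (16 ^ r) ^ t        ≡⟨ cong (λ x → S ^ t * x ^ t) (ℕP.^-*-assoc 2 4 r) ⟩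
  S ^ t * (2 ^ (4 * r)) ^ t   ≡⟨ cong (S ^ t *_) (ℕP.^-*-assoc 2 (4 * r) t) ⟩
  S ^ t * 2 ^ (4 * r * t)     ≤⟨ ℕP.*-monoʳ-≤ (S ^ t) (ℕP.^-monoʳ-≤ 2 (square-cancel-≤ (4 * r * t) m (begin
      4 * r * t * (4 * r * t)   ≡⟨ solve 2 (λ r t → con 4 :* r :* t :* (con 4 :* r :* t) := con 16 :* (r :* r) :* (t :^ 2)) refl r t ⟩
      16 * (r * r) * t ^ 2      ≤⟨ ℕP.*-monoˡ-≤ (t ^ 2) (ℕP.*-monoʳ-≤ 16 r²) ⟩
      16 * n * t ^ 2            ≤⟨ ℕP.<⇒≤ m² ⟩
      m ^ 2                     ≡⟨ cong (m *_) (ℕP.*-identityʳ m) ⟩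
      m * m                     ∎))) ⟩
  S ^ t * 2 ^ m               ≡⟨ ℕP.*-comm (S ^ t) (2 ^ m) ⟩
  2 ^ m * S ^ t               ∎
  where
  open ℕP.≤-Reasoning
  open +-*-Solver

theorem1 : (q : ℕ) → IsPrimePower q → (F : FiniteField q) → (n : ℕ) → 1 ≤ n →
    (A : ℕ) → NumFGClasses F n A →
    (sumP (σ* q) n ≤ A)
    × ((m p : ℕ) → 1 ≤ p → 16 * n * (p ^ 2) < m ^ 2 → A ^ p ≤ 2 ^ m * (sumP (σ q) n) ^ p)
theorem1 q (p , k , pr , 1≤k , q≡p^k) F n 1≤n A classes =
    LowerBound.lower-bound F {p} {k} pr 1≤k q≡p^k n A classes , upper (floor-sqrt n)
  where
  open UpperBound F {p} {k} pr 1≤k q≡p^k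
  S = sumP (σ q) n
  upper : (∃ λ r → r * r ≤ n × n < suc r * suc r) → (m t : ℕ) → 1 ≤ t → 16 * n * (t ^ 2) < m ^ 2 → A ^ t ≤ 2 ^ m * S ^ t
  -- As n ≥ 1, its integer square root is positive, which `partition-bound` requires.
  upper (zero  , _  , n<1) m t _ _  = contradiction (≤-trans n<1 1≤n) (ℕP.<⇒≱ (ℕP.n<1+n _))
  upper (suc r , r² , n<) m t _ m² = power-estimate {A} {S} {n} {suc r} {m} {t} (begin
      A                     ≤⟨ classes-≤ n 1≤n A classes ⟩
      (S + 1) * p# n n      ≤⟨ ℕP.*-monoˡ-≤ (p# n n) (ℕP.+-monoʳ-≤ S (1≤sumP n 1≤n)) ⟩
      (S + S) * p# n n      ≡⟨ solve 2 (λ s p → (s :+ s) :* p := s :* (con 2 :* p)) refl S (p# n n) ⟩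
      S * (2 * p# n n)      ≤⟨ ℕP.*-monoʳ-≤ S (partition-bound (suc r) n n (s≤s z≤n) n<) ⟩
      S * 16 ^ suc r        ∎) r² m²
    where
    open ℕP.≤-Reasoning
    open +-*-Solver
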